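{- Let $n$ be a positive integer with $n\equiv 1\pmod 4$, let $a,b$ be indeterminates, and let $M=(n-1)/2$ or $M=n-1$. Then, modulo $[n](1-aq^n)(a-q^n)(1-bq^n)(b-q^n)$, \[ \sum_{k=0}^{M}[6k+1]\frac{(aq,q/a;q^2)_k(q^2,bq,q/b;q^4)_k}{(q^4,q^4/a,aq^4;q^4)_k(q^2/b,bq^2;q^2)_k}q^{2k} \equiv\frac{(1-aq^n)(a-q^n)(-1-b^2+bq^n)}{(b-a)(1-ba)}\frac{(q^5,aq^2,q^2/a;q^4)_{(n-1)/4}}{(q,q^4/a,aq^4;q^4)_{(n-1)/4}} +\frac{(1-bq^n)(b-q^n)(-1-a^2+aq^n)}{(a-b)(1-ab)}\frac{(q^5,bq^2,q^2/b;q^4)_{(n-1)/4}}{(q,q^4/b,bq^4;q^4)_{(n-1)/4}}. \]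
   Context: For $x$ and integer $n\ge 0$, $(x;q)_n=\prod_{j=0}^{n-1}(1-xq^j)$, and $(x_1,\dots,x_m;q)_n=(x_1;q)_n\cdots(x_m;q)_n$. $[r]=(1-q^r)/(1-q)$ is the $q$-integer. A congruence modulo a polynomial $P$ in $q,a,b$ between rational functions whose denominators are coprime to $P$ means that the difference is a rational function whose numerator is divisible by $P$ and whose denominator is coprime to $P$. -}

module Defs where

open import Data.Nat as ℕ using (ℕ; zero; suc; _≡ᵇ_)
open import Data.Integer as ℤ using (ℤ; 0ℤ; 1ℤ)
open import Data.Bool using (Bool; if_then_else_; _∧_)
open import Data.List using (List; []; _∷_; _++_; map; concatMap)
open import Data.Product using (_×_; _,_; ∃; Σ)
open import Relation.Binary.PropositionalEquality using (_≡_)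

-- Polynomials in ℤ[q, a, b], represented as finite lists of monomials
-- (c , i , j , k)  ↦  c · q^i a^j b^k.  Equality is equality of all
-- coefficients (so the representation is irrelevant).

Mono : Set
Mono = ℤ × ℕ × ℕ × ℕ

Poly : Set
Poly = List Mono

coeff : Poly → ℕ → ℕ → ℕ → ℤ
coeff [] i j k = 0ℤ
coeff ((c , x , y , z) ∷ p) i j k =
  (if (x ≡ᵇ i) ∧ ((y ≡ᵇ j) ∧ (z ≡ᵇ k)) then c else 0ℤ) ℤ.+ coeff p i j k

infix 4 _≈P_ _∣P_
infixl 6 _+P_ _-P_
infixl 7 _*P_

_≈P_ : Poly → Poly → Set
p ≈P r = ∀ i j k → coeff p i j k ≡ coeff r i j k

_+P_ : Poly → Poly → Poly
p +P r = p ++ r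

negP : Poly → Poly
negP = map (λ { (c , x , y , z) → (ℤ.- c , x , y , z) })

_-P_ : Poly → Poly → Poly
p -P r = p +P negP r

mulM : Mono → Mono → Mono
mulM (c , x , y , z) (c' , x' , y' , z') = (c ℤ.* c' , x ℕ.+ x' , y ℕ.+ y' , z ℕ.+ z')

_*P_ : Poly → Poly → Poly
p *P r = concatMap (λ m → map (mulM m) r) p

constP : ℤ → Poly
constP c = (c , 0 , 0 , 0) ∷ []

zeroP oneP qP aP bP : Poly
zeroP = []
oneP = constP 1ℤ
qP = (1ℤ , 1 , 0 , 0) ∷ []
aP = (1ℤ , 0 , 1 , 0) ∷ []
bP = (1ℤ , 0 , 0 , 1) ∷ []

_^P_ : Poly → ℕ → Poly
p ^P zero = oneP
p ^P suc m = (p ^P m) *P p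

_∣P_ : Poly → Poly → Set
g ∣P p = ∃ λ h → g *P h ≈P p

IsConst : Poly → Set
IsConst g = ∀ i j k → 0 ℕ.< i ℕ.+ j ℕ.+ k → coeff g i j k ≡ 0ℤ

CoprimeP : Poly → Poly → Set
CoprimeP f g = ∀ h → h ∣P f → h ∣P g → IsConst h

qintPoly : ℕ → Poly
qintPoly zero = zeroP
qintPoly (suc m) = qintPoly m +P (qP ^P m)

record Frac : Set where
  constructor frac
  field
    num : Poly
    den : Poly
open Frac public

infixl 6 _+F_ _-F_
infixl 7 _*F_ _/F_

fromP : Poly → Frac
fromP p = frac p oneP

oneF : Frac
oneF = fromP oneP

_+F_ : Frac → Frac → Frac
frac n₁ d₁ +F frac n₂ d₂ = frac (n₁ *P d₂ +P n₂ *P d₁) (d₁ *P d₂)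

_-F_ : Frac → Frac → Frac
frac n₁ d₁ -F frac n₂ d₂ = frac (n₁ *P d₂ -P n₂ *P d₁) (d₁ *P d₂)

_*F_ : Frac → Frac → Frac
frac n₁ d₁ *F frac n₂ d₂ = frac (n₁ *P n₂) (d₁ *P d₂)

_/F_ : Frac → Frac → Frac
frac n₁ d₁ /F frac n₂ d₂ = frac (n₁ *P d₂) (d₁ *P n₂)

_^F_ : Frac → ℕ → Frac
x ^F zero = oneF
x ^F suc m = (x ^F m) *F x

qF aF bF : Frac
qF = fromP qP
aF = fromP aP
bF = fromP bP

poch : Frac → Frac → ℕ → Frac
poch x s zero = oneF
poch x s (suc m) = poch x s m *F (oneF -F x *F (s ^F m))

qint : ℕ → Frac
qint r = (oneF -F qF ^F r) /F (oneF -F qF)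

sumTo : (ℕ → Frac) → ℕ → Frac
sumTo f zero = f 0
sumTo f (suc m) = sumTo f m +F f (suc m)

-- Congruence of rational functions modulo a polynomial P:
-- X - Y = P·N / D with D coprime to P, i.e. (X - Y)·D = P·N.
CongF : Frac → Frac → Poly → Set
CongF (frac n₁ d₁) (frac n₂ d₂) P =
  Σ Poly λ N → Σ Poly λ D →
    CoprimeP D P × ((n₁ *P d₂ -P n₂ *P d₁) *P D ≈P (P *P N) *P (d₁ *P d₂))

lhsTerm : ℕ → Frac
lhsTerm k =
  qint (6 ℕ.* k ℕ.+ 1)
  *F (poch (aF *F qF) (qF ^F 2) k *F poch (qF /F aF) (qF ^F 2) k
      *F poch (qF ^F 2) (qF ^F 4) k *F poch (bF *F qF) (qF ^F 4) k
      *F poch (qF /F bF) (qF ^F 4) k)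
  /F (poch (qF ^F 4) (qF ^F 4) k *F poch ((qF ^F 4) /F aF) (qF ^F 4) k
      *F poch (aF *F (qF ^F 4)) (qF ^F 4) k
      *F poch ((qF ^F 2) /F bF) (qF ^F 2) k *F poch (bF *F (qF ^F 2)) (qF ^F 2) k)
  *F (qF ^F (2 ℕ.* k))

lhs : ℕ → Frac
lhs M = sumTo lhsTerm M

rhsPart : Frac → Frac → ℕ → Frac
rhsPart x y n =
  ((oneF -F x *F qF ^F n) *F (x -F qF ^F n)
     *F ((oneF -F oneF) -F oneF -F y ^F 2 +F y *F qF ^F n))
  /F ((y -F x) *F (oneF -F y *F x))
  *F ((poch (qF ^F 5) (qF ^F 4) m *F poch (x *F qF ^F 2) (qF ^F 4) m
        *F poch ((qF ^F 2) /F x) (qF ^F 4) m)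
      /F (poch qF (qF ^F 4) m *F poch ((qF ^F 4) /F x) (qF ^F 4) m
        *F poch (x *F qF ^F 4) (qF ^F 4) m))
  where
  m = (n ℕ.∸ 1) ℕ./ 4

rhs : ℕ → Frac
rhs n = rhsPart aF bF n +F rhsPart bF aF n

modulus : ℕ → Poly
modulus n = qintPoly n *P (oneP -P aP *P qP ^P n) *P (aP -P qP ^P n)
              *P (oneP -P bP *P qP ^P n) *P (bP -P qP ^P n)

{-# OPTIONS --safe #-}

-- Both sides are compared modulo (1 − a q^n)(a − q^n), modulo (1 − b q^n)(b − q^n) and modulo [n]
-- separately. For a = q^(±n) and for b = q^(±n) the left-hand side terminates, and it is summed by
-- telescoping (WZ) certificates in the parameters q^n → q^(n+4). Modulo [n] one may assume that q is
-- a root of unity of exact order m > 1 dividing n; the sum then splits into blocks of length m that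
-- are proportional to the first one, and the first block is a terminating series whose product
-- evaluation contains the factor 1 − q^m. The three congruences combine because
-- q^n (b − a)(1 − a b) and (1 − a)²(1 − b)² lie in the respective sums of ideals.
module Submission where

open import Defs
open import Algebra.Bundles using (CommutativeRing)
open import Data.Bool using (Bool; true; false; if_then_else_; _∧_; T)
open import Data.Bool.Properties using (∧-zeroʳ; ∧-comm; ∧-assoc)
open import Data.Empty using (⊥-elim)
open import Data.Fin using (Fin; zero; suc)
open import Data.Integer as ℤ using (ℤ; 0ℤ; 1ℤ)
import Data.Integer.Properties as ℤₚ
open import Data.List using (List; []; _∷_; _++_; map; length; null)
import Data.List.Properties as Listₚ
open import Data.List.Relation.Unary.All as All using (All; []; _∷_)
import Data.List.Relation.Unary.All.Properties as Allₚ
open import Data.Nat as ℕ using (ℕ; zero; suc; _∸_; _/_; _%_; _≤_; _<_; z≤n; s≤s; _≡ᵇ_; _<ᵇ_)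
open import Data.Nat.DivMod using (m≡m%n+[m/n]*n; m%n<n; m*n/n≡m)
open import Data.Nat.Divisibility using (_∣_; divides)
import Data.Nat.Properties as ℕₚ
open import Algebra.Properties.CommutativeSemigroup ℕₚ.+-commutativeSemigroup using () renaming (interchange to ℕ-interchange)
open import Data.Nat.Solver using (module +-*-Solver)
open import Data.Product using (_×_; _,_; ∃; proj₁; proj₂)
open import Data.Sign as Sign using ()
open import Data.Sum using (_⊎_; inj₁; inj₂; [_,_]′)
open import Data.Vec as Vec using (Vec; []; _∷_; lookup; replicate; zipWith; updateAt)
open import Data.Vec.N-ary using (N-ary; Eq; curryⁿ; _$ⁿ_; curryⁿ-cong)
open import Function using (_∘_; _⟨_⟩_)
open import Level using (0ℓ)
open import Relation.Binary using (tri<; tri≈; tri>)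
open import Relation.Binary.PropositionalEquality as ≡ using (_≡_; _≢_)
open import Relation.Nullary using (¬_; yes; no; contradiction)

-- The sum is Gasper and Rahman's quadratic series with factors (d, f, g; q⁴)_k, d f g = q⁴, at (d,
-- f, g) = (q², bq, q/b). For b = q^(±n) it terminates through bq or q/b, and at a root of unity of
-- order 2h′ + 1 through q² = q^(-4h′); one certificate with a free d serves both (`SumB`, `SumC`).
-- For a = q^(±n) it terminates through (aq, q/a; q²)_k, which needs a second certificate
-- (`OddSum`). The obstacle is division: factors of (q⁴; q⁴)_k can share divisors with [n]. So (q²;
-- q⁴)_k / (q⁴; q⁴)_k is rewritten as a central q-binomial coefficient over ∏ (1 + q^(2j))², which
-- is coprime to the modulus, and sums are kept as polynomial numerators over product denominators.
-- No cyclotomic factorization is used: an ideal containing 1 - q^n is split by adjoining 1 - q^j or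
-- (1 - q^(jn))/(1 - q^j), for growing j, until the order of q is exact. Coprimality needs no gcd:
-- for each variable, a nonzero combination of both polynomials free of that variable shows that no
-- common divisor involves it.

module S = +-*-Solver

-- Formulas over any signature of ring operations

module Formulas {A : Set} (_+_ _*_ : A → A → A) (-_ : A → A) (0# 1# : A) where

  infixl 6 _−_
  _−_ : A → A → A
  x − y = x + (- y)

  sq : A → A
  sq x = x * x

  pw : A → ℕ → A
  pw x zero    = 1#
  pw x (suc k) = pw x k * x

  ∏ : (ℕ → A) → ℕ → A
  ∏ f zero    = 1#
  ∏ f (suc k) = ∏ f k * f k

  -- hor w P δ n / ∏ δ n = Σ_{k<n} w k P k / ∏ δ k, in Horner form.
  hor : (w P δ : ℕ → A) → ℕ → A
  hor w P δ zero    = 0#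
  hor w P δ (suc k) = (hor w P δ k + (w k * P k)) * δ k

  -- Equal to x (1 - xy)(1 - y/x), hence unchanged under x → 1/x up to a power of x. In the summand
  -- a and b enter only through such pairs.
  pair : A → A → A
  pair x y = (x − y) * (1# − (x * y))

  -- (1 − q^(6k+1)) q^(2k) at K = q^(2k).
  wt : A → A → A
  wt q K = (1# − (q * (K * sq K))) * K

  -- At K = q^(2k), gν/gδ is the term ratio of the quadratic series with factors (d, f, g; q⁴)_k, where d f g = q⁴ and
  -- f = L^(−2). For L = q^(2N) the series ends at k = N, and raising N by 1 multiplies its sum by Y₁ Y₂ / (X₁ X₂).
  module _ (q a d : A) where

    μ : A → A
    μ K = (pair a (q * K) * (1# − (q * K))) * (1# − (d * sq K))

    gν : A → A → A
    gν L K = ((q * μ K) * (sq L − sq K)) * (d − (sq L * sq (K * sq q)))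

    z : A → A
    z K = ((1# − sq K) * pair a (sq K)) * (d − (q * K))

    gδ : A → A → A
    gδ L K = (z (K * sq q) * (1# − ((sq L * q) * (K * sq q)))) * ((sq L * q) − (d * K))

    X₁ X₂ Y₁ Y₂ : A → A
    X₁ u = ((u * q) − d) * (u − (d * q))
    X₂ u = pair a u
    Y₁ u = pair q u
    Y₂ u = (d − (a * u)) * ((a * d) − u)

    c₁ : A → A
    c₁ u = - (u * (d − sq u))

  module _ (q a b : A) where

    -- At K = q^(2k), `oν`/`oδ` is the ratio of consecutive terms of the sum without the weight
    -- `wt`; both are multiplied by ab to clear 1/a and 1/b.
    oν : A → A
    oν K = (pair a (q * K) * (1# − (sq q * sq K))) * pair b (q * sq K)

    oδ : A → A
    oδ K = ((1# − sq (K * sq q)) * pair a (sq (K * sq q))) * pair b (K * sq q)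

  q^4k+1 : A → ℕ → A
  q^4k+1 q zero    = q
  q^4k+1 q (suc k) = q^4k+1 q k * sq (sq q)

  -- The Gaussian binomial coefficient of i + j over i in base p. Pascal's rule makes it a
  -- polynomial from the start.
  gauss : A → ℕ → ℕ → A
  gauss p zero    j       = 1#
  gauss p (suc i) zero    = 1#
  gauss p (suc i) (suc j) = gauss p i (suc j) + (pw p (suc i) * gauss p (suc i) j)

  q-int : A → ℕ → A
  q-int q zero    = 0#
  q-int q (suc k) = q-int q k + pw q k

  -- (q²; q⁴)_k / (q⁴; q⁴)_k equals `C k` over the product of (1 + q^(2j))² for 1 ≤ j ≤ k. This
  -- removes from the denominators the factors 1 - q^(4j), which can share divisors with [n].
  module Reduced (q a b : A) where

    K : ℕ → A
    K = pw (sq q)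

    W : ℕ → A
    W k = q-int q (6 ℕ.* k ℕ.+ 1) * K k

    C : ℕ → A
    C k = gauss (sq q) k k

    numer denom : ℕ → A
    numer k = pair a (q * K k) * pair b (q * sq (K k))
    denom k = sq (1# + K (suc k)) * (pair a (sq (K (suc k))) * pair b (K (suc k)))

    P D U : ℕ → A
    P k = C k * ∏ numer k
    D = ∏ denom
    U = hor W P denom

-- A reflective ring solver, certificates, regular elements

module RingReasoning (R : CommutativeRing 0ℓ 0ℓ) where

  open import Data.Integer using (+_; -[1+_]; _◃_; _⊖_)
  open CommutativeRing R hiding (zero)
  open import Algebra.Properties.Ring ring using (-‿distribˡ-*; -‿distribʳ-*; -‿involutive; -0#≈0#; -‿+-comm)
  open import Algebra.Properties.Semiring.Mult semiring using (×-homo-+; ×1-homo-*) renaming (_×_ to _∙_)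
  open import Algebra.Properties.CommutativeSemigroup +-commutativeSemigroup using () renaming (interchange to +-interchange)
  open import Algebra.Properties.CommutativeSemigroup *-commutativeSemigroup using () renaming (interchange to *-interchange)
  open import Relation.Binary.Reasoning.Setoid setoid

  infixl 7 _:+_ _:-_
  infix  9 :-_
  infixl 8 _:*_
  infix  4 _:=_

  data Expr (n : ℕ) : Set where
    var     : Fin n → Expr n
    :0 :1     : Expr n
    _:+_ _:*_ : Expr n → Expr n → Expr n
    :-_     : Expr n → Expr n

  _:-_ : ∀ {n} → Expr n → Expr n → Expr n
  x :- y = x :+ :- y

  -- Instantiating the formulas at expressions lets a solver goal quote them by name instead of
  -- spelling out their bodies.
  module E {n} = Formulas (_:+_ {n}) _:*_ :-_ :0 :1

  _:=_ : ∀ {n} → Expr n → Expr n → Expr n × Expr n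
  _:=_ = _,_

  private
    variable
      n : ℕ

  ⟦_⟧ : Expr n → Vec Carrier n → Carrier
  ⟦ var i ⟧ ρ = lookup ρ i
  ⟦ :0 ⟧     ρ = 0#
  ⟦ :1 ⟧     ρ = 1#
  ⟦ x :+ y ⟧ ρ = ⟦ x ⟧ ρ + ⟦ y ⟧ ρ
  ⟦ x :* y ⟧ ρ = ⟦ x ⟧ ρ * ⟦ y ⟧ ρ
  ⟦ :- x ⟧  ρ = - ⟦ x ⟧ ρ

  ⟪_⟫ : ℤ → Carrier
  ⟪ + n ⟫      = n ∙ 1#
  ⟪ -[1+ n ] ⟫ = - (suc n ∙ 1#)

  ⟪⟫-⊖ : ∀ m n → ⟪ m ⊖ n ⟫ ≈ m ∙ 1# + - (n ∙ 1#)
  ⟪⟫-⊖ m       zero    = sym (trans (+-congˡ -0#≈0#) (+-identityʳ _))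
  ⟪⟫-⊖ zero    (suc n) = sym (+-identityˡ _)
  ⟪⟫-⊖ (suc m) (suc n) = begin
    ⟪ suc m ⊖ suc n ⟫                  ≡⟨ ≡.cong ⟪_⟫ (ℤₚ.[1+m]⊖[1+n]≡m⊖n m n) ⟩
    ⟪ m ⊖ n ⟫                          ≈⟨ ⟪⟫-⊖ m n ⟩
    m ∙ 1# + - (n ∙ 1#)                ≈⟨ +-identityˡ _ ⟨
    0# + (m ∙ 1# + - (n ∙ 1#))         ≈⟨ +-congʳ (-‿inverseʳ 1#) ⟨
    (1# + - 1#) + (m ∙ 1# + - (n ∙ 1#)) ≈⟨ +-interchange _ _ _ _ ⟩
    (1# + m ∙ 1#) + (- 1# + - (n ∙ 1#)) ≈⟨ +-congˡ (-‿+-comm _ _) ⟩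
    suc m ∙ 1# + - (suc n ∙ 1#)        ∎

  ⟪⟫-+ : ∀ i j → ⟪ i ℤ.+ j ⟫ ≈ ⟪ i ⟫ + ⟪ j ⟫
  ⟪⟫-+ (+ m)    (+ n)    = ×-homo-+ 1# m n
  ⟪⟫-+ (+ m)    -[1+ n ] = ⟪⟫-⊖ m (suc n)
  ⟪⟫-+ -[1+ m ] (+ n)    = trans (⟪⟫-⊖ n (suc m)) (+-comm _ _)
  ⟪⟫-+ -[1+ m ] -[1+ n ] = begin
    - (suc (suc (m ℕ.+ n)) ∙ 1#)     ≡⟨ ≡.cong (λ k → - (suc k ∙ 1#)) (ℕₚ.+-suc m n) ⟨
    - ((suc m ℕ.+ suc n) ∙ 1#)       ≈⟨ -‿cong (×-homo-+ 1# (suc m) (suc n)) ⟩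
    - (suc m ∙ 1# + suc n ∙ 1#)      ≈⟨ -‿+-comm _ _ ⟨
    - (suc m ∙ 1#) + - (suc n ∙ 1#)  ∎

  ⟪⟫-neg◃ : ∀ n → ⟪ Sign.- ◃ n ⟫ ≈ - (n ∙ 1#)
  ⟪⟫-neg◃ zero    = sym -0#≈0#
  ⟪⟫-neg◃ (suc n) = refl

  ⟪⟫-pos◃ : ∀ n → ⟪ Sign.+ ◃ n ⟫ ≈ n ∙ 1#
  ⟪⟫-pos◃ zero    = refl
  ⟪⟫-pos◃ (suc n) = refl

  ⟪⟫-* : ∀ i j → ⟪ i ℤ.* j ⟫ ≈ ⟪ i ⟫ * ⟪ j ⟫
  ⟪⟫-* (+ m)    (+ n)    = trans (⟪⟫-pos◃ (m ℕ.* n)) (×1-homo-* m n)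
  ⟪⟫-* (+ m)    -[1+ n ] = trans (⟪⟫-neg◃ (m ℕ.* suc n)) (trans (-‿cong (×1-homo-* m (suc n))) (-‿distribʳ-* _ _))
  ⟪⟫-* -[1+ m ] (+ n)    = trans (⟪⟫-neg◃ (suc m ℕ.* n)) (trans (-‿cong (×1-homo-* (suc m) n)) (-‿distribˡ-* _ _))
  ⟪⟫-* -[1+ m ] -[1+ n ] = begin
    ⟪ Sign.+ ◃ (suc m ℕ.* suc n) ⟫      ≈⟨ ⟪⟫-pos◃ (suc m ℕ.* suc n) ⟩
    (suc m ℕ.* suc n) ∙ 1#              ≈⟨ ×1-homo-* (suc m) (suc n) ⟩
    (suc m ∙ 1#) * (suc n ∙ 1#)         ≈⟨ -‿involutive _ ⟨
    - (- ((suc m ∙ 1#) * (suc n ∙ 1#))) ≈⟨ -‿cong (-‿distribʳ-* _ _) ⟩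
    - ((suc m ∙ 1#) * - (suc n ∙ 1#))   ≈⟨ -‿distribˡ-* _ _ ⟩
    - (suc m ∙ 1#) * - (suc n ∙ 1#)     ∎

  ⟪⟫-neg : ∀ i → ⟪ ℤ.- i ⟫ ≈ - ⟪ i ⟫
  ⟪⟫-neg (+ zero)  = sym -0#≈0#
  ⟪⟫-neg (+ suc n) = refl
  ⟪⟫-neg -[1+ n ]  = sym (-‿involutive _)

  _↑_ : Carrier → ℕ → Carrier
  x ↑ zero  = 1#
  x ↑ suc k = x * x ↑ k

  ↑-+ : ∀ x i j → x ↑ (i ℕ.+ j) ≈ x ↑ i * x ↑ j
  ↑-+ x zero    j = sym (*-identityˡ _)
  ↑-+ x (suc i) j = trans (*-congˡ (↑-+ x i j)) (sym (*-assoc _ _ _))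

  Monomial : ℕ → Set
  Monomial n = Vec ℕ n

  NF : ℕ → Set
  NF n = List (ℤ × Monomial n)

  ⟦_⟧ᵐ : Monomial n → Vec Carrier n → Carrier
  ⟦ [] ⟧ᵐ    []      = 1#
  ⟦ k ∷ m ⟧ᵐ (x ∷ ρ) = x ↑ k * ⟦ m ⟧ᵐ ρ

  ⟦_⟧ⁿ : NF n → Vec Carrier n → Carrier
  ⟦ [] ⟧ⁿ          ρ = 0#
  ⟦ (c , m) ∷ p ⟧ⁿ ρ = ⟪ c ⟫ * ⟦ m ⟧ᵐ ρ + ⟦ p ⟧ⁿ ρ

  data Order {n} (x y : Monomial n) : Set where
    less greater : Order x y
    same : x ≡ y → Order x y

  cmp : (x y : Monomial n) → Order x y
  cmp []      []      = same ≡.refl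
  cmp (i ∷ x) (j ∷ y) with i ℕ.≟ j
  ... | no _ = if i <ᵇ j then less else greater
  ... | yes ≡.refl with cmp x y
  ...   | less        = less
  ...   | greater     = greater
  ...   | same ≡.refl = same ≡.refl

  consℤ : ℤ → Monomial n → NF n → NF n
  consℤ (+ zero) m p = p
  consℤ c        m p = (c , m) ∷ p

  mutual
    addN : NF n → NF n → NF n
    addN []            r = r
    addN ((c , m) ∷ p) r = addC c m p r

    -- Lists are merged in decreasing lexicographic order, so that like monomials meet and cancel.
    -- Multiplication by a monomial keeps the order, so the difference of two equal expressions
    -- normalizes to the empty list.
    addC : ℤ → Monomial n → NF n → NF n → NF n
    addC c m p [] = (c , m) ∷ p
    addC c m p ((d , l) ∷ r) with cmp m l
    ... | same _  = consℤ (c ℤ.+ d) m (addN p r)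
    ... | less    = (d , l) ∷ addC c m p r
    ... | greater = (c , m) ∷ addN p ((d , l) ∷ r)

  scaleN : ℤ → Monomial n → NF n → NF n
  scaleN c m []            = []
  scaleN c m ((d , l) ∷ p) = (c ℤ.* d , zipWith ℕ._+_ m l) ∷ scaleN c m p

  mulN : NF n → NF n → NF n
  mulN []            r = []
  mulN ((c , m) ∷ p) r = addN (scaleN c m r) (mulN p r)

  negN : NF n → NF n
  negN []            = []
  negN ((c , m) ∷ p) = (ℤ.- c , m) ∷ negN p

  zeros : Monomial n
  zeros = replicate _ 0

  norm : Expr n → NF n
  norm (var i) = (1ℤ , updateAt zeros i suc) ∷ []
  norm :0       = []
  norm :1       = (1ℤ , zeros) ∷ []
  norm (x :+ y) = addN (norm x) (norm y)
  -- `mulN` recurses on its first argument, and in left-nested products the right factor is usually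
  -- the shorter one.
  norm (x :* y) = mulN (norm y) (norm x)
  norm (:- x)  = negN (norm x)

  module _ {n} (ρ : Vec Carrier n) where

    consℤ-sound : ∀ c m p → ⟦ consℤ c m p ⟧ⁿ ρ ≈ ⟪ c ⟫ * ⟦ m ⟧ᵐ ρ + ⟦ p ⟧ⁿ ρ
    consℤ-sound (+ zero)  m p = sym (trans (+-congʳ (zeroˡ _)) (+-identityˡ _))
    consℤ-sound (+ suc _) m p = refl
    consℤ-sound -[1+ _ ]  m p = refl

    mutual
      addN-sound : ∀ p r → ⟦ addN p r ⟧ⁿ ρ ≈ ⟦ p ⟧ⁿ ρ + ⟦ r ⟧ⁿ ρ
      addN-sound []            r = sym (+-identityˡ _)
      addN-sound ((c , m) ∷ p) r = addC-sound c m p r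

      addC-sound : ∀ c m p r → ⟦ addC c m p r ⟧ⁿ ρ ≈ (⟪ c ⟫ * ⟦ m ⟧ᵐ ρ + ⟦ p ⟧ⁿ ρ) + ⟦ r ⟧ⁿ ρ
      addC-sound c m p [] = sym (+-identityʳ _)
      addC-sound c m p ((d , l) ∷ r) with cmp m l
      ... | same ≡.refl = begin
        _ ≈⟨ consℤ-sound (c ℤ.+ d) m (addN p r) ⟩
        _ ≈⟨ +-cong (trans (*-congʳ (⟪⟫-+ c d)) (distribʳ _ _ _)) (addN-sound p r) ⟩
        _ ≈⟨ +-interchange _ _ _ _ ⟩
        _ ∎
      ... | less    = skip c m p d l r
      ... | greater = trans (+-congˡ (addN-sound p ((d , l) ∷ r))) (sym (+-assoc _ _ _))

      skip : ∀ c m p d l r → ⟪ d ⟫ * ⟦ l ⟧ᵐ ρ + ⟦ addC c m p r ⟧ⁿ ρ ≈ (⟪ c ⟫ * ⟦ m ⟧ᵐ ρ + ⟦ p ⟧ⁿ ρ) + (⟪ d ⟫ * ⟦ l ⟧ᵐ ρ + ⟦ r ⟧ⁿ ρ)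
      skip c m p d l r = begin
        _ ≈⟨ +-congˡ (addC-sound c m p r) ⟩
        _ ≈⟨ +-assoc _ _ _ ⟨
        _ ≈⟨ +-congʳ (+-comm _ _) ⟩
        _ ≈⟨ +-assoc _ _ _ ⟩
        _ ∎

  mono-* : ∀ (m l : Monomial n) ρ → ⟦ zipWith ℕ._+_ m l ⟧ᵐ ρ ≈ ⟦ m ⟧ᵐ ρ * ⟦ l ⟧ᵐ ρ
  mono-* []      []      []      = sym (*-identityˡ _)
  mono-* (i ∷ m) (j ∷ l) (x ∷ ρ) = trans (*-cong (↑-+ x i j) (mono-* m l ρ)) (*-interchange _ _ _ _)

  mono-0 : ∀ (ρ : Vec Carrier n) → ⟦ zeros ⟧ᵐ ρ ≈ 1#
  mono-0 []      = refl
  mono-0 (x ∷ ρ) = trans (*-identityˡ _) (mono-0 ρ)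

  mono-var : ∀ (i : Fin n) ρ → ⟦ updateAt zeros i suc ⟧ᵐ ρ ≈ lookup ρ i
  mono-var zero    (x ∷ ρ) = trans (*-cong (*-identityʳ x) (mono-0 ρ)) (*-identityʳ x)
  mono-var (suc i) (x ∷ ρ) = trans (*-identityˡ _) (mono-var i ρ)

  module _ {n} (ρ : Vec Carrier n) where

    scaleN-sound : ∀ c m p → ⟦ scaleN c m p ⟧ⁿ ρ ≈ (⟪ c ⟫ * ⟦ m ⟧ᵐ ρ) * ⟦ p ⟧ⁿ ρ
    scaleN-sound c m []            = sym (zeroʳ _)
    scaleN-sound c m ((d , l) ∷ p) = trans
      (+-cong (trans (*-cong (⟪⟫-* c d) (mono-* m l ρ)) (*-interchange _ _ _ _)) (scaleN-sound c m p))
      (sym (distribˡ _ _ _))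

    mulN-sound : ∀ p r → ⟦ mulN p r ⟧ⁿ ρ ≈ ⟦ p ⟧ⁿ ρ * ⟦ r ⟧ⁿ ρ
    mulN-sound []            r = sym (zeroˡ _)
    mulN-sound ((c , m) ∷ p) r = trans (addN-sound ρ (scaleN c m r) (mulN p r))
      (trans (+-cong (scaleN-sound c m r) (mulN-sound p r)) (sym (distribʳ _ _ _)))

    negN-sound : ∀ p → ⟦ negN p ⟧ⁿ ρ ≈ - ⟦ p ⟧ⁿ ρ
    negN-sound []            = sym -0#≈0#
    negN-sound ((c , m) ∷ p) = trans
      (+-cong (trans (*-congʳ (⟪⟫-neg c)) (sym (-‿distribˡ-* _ _))) (negN-sound p)) (-‿+-comm _ _)

    unit-sound : ∀ m → ⟦ (1ℤ , m) ∷ [] ⟧ⁿ ρ ≈ ⟦ m ⟧ᵐ ρ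
    unit-sound m = trans (+-identityʳ _) (trans (*-congʳ (+-identityʳ 1#)) (*-identityˡ _))

    norm-sound : ∀ e → ⟦ norm e ⟧ⁿ ρ ≈ ⟦ e ⟧ ρ
    norm-sound (var i) = trans (unit-sound (updateAt zeros i suc)) (mono-var i ρ)
    norm-sound :0       = refl
    norm-sound :1       = trans (unit-sound zeros) (mono-0 ρ)
    norm-sound (x :+ y) = trans (addN-sound ρ (norm x) (norm y)) (+-cong (norm-sound x) (norm-sound y))
    norm-sound (x :* y) = trans (mulN-sound (norm y) (norm x)) (trans (*-cong (norm-sound y) (norm-sound x)) (*-comm _ _))
    norm-sound (:- x)  = trans (negN-sound (norm x)) (-‿cong (norm-sound x))

  close : ∀ {A : Set} n → N-ary n (Expr n) A → A
  close n f = f $ⁿ Vec.map var (Vec.allFin n)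

  x-y≈0⇒x≈y : ∀ {x y} → x - y ≈ 0# → x ≈ y
  x-y≈0⇒x≈y {x} {y} e = begin
    x                ≈⟨ +-identityʳ x ⟨
    x + 0#           ≈⟨ +-congˡ (-‿inverseˡ y) ⟨
    x + (- y + y)    ≈⟨ +-assoc _ _ _ ⟨
    (x - y) + y      ≈⟨ +-congʳ e ⟩
    0# + y           ≈⟨ +-identityˡ y ⟩
    y                ∎

  -- The premise is settled by one evaluation: `≡.refl` fits it when the normal form of the
  -- difference is the empty list.
  solve : ∀ n (f : N-ary n (Expr n) (Expr n × Expr n)) →
    null (norm (proj₁ (close n f) :- proj₂ (close n f))) ≡ true →
    Eq n _≈_ (curryⁿ ⟦ proj₁ (close n f) ⟧) (curryⁿ ⟦ proj₂ (close n f) ⟧)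
  solve n f h = curryⁿ-cong _≈_ ⟦ proj₁ (close n f) ⟧ ⟦ proj₂ (close n f) ⟧ λ ρ →
    x-y≈0⇒x≈y (trans (sym (norm-sound ρ (proj₁ (close n f) :- proj₂ (close n f)))) (vanish _ ρ h))
    where
    vanish : ∀ (p : NF n) ρ → null p ≡ true → ⟦ p ⟧ⁿ ρ ≈ 0#
    vanish [] ρ _ = refl

  -- Explicit cofactors write x - y as a combination of the hypotheses l - r. What remains is a ring
  -- identity for `solve`; most algebraic steps of the proof have this shape.
  lin₁ : ∀ {l r x y} c → l ≈ r → x - y ≈ c * (l - r) → x ≈ y
  lin₁ {l} {r} c h e = x-y≈0⇒x≈y (trans e (trans (*-congˡ (trans (+-congʳ h) (-‿inverseʳ r))) (zeroʳ c)))

  lin₂ : ∀ {l₁ r₁ l₂ r₂ x y} c₁ c₂ → l₁ ≈ r₁ → l₂ ≈ r₂ → x - y ≈ c₁ * (l₁ - r₁) + c₂ * (l₂ - r₂) → x ≈ y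
  lin₂ {r₂ = r} c₁ c₂ h₁ h₂ e =
    lin₁ c₁ h₁ (trans e (trans (+-congˡ (trans (*-congˡ (trans (+-congʳ h₂) (-‿inverseʳ r))) (zeroʳ c₂))) (+-identityʳ _)))

  lin₃ : ∀ {l₁ r₁ l₂ r₂ l₃ r₃ x y} c₁ c₂ c₃ → l₁ ≈ r₁ → l₂ ≈ r₂ → l₃ ≈ r₃ →
    x - y ≈ c₁ * (l₁ - r₁) + c₂ * (l₂ - r₂) + c₃ * (l₃ - r₃) → x ≈ y
  lin₃ {r₃ = r} c₁ c₂ c₃ h₁ h₂ h₃ e =
    lin₂ c₁ c₂ h₁ h₂ (trans e (trans (+-congˡ (trans (*-congˡ (trans (+-congʳ h₃) (-‿inverseʳ r))) (zeroʳ c₃))) (+-identityʳ _)))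

  -- Cancellation is by non-zero-divisors rather than by nonzero elements, since the same arguments
  -- run over ℤ[q, a, b] and over its quotients.
  Reg : Carrier → Set
  Reg x = ∀ {y} → x * y ≈ 0# → y ≈ 0#

  reg-* : ∀ {x y} → Reg x → Reg y → Reg (x * y)
  reg-* rx ry e = ry (rx (trans (sym (*-assoc _ _ _)) e))

  reg-cong : ∀ {x y} → x ≈ y → Reg x → Reg y
  reg-cong e rx h = rx (trans (*-congʳ e) h)

  reg-1 : Reg 1#
  reg-1 h = trans (sym (*-identityˡ _)) h

  reg-neg : ∀ {x} → Reg x → Reg (- x)
  reg-neg r e = r (trans (sym (-‿involutive _)) (trans (-‿cong (trans (-‿distribˡ-* _ _) e)) -0#≈0#))

  reg-factorˡ : ∀ {x y} → Reg (x * y) → Reg x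
  reg-factorˡ r {z} e = r (trans (*-congʳ (*-comm _ _)) (trans (*-assoc _ _ _) (trans (*-congˡ e) (zeroʳ _))))

  cancel : ∀ {c x y} → Reg c → c * x ≈ c * y → x ≈ y
  cancel {c} {x} {y} rc e = x-y≈0⇒x≈y (rc (trans (distribˡ c x (- y))
    (trans (+-cong e (sym (-‿distribʳ-* c y))) (-‿inverseʳ _))))

-- Powers and finite products

module Powers (R : CommutativeRing 0ℓ 0ℓ) where

  open RingReasoning R
  open CommutativeRing R hiding (zero)
  open Formulas _+_ _*_ -_ 0# 1#

  pw-cong : ∀ {x y} n → x ≈ y → pw x n ≈ pw y n
  pw-cong zero    e = refl
  pw-cong (suc n) e = *-cong (pw-cong n e) e

  pw-+ : ∀ x m n → pw x (m ℕ.+ n) ≈ pw x m * pw x n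
  pw-+ x zero    n = sym (*-identityˡ _)
  pw-+ x (suc m) n = trans (*-congʳ (pw-+ x m n)) (solve 3 (λ a b c → a :* b :* c := a :* c :* b) ≡.refl (pw x m) (pw x n) x)

  pw-1 : ∀ n → pw 1# n ≈ 1#
  pw-1 zero    = refl
  pw-1 (suc n) = trans (*-identityʳ _) (pw-1 n)

  pw-* : ∀ x y n → pw (x * y) n ≈ pw x n * pw y n
  pw-* x y zero    = sym (*-identityˡ _)
  pw-* x y (suc n) = trans (*-congʳ (pw-* x y n))
    (solve 4 (λ a b c d → a :* b :* (c :* d) := a :* c :* (b :* d)) ≡.refl (pw x n) (pw y n) x y)

  pw-pw : ∀ x m n → pw (pw x m) n ≈ pw x (n ℕ.* m)
  pw-pw x m zero    = refl
  pw-pw x m (suc n) = trans (*-congʳ (pw-pw x m n)) (trans (*-comm _ _) (sym (pw-+ x m (n ℕ.* m))))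

  pw-swap : ∀ x m n → pw (pw x m) n ≈ pw (pw x n) m
  pw-swap x m n = trans (pw-pw x m n) (trans (reflexive (≡.cong (pw x) (ℕₚ.*-comm n m))) (sym (pw-pw x n m)))

  pw-difference : ∀ x y n → ∃ λ g → pw x n - pw y n ≈ (x - y) * g
  pw-difference x y zero    = 0# , solve 2 (λ x y → :1 :- :1 := (x :- y) :* :0) ≡.refl x y
  pw-difference x y (suc n) with pw-difference x y n
  ... | g , e = g * x + pw y n , lin₁ x e (solve 5 (λ x y g p r → p :* x :- r :* y :- (x :- y) :* (g :* x :+ r) := x :* (p :- r :- (x :- y) :* g)) ≡.refl x y g (pw x n) (pw y n))

  -- Where x^m = 1 with m odd, this makes 1 + x a divisor of 2.
  pw-odd+1 : ∀ x n → ∃ λ g → pw x (suc (n ℕ.+ n)) + 1# ≈ (1# + x) * g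
  pw-odd+1 x zero    = 1# , solve 1 (λ x → :1 :* x :+ :1 := (:1 :+ x) :* :1) ≡.refl x
  pw-odd+1 x (suc n) with pw-odd+1 x n
  ... | g , e = x * x * g + (1# - x) , lin₁ (x * x) e (trans
      (+-congʳ (+-congʳ (*-congʳ (*-congʳ (reflexive (≡.cong (pw x) (ℕₚ.+-suc n n)))))))
      (solve 3 (λ x g p → p :* x :* x :* x :+ :1 :- (:1 :+ x) :* (x :* x :* g :+ (:1 :- x)) := x :* x :* (p :* x :+ :1 :- (:1 :+ x) :* g)) ≡.refl x g (pw x (n ℕ.+ n))))

  ∏-cong : ∀ {f g : ℕ → Carrier} n → (∀ k → f k ≈ g k) → ∏ f n ≈ ∏ g n
  ∏-cong zero    h = refl
  ∏-cong (suc n) h = *-cong (∏-cong n h) (h n)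

  reg-∏ : ∀ {f : ℕ → Carrier} n → (∀ k → k ℕ.< n → Reg (f k)) → Reg (∏ f n)
  reg-∏ zero    h = reg-1
  reg-∏ (suc n) h = reg-* (reg-∏ n λ k k<n → h k (ℕₚ.m<n⇒m<1+n k<n)) (h n (ℕₚ.n<1+n n))

  reg-pw : ∀ {x} n → Reg x → Reg (pw x n)
  reg-pw zero    r = reg-1
  reg-pw (suc n) r = reg-* (reg-pw n r) r

-- Telescoping in a discrete parameter N

module Contiguity (R : CommutativeRing 0ℓ 0ℓ) where

  open RingReasoning R
  open CommutativeRing R hiding (zero)
  open Formulas _+_ _*_ -_ 0# 1#

  -- U N k / D N k is the partial sum S N of the first k terms w P / D; the goal is X N · S (N + 1) = Y N · S N.
  module Contiguous (w : ℕ → Carrier) (ν δ : ℕ → ℕ → Carrier) (X Y : ℕ → Carrier) where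

    P D U : ℕ → ℕ → Carrier
    P N = ∏ (ν N)
    D N = ∏ (δ N)
    U N = hor w (P N) (δ N)

    -- `partial N k` is X N · S (N + 1) - Y N · S N for the sums over the first k indices,
    -- multiplied by both denominators; `term N k` is the contribution of index k in the same
    -- scaling.
    partial term : ℕ → ℕ → Carrier
    partial N k = X N * (U (suc N) k * D N k) - Y N * (U N k * D (suc N) k)
    term    N k = w k * (X N * (P (suc N) k * D N k) - Y N * (P N k * D (suc N) k))

    partial-zero : ∀ N → partial N 0 ≈ 0#
    partial-zero N = solve 2 (λ x y → x :* (:0 :* :1) :- y :* (:0 :* :1) := :0) ≡.refl (X N) (Y N)

    partial-suc : ∀ N k → partial N (suc k) ≈ δ N k * δ (suc N) k * (partial N k + term N k)
    partial-suc N k = solve 11 (λ x y u u′ d d′ p p′ δ δ′ w →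
      x :* ((u′ :+ w :* p′) :* δ′ :* (d :* δ)) :- y :* ((u :+ w :* p) :* δ :* (d′ :* δ′))
      := δ :* δ′ :* (x :* (u′ :* d) :- y :* (u :* d′) :+ w :* (x :* (p′ :* d) :- y :* (p :* d′)))) ≡.refl
      (X N) (Y N) (U N k) (U (suc N) k) (D N k) (D (suc N) k) (P N k) (P (suc N) k) (δ N k) (δ (suc N) k) (w k)

    -- β/α is a closed form for the quotient of the k-th summands for N and N + 1. Passing to the
    -- next index multiplies it by a quotient of term ratios, which is `step`; then α cancels.
    ratio-suc : ∀ N k {α β α′ β′} → Reg α → α * (P N k * D (suc N) k) ≈ β * (P (suc N) k * D N k) →
      ν N k * δ (suc N) k * (α′ * β) ≈ ν (suc N) k * δ N k * (β′ * α) →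
      α′ * (P N (suc k) * D (suc N) (suc k)) ≈ β′ * (P (suc N) (suc k) * D N (suc k))
    ratio-suc N k {α} {β} {α′} {β′} reg ratio step = cancel reg
      (lin₂ (α′ * ν N k * δ (suc N) k) (P (suc N) k * D N k) ratio step
        (solve 12 (λ α α′ β β′ P D P′ D′ ν δ ν′ δ′ →
          α :* (α′ :* (P :* ν :* (D′ :* δ′))) :- α :* (β′ :* (P′ :* ν′ :* (D :* δ)))
          := α′ :* ν :* δ′ :* (α :* (P :* D′) :- β :* (P′ :* D)) :+ (P′ :* D) :* (ν :* δ′ :* (α′ :* β) :- ν′ :* δ :* (β′ :* α))) ≡.refl
          α α′ β β′ (P N k) (D N k) (P (suc N) k) (D (suc N) k) (ν N k) (δ N k) (ν (suc N) k) (δ (suc N) k)))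

    reg-D : (∀ N k → Reg (δ N k)) → ∀ N k → Reg (D N k)
    reg-D reg-δ N zero    = reg-1
    reg-D reg-δ N (suc k) = reg-* (reg-D reg-δ N k) (reg-δ N k)

    Sums : ℕ → ℕ → Set
    Sums N k = U N k * ∏ X N ≈ D N k * (w 0 * ∏ Y N)

    module _ (last : ℕ → ℕ) (last-0 : last 0 ≡ 0) (later : ∀ N j → ∃ λ i → j ℕ.+ last (suc N) ≡ i ℕ.+ last N)
      (reg-δ : ∀ N k → Reg (δ N k))
      (P-vanish : ∀ N j → P N (suc j ℕ.+ last N) ≈ 0#)
      (balance : ∀ N j → partial N (j ℕ.+ last (suc N)) + term N (j ℕ.+ last (suc N)) ≈ 0#)
      where

      sums-suc : ∀ N j → Sums N (suc j ℕ.+ last N) → Sums N (suc (suc j) ℕ.+ last N)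
      sums-suc N j h = lin₂ (δ N k) (w k * δ N k * ∏ X N) h (P-vanish N j)
        (solve 7 (λ u w p δ x d y → (u :+ w :* p) :* δ :* x :- d :* δ :* y := δ :* (u :* x :- d :* y) :+ w :* δ :* x :* (p :- :0)) ≡.refl
          (U N k) (w k) (P N k) (δ N k) (∏ X N) (D N k) (w 0 * ∏ Y N))
        where k = suc j ℕ.+ last N

      -- Induction on N: once the index `last (suc N)` is included, `balance` gives X N · S (N + 1)
      -- = Y N · S N, and `later` makes the hypothesis for N apply at the same index. The base is
      -- the single term w 0, because `last 0` is 0.
      sums : ∀ N j → Sums N (suc j ℕ.+ last N)
      sums zero zero = ≡.subst (λ k → Sums 0 (suc k)) (≡.sym last-0)
        (solve 2 (λ w δ → (:0 :+ w :* :1) :* δ :* :1 := :1 :* δ :* (w :* :1)) ≡.refl (w 0) (δ 0 0))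
      sums zero    (suc j) = sums-suc zero j (sums zero j)
      sums (suc N) j       = cancel (reg-D reg-δ N k)
        (lin₃ (∏ X N) (∏ X N * (δ N k′ * δ (suc N) k′)) (Y N * D (suc N) k) (partial-suc N k′) (balance N j)
          (≡.subst (λ k → Sums N (suc k)) (≡.sym (proj₂ (later N j))) (sums N (proj₁ (later N j))))
          (solve 12 (λ x y u u′ d d′ ∏x ∏y w δ δ′ b →
            d :* (u′ :* (∏x :* x)) :- d :* (d′ :* (w :* (∏y :* y)))
            := ∏x :* (x :* (u′ :* d) :- y :* (u :* d′) :- δ :* δ′ :* b) :+ ∏x :* (δ :* δ′) :* (b :- :0) :+ y :* d′ :* (u :* ∏x :- d :* (w :* ∏y))) ≡.refl
            (X N) (Y N) (U N k) (U (suc N) k) (D N k) (D (suc N) k) (∏ X N) (∏ Y N) (w 0) (δ N k′) (δ (suc N) k′) (partial N k′ + term N k′)))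
        where
        k′ = j ℕ.+ last (suc N)
        k  = suc k′

-- Terminating quadratic summation with a free parameter d

module Summation₁ (R : CommutativeRing 0ℓ 0ℓ) where

  open RingReasoning R
  open Contiguity R
  open CommutativeRing R hiding (zero)
  open Formulas _+_ _*_ -_ 0# 1#
  open import Relation.Binary.Reasoning.Setoid setoid

  -- The certificate equation: the closed form of the partial sum before the k-th term, plus that
  -- term, is the closed form after it. Common factors, among them P and D, are already removed.
  star : ∀ q K u d a →
    c₁ q a d u * (u - d * q * K) * (z q a d K * (1# - u * q * K))
     + wt q K * ((u * q - d * K) * (u - d * q * K) * (u - 1#) * (d - u * sq K) * X₂ q a d u
         - (u - sq K) * pair q (u * K) * (d - u) * Y₂ q a d u)
     ≈ c₁ q a d u * (u - sq K) * μ q a d K * (d - u * sq K)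
  star = solve 5 (λ q K u d a →
    E.c₁ q a d u :* (u :- d :* q :* K) :* (E.z q a d K :* (:1 :- u :* q :* K))
     :+ E.wt q K :* ((u :* q :- d :* K) :* (u :- d :* q :* K) :* (u :- :1) :* (d :- u :* E.sq K) :* E.X₂ q a d u
         :- (u :- E.sq K) :* E.pair q (u :* K) :* (d :- u) :* E.Y₂ q a d u)
     := E.c₁ q a d u :* (u :- E.sq K) :* E.μ q a d K :* (d :- u :* E.sq K)) ≡.refl

  module GenericSum (q a d : Carrier) where

    K : ℕ → Carrier
    K = pw (sq q)

    u : ℕ → Carrier
    u N = sq (K (suc N))

    ν δ : ℕ → ℕ → Carrier
    ν N k = gν q a d (K N) (K k)
    δ N k = gδ q a d (K N) (K k)

    w : ℕ → Carrier
    w k = wt q (K k)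

    X Y : ℕ → Carrier
    X N = X₁ q a d (u N) * X₂ q a d (u N)
    Y N = Y₁ q a d (u N) * Y₂ q a d (u N)

    open Contiguous w ν δ X Y public hiding (sums; sums-suc)

    module Step (N : ℕ) where

      v = u N
      L = K N
      E = pair q v

      -- β/α is the quotient of the k-th summands for N and N + 1 at K = q^(2k). The last factors,
      -- free of K, make it 1 at k = 0.
      α β : Carrier → Carrier
      α K = (d - v * sq K) * (v * q - d * K) * (v - d * q * K) * ((v - 1#) * E)
      β K = (v - sq K) * pair q (v * K) * ((d - v) * X₁ q a d v)

      -- The factors of `α` and `β` at K and K q² are, up to powers of q, factors of the term ratios
      -- for N and N + 1. Naming them reduces the identity to reordering a product.
      ratio-step : ∀ K → let K′ = K * sq q in
        (gν q a d L K * gδ q a d (L * sq q) K) * (α K′ * β K) ≈ (gν q a d (L * sq q) K * gδ q a d L K) * (β K′ * α K)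
      ratio-step K = begin
        (gν q a d L K * gδ q a d (L * sq q) K) * (α K′ * β K)
          ≈⟨ *-congˡ (*-cong
               (solve 5 (λ q d L K s → let K′ = K :* E.sq q ; v = E.sq (L :* E.sq q) in
                  (d :- v :* E.sq K′) :* (v :* q :- d :* K′) :* (v :- d :* q :* K′) :* s
                  := (d :- v :* E.sq K′) :* (q :* (v :- d :* q :* K)) :* (q :* q :* q :* (E.sq L :* q :- d :* K)) :* s)
                  ≡.refl q d L K s)
               (solve 4 (λ q L K t → let v = E.sq (L :* E.sq q) in
                  (v :- E.sq K) :* E.pair q (v :* K) :* t
                  := (v :- E.sq K) :* (q :* (:1 :- (E.sq L :* q) :* (K :* E.sq q)) :* (:1 :- q :* (v :* K))) :* t)
                  ≡.refl q L K t)) ⟩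
        (gν q a d L K * gδ q a d (L * sq q) K) * (f5 * (q * f3) * (q * q * q * g7) * s * (f8 * (q * g6 * f10) * t))
          ≈⟨ solve 15 (λ q M Z f1 f2 f3 f4 f5 g6 g7 f8 f9 f10 s t →
               (q :* M :* f1 :* f2) :* (Z :* f9 :* f4) :* (f5 :* (q :* f3) :* (q :* q :* q :* g7) :* s :* (f8 :* (q :* g6 :* f10) :* t))
               := (q :* M :* f8 :* f5) :* (Z :* g6 :* g7) :* (q :* q :* q :* q :* f1 :* (q :* f10 :* f9) :* t :* (f2 :* f4 :* f3 :* s))) ≡.refl
               q (μ q a d K) (z q a d K′) f1 f2 f3 f4 f5 g6 g7 f8 f9 f10 s t ⟩
        (gν q a d (L * sq q) K * gδ q a d L K) * (q * q * q * q * f1 * (q * f10 * f9) * t * (f2 * f4 * f3 * s))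
          ≈⟨ *-congˡ (*-cong
               (solve 4 (λ q L K t → let K′ = K :* E.sq q ; v = E.sq (L :* E.sq q) in
                  q :* q :* q :* q :* (E.sq L :- E.sq K) :* (q :* (:1 :- q :* (v :* K)) :* (:1 :- (v :* q) :* K′)) :* t
                  := (v :- E.sq K′) :* E.pair q (v :* K′) :* t) ≡.refl q L K t)
               (solve 5 (λ q d L K s → let v = E.sq (L :* E.sq q) in
                  (d :- E.sq L :* E.sq (K :* E.sq q)) :* (v :* q :- d :* K) :* (v :- d :* q :* K) :* s
                  := (d :- v :* E.sq K) :* (v :* q :- d :* K) :* (v :- d :* q :* K) :* s) ≡.refl q d L K s)) ⟩
        (gν q a d (L * sq q) K * gδ q a d L K) * (β K′ * α K) ∎
        where
        K′ = K * sq q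
        s  = (v - 1#) * E
        t  = (d - v) * X₁ q a d v
        f1 = sq L - sq K
        f2 = d - sq L * sq K′
        f3 = v - d * q * K
        f4 = v * q - d * K
        f5 = d - v * sq K′
        g6 = 1# - sq L * q * K′
        g7 = sq L * q - d * K
        f8 = v - sq K
        f9 = 1# - v * q * K′
        f10 = 1# - q * (v * K)

    module Summation
      (reg₁ : ∀ N k → Reg (d - u N * sq (K k)))
      (reg₂ : ∀ N k → Reg (u N * q - d * K k))
      (reg₃ : ∀ N k → Reg (u N - d * q * K k))
      (reg₄ : ∀ N → Reg (u N - 1#))
      (reg₅ : ∀ N → Reg (pair q (u N)))
      (reg₆ : ∀ N k → Reg (δ N k))
      where

      module _ (N : ℕ) where
        open Step N

        reg-α : ∀ k → Reg (α (K k))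
        reg-α k = reg-* (reg-* (reg-* (reg₁ N k) (reg₂ N k)) (reg₃ N k)) (reg-* (reg₄ N) (reg₅ N))

        ratio : ∀ k → α (K k) * (P N k * D (suc N) k) ≈ β (K k) * (P (suc N) k * D N k)
        ratio zero = solve 3 (λ q d v →
          (d :- v :* E.sq :1) :* (v :* q :- d :* :1) :* (v :- d :* q :* :1) :* ((v :- :1) :* E.pair q v) :* (:1 :* :1)
          := (v :- E.sq :1) :* E.pair q (v :* :1) :* ((d :- v) :* E.X₁ q d d v) :* (:1 :* :1)) ≡.refl q d v
        ratio (suc k) = ratio-suc N k (reg-α k) (ratio k) (ratio-step (K k))

        κ : Carrier
        κ = c₁ q a d v * X₁ q a d v

        -- The WZ certificate: the scaled partial sum is a single hypergeometric term in k.
        -- `telescope` and `telescope-next` are its forms before and after the k-th summand; `star`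
        -- leads from the first to the second, `partial-suc` from there to the next index.
        telescope : ∀ k → (v * q - d * K k) * (v - 1#) * (d - v * sq (K k)) * partial N k
                          ≈ κ * (z q a d (K k) * (1# - v * q * K k)) * (P (suc N) k * D N k)

        telescope-next : ∀ k → (v * q - d * K k) * (v - d * q * K k) * (v - 1#) * (partial N k + term N k)
                               ≈ κ * ((v - sq (K k)) * μ q a d (K k)) * (P (suc N) k * D N k)
        telescope-next k = cancel (reg₁ N k)
          (lin₃ (v - d * q * Kk) (- (w k * Y₂ q a d v)) (X₁ q a d v * (P (suc N) k * D N k))
            (telescope k) (ratio k) (star q Kk v d a)
            (solve 18 (λ r1 r2 r3 r4 E x1 x2 y2 c z m e f g w PD UD PD' →
              r1 :* (r2 :* r3 :* r4 :* (UD :+ w :* (x1 :* x2 :* PD' :- E :* y2 :* PD)))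
                :- r1 :* (c :* x1 :* (f :* m) :* PD')
              := r3 :* (r2 :* r4 :* r1 :* UD :- c :* x1 :* z :* PD')
                :+ (:- (w :* y2)) :* (r1 :* r2 :* r3 :* (r4 :* E) :* PD :- f :* e :* (g :* x1) :* PD')
                :+ x1 :* PD' :* (c :* r3 :* z :+ w :* (r2 :* r3 :* r4 :* r1 :* x2 :- f :* e :* g :* y2) :- c :* f :* m :* r1)) ≡.refl
              (d - v * sq Kk) (v * q - d * Kk) (v - d * q * Kk) (v - 1#) E (X₁ q a d v) (X₂ q a d v) (Y₂ q a d v)
              (c₁ q a d v) (z q a d Kk * (1# - v * q * Kk)) (μ q a d Kk) (pair q (v * Kk)) (v - sq Kk) (d - v) (w k)
              (P N k * D (suc N) k) (partial N k) (P (suc N) k * D N k)))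
          where Kk = K k

        telescope zero = lin₁ ((v * q - d * 1#) * (v - 1#) * (d - v * sq 1#)) (partial-zero N)
          (solve 6 (λ s p κ a f g → s :* p :- κ :* (((:1 :- E.sq :1) :* E.pair a (E.sq :1)) :* f :* g) :* (:1 :* :1) := s :* (p :- :0)) ≡.refl
            ((v * q - d * 1#) * (v - 1#) * (d - v * sq 1#)) (partial N 0) κ a (d - q * 1#) (1# - v * q * 1#))
        telescope (suc k) =
          lin₃ (r * (v - 1#) * r₁) ((v - 1#) * r₁ * δ N k * δ (suc N) k * b) (q * r₁ * δ N k * (z₁ * z₂)) (partial-suc N k)
            (solve 4 (λ q d v K → v :* q :- d :* (K :* E.sq q) := q :* (v :- d :* q :* K)) ≡.refl q d v (K k))
            (telescope-next k)
            (solve 16 (λ r r1 r2 r3 r4 q m f κ z e δ b p P′ D → let δ′ = z :* e :* r2 in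
              r :* r4 :* r1 :* p :- κ :* (z :* e) :* (P′ :* (q :* m :* f :* r1) :* (D :* δ))
              := r :* r4 :* r1 :* (p :- δ :* δ′ :* b) :+ r4 :* r1 :* δ :* δ′ :* b :* (r :- q :* r3)
                :+ q :* r1 :* δ :* (z :* e) :* (r2 :* r3 :* r4 :* b :- κ :* (f :* m) :* (P′ :* D))) ≡.refl
              r r₁ r₂ (v - d * q * K k) (v - 1#) q (μ q a d (K k)) (v - sq (K k)) κ z₁ z₂ (δ N k) b (partial N (suc k))
              (P (suc N) k) (D N k))
          where
          r  = v * q - d * K (suc k)
          r₁ = d - v * sq (K (suc k))
          r₂ = v * q - d * K k
          z₁ = z q a d (K (suc k))
          z₂ = 1# - v * q * K (suc k)
          b  = partial N k + term N k

      P-vanish : ∀ N j → P N (suc j ℕ.+ N) ≈ 0#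

      -- At k = N the difference itself is zero; for larger k the product P already contains that
      -- zero factor.
      vanish : ∀ N j → (sq (K N) - sq (K (j ℕ.+ N))) * P N (j ℕ.+ N) ≈ 0#
      vanish N zero    = trans (*-congʳ (-‿inverseʳ _)) (zeroˡ _)
      vanish N (suc j) = trans (*-congˡ (P-vanish N j)) (zeroʳ _)

      P-vanish N j = lin₁ (q * μ q a d (K k) * (d - sq (K N) * sq (K k * sq q))) (vanish N j)
        (solve 5 (λ q m f r P → P :* (q :* m :* f :* r) :- :0 := q :* m :* r :* (f :* P :- :0)) ≡.refl
          q (μ q a d (K k)) (sq (K N) - sq (K k)) (d - sq (K N) * sq (K k * sq q)) (P N k))
        where k = j ℕ.+ N

      balance : ∀ N j → partial N (j ℕ.+ suc N) + term N (j ℕ.+ suc N) ≈ 0#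
      -- The right-hand side of `telescope-next` carries the factor u N - K², which is L² - K² for
      -- the parameter N + 1; times P it vanishes from k = N + 1 on.
      balance N j = reg-* (reg-* (reg₂ N k) (reg₃ N k)) (reg₄ N)
        (trans (telescope-next N k) (lin₁ (κ N * μ q a d (K k) * D N k) (vanish (suc N) j)
          (solve 5 (λ c f m p d → c :* (f :* m) :* (p :* d) :- :0 := c :* m :* d :* (f :* p :- :0)) ≡.refl
            (κ N) (u N - sq (K k)) (μ q a d (K k)) (P (suc N) k) (D N k))))
        where k = j ℕ.+ suc N

      sums : ∀ N j → Sums N (suc j ℕ.+ N)
      sums = Contiguous.sums w ν δ X Y (λ N → N) ≡.refl (λ N j → suc j , ℕₚ.+-suc j N) reg₆ P-vanish balance

-- Terminating summation at a = q^(4N+1)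

module Summation₂ (R : CommutativeRing 0ℓ 0ℓ) where

  open RingReasoning R
  open Contiguity R
  open CommutativeRing R hiding (zero)
  open Formulas _+_ _*_ -_ 0# 1#

  -- For a = q^(4N+1) the factor (q/a; q²)_k ends the series at k = 2N, whence `double`. This
  -- termination is not of the form f = L^(-2), so it has its own certificate.
  module OddSum (q b : Carrier) where

    K : ℕ → Carrier
    K = pw (sq q)

    x : ℕ → Carrier
    x = q^4k+1 q

    ν δ : ℕ → ℕ → Carrier
    ν N k = oν q (x N) b (K k)
    δ N k = oδ q (x N) b (K k)

    w : ℕ → Carrier
    w k = wt q (K k)

    X Y : ℕ → Carrier
    X N = (1# - x N) * pair b (x N * (q * sq q))
    Y N = (1# - x (suc N)) * pair b (x N * q)

    open Contiguous w ν δ X Y public hiding (sums; sums-suc)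

    module Summation
      (reg₁ : ∀ N k → Reg (1# - x N * (q * K k)))
      (reg₂ : ∀ N k → Reg (1# - x N * (q * sq q * K k)))
      (reg₃ : ∀ N k → Reg (x N - sq (K k)))
      (reg₄ : ∀ N → Reg (1# - x (suc N)))
      (reg₆ : ∀ N k → Reg (δ N k))
      where

      module _ (N : ℕ) where

        a a′ κ : Carrier
        a  = x N
        a′ = x (suc N)
        κ  = a * (1# + a * sq q) * (a - 1#)

        α β : Carrier → Carrier
        α K = (1# - a * (q * K)) * (1# - a * (q * sq q * K)) * (a - sq K) * (1# - a′)
        β K = (1# - a′ * sq K) * (a * (q * sq q) - K) * (a * q - K) * (a - 1#)

        reg-α : ∀ k → Reg (α (K k))
        reg-α k = reg-* (reg-* (reg-* (reg₁ N k) (reg₂ N k)) (reg₃ N k)) (reg₄ N)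

        ratio-step : ∀ k → ν N k * δ (suc N) k * (α (K (suc k)) * β (K k)) ≈ ν (suc N) k * δ N k * (β (K (suc k)) * α (K k))
        ratio-step k = solve 7 (λ q a K f g h i → let a′ = a :* E.sq (E.sq q) ; K′ = K :* E.sq q in
          E.pair a (q :* K) :* f :* g :* (h :* E.pair a′ (E.sq K′) :* i)
            :* ((:1 :- a :* (q :* K′)) :* (:1 :- a :* (q :* E.sq q :* K′)) :* (a :- E.sq K′) :* (:1 :- a′)
              :* ((:1 :- a′ :* E.sq K) :* (a :* (q :* E.sq q) :- K) :* (a :* q :- K) :* (a :- :1)))
          := E.pair a′ (q :* K) :* f :* g :* (h :* E.pair a (E.sq K′) :* i)
            :* ((:1 :- a′ :* E.sq K′) :* (a :* (q :* E.sq q) :- K′) :* (a :* q :- K′) :* (a :- :1)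
              :* ((:1 :- a :* (q :* K)) :* (:1 :- a :* (q :* E.sq q :* K)) :* (a :- E.sq K) :* (:1 :- a′)))) ≡.refl
          q a (K k) (1# - sq q * sq (K k)) (pair b (q * sq (K k))) (1# - sq (K (suc k))) (pair b (K (suc k)))

        ratio : ∀ k → α (K k) * (P N k * D (suc N) k) ≈ β (K k) * (P (suc N) k * D N k)
        ratio zero = solve 2 (λ q a → let a′ = a :* E.sq (E.sq q) in
          (:1 :- a :* (q :* :1)) :* (:1 :- a :* (q :* E.sq q :* :1)) :* (a :- E.sq :1) :* (:1 :- a′) :* (:1 :* :1)
          := (:1 :- a′ :* E.sq :1) :* (a :* (q :* E.sq q) :- :1) :* (a :* q :- :1) :* (a :- :1) :* (:1 :* :1)) ≡.refl q a
        ratio (suc k) = ratio-suc N k (reg-α k) (ratio k) (ratio-step k)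

        telescope : ∀ k → (1# - a * (q * K k)) * (1# - a * (q * sq q * K k)) * partial N k
          ≈ κ * (sq q * (q - K k) * (1# - sq (K k)) * (1# - a′ * sq (K k)) * pair b (K k)) * (P (suc N) k * D N k)

        telescope-next : ∀ k → (1# - a * (q * sq q * K k)) * (a - sq (K k)) * (partial N k + term N k)
          ≈ κ * ((a * (q * sq q) - K k) * ((1# - sq q * sq (K k)) * pair b (q * sq (K k)) * (1# - q * K k))) * (P (suc N) k * D N k)
        telescope-next k = cancel (reg₁ N k)
          (lin₃ (a - sq Kk) (- (w k * pair b (a * q))) ((P (suc N) k * D N k) * (a - 1#))
            (telescope k) (ratio k)
            (solve 4 (λ q K a b → let a′ = a :* E.sq (E.sq q) in
              (a :- E.sq K) :* (a :* (:1 :+ a :* E.sq q)) :* (E.sq q :* (q :- K) :* (:1 :- E.sq K) :* (:1 :- a′ :* E.sq K) :* E.pair b K)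
                :- E.wt q K :* ((:1 :- a :* (q :* K)) :* (:1 :- a :* (q :* E.sq q :* K)) :* (a :- E.sq K) :* E.pair b (a :* (q :* E.sq q))
                  :+ E.pair b (a :* q) :* ((:1 :- a′ :* E.sq K) :* (a :* (q :* E.sq q) :- K) :* (a :* q :- K)))
              := (:1 :- a :* (q :* K)) :* (a :* (:1 :+ a :* E.sq q)) :* ((a :* (q :* E.sq q) :- K) :* ((:1 :- E.sq q :* E.sq K) :* E.pair b (q :* E.sq K) :* (:1 :- q :* K))))
              ≡.refl q Kk a b)
            (solve 15 (λ r1 r2 r3 a c z n g x0 y0 e w PD UD PD' → let κ = c :* (a :- :1) in
              r1 :* (r2 :* r3 :* (UD :+ w :* ((:1 :- a) :* x0 :* PD' :- e :* y0 :* PD))) :- r1 :* (κ :* n :* PD')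
              := r3 :* (r1 :* r2 :* UD :- κ :* z :* PD')
                :+ (:- (w :* y0)) :* (r1 :* r2 :* r3 :* e :* PD :- g :* (a :- :1) :* PD')
                :+ PD' :* (a :- :1) :* (r3 :* c :* z :- w :* (r1 :* r2 :* r3 :* x0 :+ y0 :* g) :- r1 :* c :* n)) ≡.refl
              (1# - a * (q * Kk)) (1# - a * (q * sq q * Kk)) (a - sq Kk) a (a * (1# + a * sq q))
              (sq q * (q - Kk) * (1# - sq Kk) * (1# - a′ * sq Kk) * pair b Kk)
              ((a * (q * sq q) - Kk) * ((1# - sq q * sq Kk) * pair b (q * sq Kk) * (1# - q * Kk)))
              ((1# - a′ * sq Kk) * (a * (q * sq q) - Kk) * (a * q - Kk))
              (pair b (a * (q * sq q))) (pair b (a * q)) (1# - a′) (w k)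
              (P N k * D (suc N) k) (partial N k) (P (suc N) k * D N k)))
          where Kk = K k

        telescope zero = lin₁ ((1# - a * (q * 1#)) * (1# - a * (q * sq q * 1#))) (partial-zero N)
          (solve 6 (λ s p κ f g h → s :* p :- κ :* (f :* (:1 :- E.sq :1) :* g :* h) :* (:1 :* :1) := s :* (p :- :0)) ≡.refl
            ((1# - a * (q * 1#)) * (1# - a * (q * sq q * 1#))) (partial N 0) κ (sq q * (q - 1#)) (1# - a′ * sq 1#) (pair b 1#))
        telescope (suc k) =
          lin₂ ((1# - a * (q * K (suc k))) * r₂) (r₂ * δ N k * e₁ * sq (sq q) * e₂ * e₃) (partial-suc N k) (telescope-next k)
            (solve 14 (λ q a K κ e1 e2 e3 n p δ c s P′ D →
              let a′ = a :* E.sq (E.sq q)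
                  K′ = K :* E.sq q
                  q³ = q :* E.sq q
                  δ′ = e1 :* ((a′ :- E.sq K′) :* e2) :* e3 in
              (:1 :- a :* (q :* K′)) :* (:1 :- a :* (q³ :* K′)) :* s
                :- κ :* (E.sq q :* (q :- K′) :* e1 :* e2 :* e3) :* (P′ :* (E.pair a′ (q :* K) :* n :* p) :* (D :* δ))
              := (:1 :- a :* (q :* K′)) :* (:1 :- a :* (q³ :* K′)) :* (s :- δ :* δ′ :* c)
                :+ (:1 :- a :* (q³ :* K′)) :* δ :* e1 :* E.sq (E.sq q) :* e2 :* e3
                 :* ((:1 :- a :* (q³ :* K)) :* (a :- E.sq K) :* c :- κ :* ((a :* q³ :- K) :* (n :* p :* (:1 :- q :* K))) :* (P′ :* D))) ≡.refl
              q a (K k) κ e₁ e₂ e₃ (1# - sq q * sq (K k)) (pair b (q * sq (K k))) (δ N k) (partial N k + term N k) (partial N (suc k))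
              (P (suc N) k) (D N k))
          where
          r₂ = 1# - a * (q * sq q * K (suc k))
          e₁ = 1# - sq (K (suc k))
          e₂ = 1# - a′ * sq (K (suc k))
          e₃ = pair b (K (suc k))

      double : ℕ → ℕ
      double zero    = zero
      double (suc N) = suc (suc (double N))

      x≈qK : ∀ N → x N ≈ q * K (double N)
      x≈qK zero    = sym (*-identityʳ q)
      x≈qK (suc N) = trans (*-congʳ (x≈qK N)) (solve 2 (λ q K → q :* K :* E.sq (E.sq q) := q :* (K :* E.sq q :* E.sq q)) ≡.refl q (K (double N)))

      P-vanish : ∀ N j → P N (suc j ℕ.+ double N) ≈ 0#
      P-vanish N zero = lin₁ (P N k * (1# - x N * (q * K k)) * (1# - sq q * sq (K k)) * pair b (q * sq (K k))) (x≈qK N)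
        (solve 6 (λ p x y e f g → p :* ((x :- y) :* e :* f :* g) :- :0 := p :* e :* f :* g :* (x :- y)) ≡.refl
          (P N k) (x N) (q * K k) (1# - x N * (q * K k)) (1# - sq q * sq (K k)) (pair b (q * sq (K k))))
        where k = double N
      P-vanish N (suc j) = trans (*-congʳ (P-vanish N j)) (zeroˡ _)

      -- The factor q^(4N+4) - q^(2k) of the certificate is zero at k = 2(N + 1), the last index of
      -- the series for N + 1; beyond it P is zero.
      vanish : ∀ N j → (x N * (q * sq q) - K (j ℕ.+ double (suc N))) * P (suc N) (j ℕ.+ double (suc N)) ≈ 0#
      vanish N zero    = lin₁ (q * sq q * P (suc N) (double (suc N))) (x≈qK N)
        (solve 4 (λ q x K p → (x :* (q :* E.sq q) :- K :* E.sq q :* E.sq q) :* p :- :0 := q :* E.sq q :* p :* (x :- q :* K)) ≡.refl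
          q (x N) (K (double N)) (P (suc N) (double (suc N))))
      vanish N (suc j) = trans (*-congˡ (P-vanish (suc N) j)) (zeroʳ _)

      balance : ∀ N j → partial N (j ℕ.+ double (suc N)) + term N (j ℕ.+ double (suc N)) ≈ 0#
      balance N j = reg-* (reg₂ N k) (reg₃ N k)
        (trans (telescope-next N k) (lin₁ (κ N * n * D N k) (vanish N j)
          (solve 5 (λ c f n p d → c :* (f :* n) :* (p :* d) :- :0 := c :* n :* d :* (f :* p :- :0)) ≡.refl
            (κ N) (x N * (q * sq q) - K k) n (P (suc N) k) (D N k))))
        where
        k = j ℕ.+ double (suc N)
        n = (1# - sq q * sq (K k)) * pair b (q * sq (K k)) * (1# - q * K k)

      sums : ∀ N j → Sums N (suc j ℕ.+ double N)
      sums = Contiguous.sums w ν δ X Y double ≡.refl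
        (λ N j → suc (suc j) , ≡.trans (ℕₚ.+-suc j (suc (double N))) (≡.cong suc (ℕₚ.+-suc j (double N)))) reg₆ P-vanish balance

-- Reduction to central q-binomial coefficients; the sum at a root of unity

module Reduction (R : CommutativeRing 0ℓ 0ℓ) where

  open RingReasoning R
  open Powers R
  open CommutativeRing R hiding (zero)
  open Formulas _+_ _*_ -_ 0# 1#
  open import Relation.Binary.Reasoning.Setoid setoid

  gauss-0 : ∀ p i → gauss p i 0 ≡ 1#
  gauss-0 p zero    = ≡.refl
  gauss-0 p (suc i) = ≡.refl

  -- The two absorption identities are kept together because the Pascal step for either one uses
  -- both.
  Absorb : Carrier → ℕ → ℕ → Set
  Absorb p i j =
      (1# - pw p (suc i)) * gauss p (suc i) j ≈ (1# - pw p (suc (i ℕ.+ j))) * gauss p i j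
    × (1# - pw p (suc j)) * gauss p i (suc j) ≈ (1# - pw p (suc (i ℕ.+ j))) * gauss p i j

  absorb-zeroˡ : ∀ p j → Absorb p 0 j → Absorb p 0 (suc j)
  absorb-zeroˡ p j ih = left , refl
    where
    left : (1# - 1# * p) * (1# + 1# * p * gauss p 1 j) ≈ (1# - pw p (suc (suc j))) * 1#
    left = lin₁ p (proj₁ ih)
      (solve 3 (λ p g x → (:1 :- :1 :* p) :* (:1 :+ :1 :* p :* g) :- (:1 :- x :* p :* p) :* :1 := p :* ((:1 :- :1 :* p) :* g :- (:1 :- x :* p) :* :1)) ≡.refl p (gauss p 1 j) (pw p j))

  absorb-zeroʳ : ∀ p i → Absorb p i 0 → Absorb p (suc i) 0
  absorb-zeroʳ p i ih = left , right
    where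
    left : (1# - pw p (suc (suc i))) * 1# ≈ (1# - pw p (suc (suc (i ℕ.+ 0)))) * 1#
    left = reflexive (≡.cong (λ k → (1# - pw p (suc (suc k))) * 1#) (≡.sym (ℕₚ.+-identityʳ i)))
    previous : (1# - 1# * p) * gauss p i 1 ≈ (1# - pw p (suc i)) * 1#
    previous = trans (proj₂ ih)
      (reflexive (≡.cong₂ (λ k g → (1# - pw p (suc k)) * g) (ℕₚ.+-identityʳ i) (gauss-0 p i)))
    right : (1# - 1# * p) * (gauss p i 1 + pw p (suc i) * 1#) ≈ (1# - pw p (suc (suc (i ℕ.+ 0)))) * 1#
    right = trans (lin₁ 1# previous
       (solve 3 (λ p g x → (:1 :- :1 :* p) :* (g :+ x :* p :* :1) :- (:1 :- x :* p :* p) :* :1 := :1 :* ((:1 :- :1 :* p) :* g :- (:1 :- x :* p) :* :1)) ≡.refl p (gauss p i 1) (pw p i))) left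

  absorb-step : ∀ p i j → Absorb p (suc i) j → Absorb p i (suc j) → Absorb p (suc i) (suc j)
  absorb-step p i j (ih₁ , ih₂) (ih₃ , ih₄) = left , right
    where
    g₁ = gauss p i (suc j)
    g₂ = gauss p (suc i) j
    G  = gauss p (suc i) (suc j)
    s  = pw p (i ℕ.+ j)
    x  = pw p i
    y  = pw p j
    exponent : (1# - s * p * p * p) * G ≈ (1# - pw p (suc (suc i ℕ.+ suc j))) * G
    exponent = reflexive (≡.cong (λ k → (1# - pw p (suc (suc k))) * G) (≡.sym (ℕₚ.+-suc i j)))
    left : (1# - x * p * p) * (G + x * p * p * gauss p (suc (suc i)) j) ≈ (1# - pw p (suc (suc i ℕ.+ suc j))) * G
    left = trans (lin₃ (x * p * p) (- (x * p * p)) (- (p * p * p * G))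
        ih₁ ih₂ (sym (pw-+ p i j))
        (solve 7 (λ p x y s G g h → (:1 :- x :* p :* p) :* (G :+ x :* p :* p :* h) :- (:1 :- s :* p :* p :* p) :* G
          := x :* p :* p :* ((:1 :- x :* p :* p) :* h :- (:1 :- s :* p :* p) :* g) :+ (:- (x :* p :* p)) :* ((:1 :- y :* p) :* G :- (:1 :- s :* p :* p) :* g)
            :+ (:- (p :* p :* p :* G)) :* (x :* y :- s)) ≡.refl p x y s G g₂ (gauss p (suc (suc i)) j))) exponent
    left-G : (1# - x * p) * G ≈ (1# - s * p * p) * g₁
    left-G = trans ih₃ (reflexive (≡.cong (λ k → (1# - pw p (suc k)) * g₁) (ℕₚ.+-suc i j)))
    right-g : (1# - y * p * p) * gauss p i (suc (suc j)) ≈ (1# - s * p * p) * g₁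
    right-g = trans ih₄ (reflexive (≡.cong (λ k → (1# - pw p (suc k)) * g₁) (ℕₚ.+-suc i j)))
    right : (1# - y * p * p) * (gauss p i (suc (suc j)) + x * p * G) ≈ (1# - pw p (suc (suc i ℕ.+ suc j))) * G
    right = trans (lin₃ 1# (- 1#) (p * p * p * G) right-g left-G (pw-+ p i j)
        (solve 7 (λ p x y s G g h → (:1 :- y :* p :* p) :* (h :+ x :* p :* G) :- (:1 :- s :* p :* p :* p) :* G
          := :1 :* ((:1 :- y :* p :* p) :* h :- (:1 :- s :* p :* p) :* g) :+ (:- :1) :* ((:1 :- x :* p) :* G :- (:1 :- s :* p :* p) :* g)
            :+ p :* p :* p :* G :* (s :- x :* y)) ≡.refl p x y s G g₁ (gauss p i (suc (suc j))))) exponent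

  gauss-absorb : ∀ p i j → Absorb p i j
  gauss-absorb p zero    zero    = refl , refl
  gauss-absorb p zero    (suc j) = absorb-zeroˡ p j (gauss-absorb p zero j)
  gauss-absorb p (suc i) zero    = absorb-zeroʳ p i (gauss-absorb p i zero)
  gauss-absorb p (suc i) (suc j) = absorb-step p i j (gauss-absorb p (suc i) j) (gauss-absorb p i (suc j))

  -- With p = q², two absorptions give (1 - p^(k+1))² C(k+1) = (1 - p^(2k+2))(1 - p^(2k+1)) C(k);
  -- one factor 1 - p^(k+1) then cancels.
  central : ∀ q k → Reg (1# - pw (sq q) (suc k)) →
    (1# - pw (sq q) (suc k)) * gauss (sq q) (suc k) (suc k)
    ≈ (1# - sq q * sq (pw (sq q) k)) * (1# + pw (sq q) (suc k)) * gauss (sq q) k k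
  central q k r = cancel r (lin₃ x (1# - s * p * p) (c * (p * p * p * (s + y * y) - (p + p * p))) diagonal (proj₂ (gauss-absorb p k k)) (pw-+ p k k)
      (solve 6 (λ p y s g h c → let x = :1 :- y :* p in
        x :* (x :* h) :- x :* ((:1 :- p :* (y :* y)) :* (:1 :+ y :* p) :* c)
        := x :* (x :* h :- (:1 :- s :* p :* p) :* g) :+ (:1 :- s :* p :* p) :* (x :* g :- (:1 :- s :* p) :* c)
          :+ c :* (p :* p :* p :* (s :+ y :* y) :- (p :+ p :* p)) :* (s :- y :* y)) ≡.refl p y s (gauss p k (suc k)) (gauss p (suc k) (suc k)) c))
    where
    p = sq q
    y = pw p k
    s = pw p (k ℕ.+ k)
    c = gauss p k k
    x = 1# - pw p (suc k)
    diagonal : x * gauss p (suc k) (suc k) ≈ (1# - s * p * p) * gauss p k (suc k)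
    diagonal = trans (proj₁ (gauss-absorb p k (suc k))) (reflexive (≡.cong (λ j → (1# - pw p (suc j)) * gauss p k (suc k)) (ℕₚ.+-suc k k)))

  hor-cong : ∀ {w w′ P P′ δ δ′ : ℕ → Carrier} k → (∀ j → w j ≈ w′ j) → (∀ j → P j ≈ P′ j) → (∀ j → δ j ≈ δ′ j) → hor w P δ k ≈ hor w′ P′ δ′ k
  hor-cong zero    hw hP hδ = refl
  hor-cong (suc k) hw hP hδ = *-cong (+-cong (hor-cong k hw hP hδ) (*-cong (hw k) (hP k))) (hδ k)

  hor-scale : ∀ (c : Carrier) (w w′ P δ : ℕ → Carrier) → (∀ j → w′ j ≈ c * w j) → ∀ k → hor w′ P δ k ≈ c * hor w P δ k
  hor-scale c w w′ P δ h zero    = sym (zeroʳ c)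
  hor-scale c w w′ P δ h (suc k) = lin₂ (δ k) (P k * δ k) (hor-scale c w w′ P δ h k) (h k)
    (solve 7 (λ c u u′ w w′ p d → (u′ :+ w′ :* p) :* d :- c :* ((u :+ w :* p) :* d) := d :* (u′ :- c :* u) :+ p :* d :* (w′ :- c :* w)) ≡.refl
      c (hor w P δ k) (hor w′ P δ k) (w k) (w′ k) (P k) (δ k))

  hor-compare : ∀ (w P P′ δ δ′ : ℕ → Carrier) n → (∀ k → k < n → P k * ∏ δ′ k ≈ P′ k * ∏ δ k) →
    ∀ k → k ≤ n → hor w P δ k * ∏ δ′ k ≈ hor w P′ δ′ k * ∏ δ k
  hor-compare w P P′ δ δ′ n h zero    _ = refl
  hor-compare w P P′ δ δ′ n h (suc k) k<n = lin₂ (δ k * δ′ k) (w k * δ k * δ′ k) (hor-compare w P P′ δ δ′ n h k (ℕₚ.<⇒≤ k<n)) (h k k<n)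
    (solve 9 (λ w p p′ d d′ D D′ u u′ → (u :+ w :* p) :* d :* (D′ :* d′) :- (u′ :+ w :* p′) :* d′ :* (D :* d)
       := d :* d′ :* (u :* D′ :- u′ :* D) :+ w :* d :* d′ :* (p :* D′ :- p′ :* D)) ≡.refl
      (w k) (P k) (P′ k) (δ k) (δ′ k) (∏ δ k) (∏ δ′ k) (hor w P δ k) (hor w P′ δ′ k))

  q-int-cyc : ∀ q k → (1# - q) * q-int q k ≈ 1# - pw q k
  q-int-cyc q zero    = solve 1 (λ q → (:1 :- q) :* :0 := :1 :- :1) ≡.refl q
  q-int-cyc q (suc k) = lin₁ 1# (q-int-cyc q k)
    (solve 3 (λ q g p → (:1 :- q) :* (g :+ p) :- (:1 :- p :* q) := :1 :* ((:1 :- q) :* g :- (:1 :- p))) ≡.refl q (q-int q k) (pw q k))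

  K-pw : ∀ q k → pw (sq q) k ≈ pw q (k ℕ.+ k)
  K-pw q k = trans (pw-* q q k) (sym (pw-+ q k k))

  parity : ∀ k → ∃ λ i → k ≡ i ℕ.+ i ⊎ k ≡ suc (i ℕ.+ i)
  parity zero    = 0 , inj₁ ≡.refl
  parity (suc k) with parity k
  ... | i , inj₁ ≡.refl = i , inj₂ ≡.refl
  ... | i , inj₂ ≡.refl = suc i , inj₁ (≡.cong suc (≡.sym (ℕₚ.+-suc i i)))

  six : ∀ k → 6 ℕ.* k ℕ.+ 1 ≡ suc ((k ℕ.+ k) ℕ.+ ((k ℕ.+ k) ℕ.+ (k ℕ.+ k)))
  six = S.solve 1 (λ k → S.con 6 S.:* k S.:+ S.con 1 S.:= S.con 1 S.:+ ((k S.:+ k) S.:+ ((k S.:+ k) S.:+ (k S.:+ k)))) ≡.refl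

  pw-6k+1 : ∀ q k → pw q (6 ℕ.* k ℕ.+ 1) ≈ q * (pw (sq q) k * sq (pw (sq q) k))
  pw-6k+1 q k = trans (reflexive (≡.cong (pw q) (six k)))
    (lin₃ q (q * pw q e) (- q * (y * y + y * pw q e + pw q e * pw q e)) (pw-+ q e (e ℕ.+ e)) (pw-+ q e e) (K-pw q k)
      (solve 5 (λ q y x x² x³ → x³ :* q :- q :* (y :* (y :* y))
        := q :* (x³ :- x :* x²) :+ q :* x :* (x² :- x :* x) :+ (:- q) :* (y :* y :+ y :* x :+ x :* x) :* (y :- x)) ≡.refl
        q y (pw q e) (pw q (e ℕ.+ e)) (pw q (e ℕ.+ (e ℕ.+ e)))))
    where
    e = k ℕ.+ k
    y = pw (sq q) k

  module _ (q a b : Carrier) where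
    open Reduced q a b

    W-wt : ∀ k → (1# - q) * W k ≈ wt q (K k)
    W-wt k = lin₂ (K k) (- K k) (q-int-cyc q (6 ℕ.* k ℕ.+ 1)) (pw-6k+1 q k)
      (solve 5 (λ q i K p s → (:1 :- q) :* (i :* K) :- (:1 :- q :* (K :* E.sq K)) :* K
        := K :* ((:1 :- q) :* i :- (:1 :- p)) :+ (:- K) :* (p :- q :* (K :* E.sq K))) ≡.refl
        q (q-int q (6 ℕ.* k ℕ.+ 1)) (K k) (pw q (6 ℕ.* k ℕ.+ 1)) 0#)

  module _ (q a b : Carrier) (ν δ ƛ : ℕ → Carrier)
    (match-ν : ∀ k → ν k ≈ ƛ k * oν q a b (pw (sq q) k))
    (match-δ : ∀ k → δ k ≈ ƛ k * oδ q a b (pw (sq q) k))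
    where
    open Reduced q a b

    -- Induction on k with `central` as the step. The common factor `ƛ` admits series that agree
    -- with the original one only after cancellation, such as the generic series at d = q², where 1
    -- - q K occurs above and below.
    reduced-ratio : ∀ n → (∀ k → k < n → Reg (1# - K (suc k))) → ∀ k → k ≤ n → P k * ∏ δ k ≈ ∏ ν k * D k
    reduced-ratio n reg zero    _   = *-identityʳ _
    reduced-ratio n reg (suc k) k<n = cancel (reg k k<n) (lin₁ (∏ numer k * numer k * ∏ δ k * δ k) (central q k (reg k k<n))
      (lin₃ (y * C k * ∏ numer k * numer k * ∏ δ k) (- (x * denom k * ∏ ν k * D k)) (y * numer k * ƛ k * oδ q a b (K k))
        (match-δ k) (match-ν k) (reduced-ratio n reg k (ℕₚ.<⇒≤ k<n))
        (solve 15 (λ f K′ c′ p n₁ n₂ A B G δ c H ν D ƛ →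
           let x = :1 :- K′
               y = f :* (:1 :+ K′)
               n = n₁ :* n₂
               r = E.sq (:1 :+ K′) :* (A :* B)
               oδ = (:1 :- E.sq K′) :* A :* B
               oν = n₁ :* f :* n₂
           in x :* (c′ :* (p :* n) :* (G :* δ)) :- x :* (H :* ν :* (D :* r)) :- p :* n :* G :* δ :* (x :* c′ :- y :* c)
              := y :* c :* p :* n :* G :* (δ :- ƛ :* oδ) :+ (:- (x :* r :* H :* D)) :* (ν :- ƛ :* oν)
                :+ y :* n :* ƛ :* oδ :* (c :* p :* G :- H :* D)) ≡.refl
           (1# - sq q * sq (K k)) (K (suc k)) (C (suc k)) (∏ numer k) (pair a (q * K k)) (pair b (q * sq (K k)))
           (pair a (sq (K (suc k)))) (pair b (K (suc k))) (∏ δ k) (δ k) (C k) (∏ ν k) (ν k) (D k) (ƛ k))))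
      where
      x = 1# - K (suc k)
      y = (1# - sq q * sq (K k)) * (1# + K (suc k))

    weightedU plainU : ℕ → Carrier
    weightedU = hor (λ k → wt q (K k)) P denom
    plainU = hor (λ k → wt q (K k)) (∏ ν) δ

    weighted : ∀ k → weightedU k ≈ (1# - q) * U k
    weighted = hor-scale (1# - q) W (λ k → wt q (K k)) P denom (λ k → sym (W-wt q a b k))

    reduced-sum : ∀ n → (∀ k → k < n → Reg (1# - K (suc k))) → ∀ k → k ≤ n → (1# - q) * U k * ∏ δ k ≈ plainU k * D k
    reduced-sum n reg k k≤n = trans (*-congʳ (sym (weighted k)))
      (hor-compare (λ k → wt q (K k)) P (∏ ν) denom δ n (λ k k<n → reduced-ratio n reg k (ℕₚ.<⇒≤ k<n)) k k≤n)

  pair-cong : ∀ {x y y′} → y ≈ y′ → pair x y ≈ pair x y′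
  pair-cong e = *-cong (+-congˡ (-‿cong e)) (+-congˡ (-‿cong (*-congˡ e)))

  sq-cong : ∀ {x y} → x ≈ y → sq x ≈ sq y
  sq-cong e = *-cong e e

  pair-cong₂ : ∀ {x x′ y} → x ≈ x′ → pair x y ≈ pair x′ y
  pair-cong₂ e = *-cong (+-congʳ e) (+-congˡ (-‿cong (*-congʳ e)))

  module _ {q a a′ b b′ : Carrier} (ha : a ≈ a′) (hb : b ≈ b′) where

    den-cong : ∀ k → Reduced.denom q a b k ≈ Reduced.denom q a′ b′ k
    den-cong k = *-congˡ (*-cong (pair-cong₂ ha) (pair-cong₂ hb))

    D-cong : ∀ k → Reduced.D q a b k ≈ Reduced.D q a′ b′ k
    D-cong k = ∏-cong k den-cong

    U-cong : ∀ k → Reduced.U q a b k ≈ Reduced.U q a′ b′ k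
    U-cong k = hor-cong k (λ j → refl) (λ j → *-congˡ (∏-cong j λ i → *-cong (pair-cong₂ ha) (pair-cong₂ hb))) den-cong

  -- The hypotheses say that q is a root of unity of exact odd order m = 2h′ + 1, with regular
  -- elements in place of nonzero ones.
  module Periodic (q a b : Carrier) (h′ : ℕ)
    (q^m : pw q (suc (h′ ℕ.+ h′)) ≈ 1#)
    (reg-cyc : ∀ j → 0 < j → j < suc (h′ ℕ.+ h′) → Reg (1# - pw q j))
    (reg-2 : Reg (1# + 1#))
    (h′>0 : 0 < h′)
    where

    open Reduced q a b

    m : ℕ
    m = suc (h′ ℕ.+ h′)

    h′+1<m : suc h′ < m
    h′+1<m = s≤s (ℕₚ.m<n+m h′ h′>0)

    K-period : ∀ i k → K (k ℕ.+ i ℕ.* m) ≈ K k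
    K-period i k = begin
      K (k ℕ.+ i ℕ.* m)     ≈⟨ pw-+ (sq q) k (i ℕ.* m) ⟩
      K k * K (i ℕ.* m)     ≈⟨ *-congˡ (pw-pw (sq q) m i) ⟨
      K k * pw (K m) i      ≈⟨ *-congˡ (pw-cong i (trans (pw-* q q m) (trans (*-cong q^m q^m) (*-identityˡ 1#)))) ⟩
      K k * pw 1# i         ≈⟨ *-congˡ (pw-1 i) ⟩
      K k * 1#              ≈⟨ *-identityʳ _ ⟩
      K k                   ∎

    num-period : ∀ i k → numer (k ℕ.+ i ℕ.* m) ≈ numer k
    num-period i k = *-cong (pair-cong (*-congˡ (K-period i k))) (pair-cong (*-congˡ (sq-cong (K-period i k))))

    den-period : ∀ i k → denom (k ℕ.+ i ℕ.* m) ≈ denom k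
    den-period i k = *-cong (sq-cong (+-congˡ (K-period i (suc k))))
      (*-cong (pair-cong (sq-cong (K-period i (suc k)))) (pair-cong (K-period i (suc k))))

    W-period : ∀ i k → W (k ℕ.+ i ℕ.* m) ≈ W k
    W-period i k = cancel {1# - pw q 1} (reg-cyc 1 (s≤s z≤n) (ℕₚ.≤-<-trans (s≤s z≤n) h′+1<m))
      (trans (one (k ℕ.+ i ℕ.* m)) (trans (*-cong (+-congˡ (-‿cong (*-congˡ (*-cong e (sq-cong e))))) e) (sym (one k))))
      where
      e = K-period i k
      one : ∀ k → (1# - pw q 1) * W k ≈ wt q (K k)
      one k = trans (*-congʳ (+-congˡ (-‿cong (*-identityˡ q)))) (W-wt q a b k)

    -- (q^j)^m = 1 with m odd, so 1 + q^j divides 2.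
    reg-1+ : ∀ j → Reg (1# + pw q j)
    reg-1+ j = reg-factorˡ (reg-cong (trans (+-congʳ (sym (trans (pw-swap q j m) (trans (pw-cong j q^m) (pw-1 j)))))
      (proj₂ (pw-odd+1 (pw q j) h′))) reg-2)

    reg-K : ∀ k → suc k < m → Reg (1# - K (suc k))
    reg-K k k<m = reg-cong (solve 1 (λ x → (:1 :- x) :* (:1 :+ x) := :1 :- x :* x) ≡.refl (pw q (suc k)) ⟨ trans ⟩ +-congˡ (-‿cong (sym (pw-* q q (suc k)))))
      (reg-* (reg-cyc (suc k) (s≤s z≤n) k<m) (reg-1+ (suc k)))

    C-step : ∀ i k → suc k < m → (1# - K (suc k)) * C (suc k ℕ.+ i ℕ.* m) ≈ (1# - sq q * sq (K k)) * (1# + K (suc k)) * C (k ℕ.+ i ℕ.* m)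
    C-step i k k<m = begin
      (1# - K (suc k)) * C (suc k ℕ.+ i ℕ.* m)                         ≈⟨ *-congʳ (+-congˡ (-‿cong e)) ⟨
      (1# - K (suc (k ℕ.+ i ℕ.* m))) * C (suc (k ℕ.+ i ℕ.* m))         ≈⟨ central q (k ℕ.+ i ℕ.* m) (reg-cong (+-congˡ (-‿cong (sym e))) (reg-K k k<m)) ⟩
      _                                                                ≈⟨ *-congʳ (*-cong (+-congˡ (-‿cong (*-congˡ (sq-cong (K-period i k))))) (+-congˡ e)) ⟩
      (1# - sq q * sq (K k)) * (1# + K (suc k)) * C (k ℕ.+ i ℕ.* m)    ∎
      where e = K-period i (suc k)

    -- A case of the q-Lucas theorem: both sides obey the recursion of `central`, whose coefficients
    -- have period m in k.
    C-block : ∀ i k → k < m → C (k ℕ.+ i ℕ.* m) ≈ C (i ℕ.* m) * C k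
    C-block i zero    _   = sym (*-identityʳ _)
    C-block i (suc k) k<m = cancel (reg-K k k<m) (trans (C-step i k k<m)
      (lin₂ (x * y) (- C (i ℕ.* m)) (C-block i k (ℕₚ.<-trans (ℕₚ.n<1+n k) k<m))
        (trans (*-congˡ (reflexive (≡.cong C (≡.sym (ℕₚ.+-identityʳ (suc k)))))) (trans (C-step 0 k k<m) (*-congˡ (reflexive (≡.cong C (ℕₚ.+-identityʳ k))))))
        (solve 7 (λ x y z c c′ d d′ → x :* y :* d :- z :* (c :* c′) := x :* y :* (d :- c :* d′) :+ (:- c) :* (z :* c′ :- x :* y :* d′)) ≡.refl
          x y (1# - K (suc k)) (C (i ℕ.* m)) (C (suc k)) (C (k ℕ.+ i ℕ.* m)) (C k))))
      where
      x = 1# - sq q * sq (K k)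
      y = 1# + K (suc k)

    -- The recursion step from k = h′ carries the factor 1 - q^(4h′+2) = 1 - q^(2m) = 0, and later
    -- steps propagate the zero to the end of the block.
    C-vanish : ∀ j → j ℕ.+ suc h′ < m → C (j ℕ.+ suc h′) ≈ 0#
    C-vanish zero    l = reg-K h′ l (trans (central q h′ (reg-K h′ l))
      (lin₃ (- (1# + pw q m) * y * C h′) (- y * C h′ * sq q * (K h′ + pw q (h′ ℕ.+ h′))) 0# q^m (K-pw q h′) q^m
        (solve 6 (λ q K p y c r → (:1 :- E.sq q :* E.sq K) :* y :* c :- :0
          := (:- (:1 :+ p :* q)) :* y :* c :* (p :* q :- :1) :+ (:- y) :* c :* E.sq q :* (K :+ p) :* (K :- p) :+ :0 :* (p :* q :- :1)) ≡.refl
          q (K h′) (pw q (h′ ℕ.+ h′)) y (C h′) 0#)))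
      where y = 1# + K (suc h′)
    C-vanish (suc j) l = reg-K (j ℕ.+ suc h′) l (trans (central q (j ℕ.+ suc h′) (reg-K (j ℕ.+ suc h′) l))
      (trans (*-congˡ (C-vanish j (ℕₚ.<-trans (ℕₚ.n<1+n _) l))) (zeroʳ _)))

    -- As q² = q^(−4h′), the first block is the terminating series with L = q^(2h′) and d = b q.
    module FirstBlock where

      L d : Carrier
      L = K h′
      d = b * q

      L²q² : sq L * sq q ≈ 1#
      L²q² = lin₃ 1# ((q * K h′ + pw q m) * q) (1# + pw q m) (solve 1 (λ x → x := x) ≡.refl 1#) (K-pw q h′) q^m
        (solve 4 (λ q K p o → E.sq K :* E.sq q :- :1 := :1 :* (:1 :- :1) :+ (q :* K :+ p :* q) :* q :* (K :- p) :+ (:1 :+ p :* q) :* (p :* q :- :1)) ≡.refl q (K h′) (pw q (h′ ℕ.+ h′)) 1#)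

      gP gD gU : ℕ → Carrier
      gP = ∏ (λ k → gν q a d L (K k))
      gD = ∏ (λ k → gδ q a d L (K k))
      gU = hor (λ k → wt q (K k)) gP (λ k → gδ q a d L (K k))

      -- 1 - q K is common to numerator and denominator of the generic series at f = q². It is zero
      -- at k = h′, so it can be cancelled only at smaller indices. The factor q² L² equals 1 here
      -- and balances the powers of L.
      ƛ : Carrier → Carrier
      ƛ K = (1# - q * K) * (sq q * sq L)

      match-ν : ∀ K → gν q a d L K ≈ ƛ K * oν q a b K
      match-ν K = lin₁ (q * (κ * (d - v * (sq q * sq q) * κ) - v * (1# - sq q * κ) * sq q * κ) * μ q a d K) L²q²
        (solve 5 (λ q a b L K → let κ = E.sq K ; v = E.sq L ; d = b :* q in
          E.gν q a d L K :- (:1 :- q :* K) :* (E.sq q :* v) :* E.oν q a b K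
          := q :* (κ :* (d :- v :* (E.sq q :* E.sq q) :* κ) :- v :* (:1 :- E.sq q :* κ) :* E.sq q :* κ) :* E.μ q a d K :* (v :* E.sq q :- :1)) ≡.refl q a b L K)
        where
        κ = sq K
        v = sq L

      match-δ : ∀ K → gδ q a d L K ≈ ƛ K * oδ q a b K
      match-δ K = lin₁ ((1# - sq K′) * pair a (sq K′) * (q * (b - K′)) * ((1# - q * K) * (q * b * K) - q * K * (v * q - d * K))) L²q²
        (solve 5 (λ q a b L K → let K′ = K :* E.sq q ; v = E.sq L ; d = b :* q in
          E.gδ q a d L K :- (:1 :- q :* K) :* (E.sq q :* v) :* E.oδ q a b K
          := (:1 :- E.sq K′) :* E.pair a (E.sq K′) :* (q :* (b :- K′)) :* ((:1 :- q :* K) :* (q :* b :* K) :- q :* K :* (v :* q :- d :* K)) :* (v :* E.sq q :- :1)) ≡.refl q a b L K)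
        where
        K′ = K * sq q
        v = sq L

      k+1<m : ∀ k → k < h′ → suc k < m
      k+1<m k k<h = s≤s (ℕₚ.≤-trans k<h (ℕₚ.m≤m+n h′ h′))

      ratio : ∀ k → k ≤ h′ → P k * gD k ≈ gP k * D k
      ratio = reduced-ratio q a b _ _ (λ k → ƛ (K k)) (λ k → match-ν (K k)) (λ k → match-δ (K k)) h′
        (λ k k<h → reg-K k (k+1<m k k<h))

      reg-ƛ : ∀ k → k < h′ → Reg (ƛ (K k))
      reg-ƛ k k<h = reg-* (reg-cong (+-congˡ (-‿cong (trans (*-comm _ _) (*-congˡ (sym (K-pw q k))))))
          (reg-cyc (suc (k ℕ.+ k)) (s≤s z≤n) (s≤s (ℕₚ.+-mono-<-≤ k<h (ℕₚ.<⇒≤ k<h)))))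
        (reg-cong (trans (sym L²q²) (*-comm _ _)) reg-1)

      -- The hypothesis leaves out the last denominator factor, gδ at k = h′, since that factor is
      -- zero modulo q^m = 1.
      first-block : (∀ k → k < h′ → Reg (pair a (sq (K (suc k))) * pair b (K (suc k)))) →
        gU h′ + wt q (K h′) * gP h′ ≈ 0# → U (suc h′) ≈ 0#
      first-block reg-pair e = reg-cyc 1 (s≤s z≤n) (ℕₚ.≤-<-trans (s≤s z≤n) h′+1<m)
        (lin₃ (denom h′) (P h′ * denom h′) (- denom h′) u-zero (W-wt q a b h′) (hor-scale (1# - q) W (λ k → wt q (K k)) P denom (λ k → sym (W-wt q a b k)) h′)
          (solve 7 (λ q u v w W p d → (:1 :- :1 :* q) :* ((u :+ W :* p) :* d) :- :0
            := d :* (v :+ w :* p :- :0) :+ p :* d :* ((:1 :- q) :* W :- w) :+ (:- d) :* (v :- (:1 :- q) :* u)) ≡.refl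
            q (U h′) (wU h′) (wt q (K h′)) (W h′) (P h′) (denom h′)))
        where
        wU : ℕ → Carrier
        wU = hor (λ k → wt q (K k)) P denom
        reg-gD : Reg (gD h′)
        reg-gD = reg-∏ h′ λ k k<h → reg-cong (sym (match-δ (K k))) (reg-* (reg-ƛ k k<h)
          (reg-cong (sym (*-assoc _ _ _)) (reg-* (reg-cong (solve 1 (λ x → (:1 :- x) :* (:1 :+ x) := :1 :- E.sq x) ≡.refl (K (suc k)))
            (reg-* (reg-K k (k+1<m k k<h)) (reg-cong (+-congˡ (sym (K-pw q (suc k)))) (reg-1+ (suc k ℕ.+ suc k))))) (reg-pair k k<h))))
        u-zero : wU h′ + wt q (K h′) * P h′ ≈ 0#
        u-zero = reg-gD (lin₃ 1# (wt q (K h′)) (D h′)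
          (hor-compare (λ k → wt q (K k)) P gP denom (λ k → gδ q a d L (K k)) h′ (λ k k<h → ratio k (ℕₚ.<⇒≤ k<h)) h′ ℕₚ.≤-refl)
          (ratio h′ ℕₚ.≤-refl) e
          (solve 7 (λ u w p g v r d → g :* (u :+ w :* p) :- :0 := :1 :* (u :* g :- v :* d) :+ w :* (p :* g :- r :* d) :+ d :* (v :+ w :* r :- :0)) ≡.refl
            (wU h′) (wt q (K h′)) (P h′) (gD h′) (gU h′) (gP h′) (D h′)))

      ∏-zero : ∀ {f : ℕ → Carrier} j n → j < n → f j ≈ 0# → ∏ f n ≈ 0#
      ∏-zero {f} j (suc n) j<n e with ℕₚ.m≤n⇒m<n∨m≡n (ℕₚ.≤-pred j<n)
      ... | inj₁ j<n′    = trans (*-congʳ (∏-zero j n j<n′ e)) (zeroˡ _)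
      ... | inj₂ ≡.refl = trans (*-congˡ e) (zeroʳ _)

      u : ℕ → Carrier
      u N = sq (K (suc N))

      u-pw : ∀ j → u j ≈ pw q ((suc j ℕ.+ suc j) ℕ.+ (suc j ℕ.+ suc j))
      u-pw j = trans (*-cong (K-pw q (suc j)) (K-pw q (suc j))) (sym (pw-+ q (suc j ℕ.+ suc j) (suc j ℕ.+ suc j)))

      -- One of q^(4j+3), q^(4j+5) with j < h′ is q^m = 1.
      Y-vanish : ∃ λ j → j < h′ × Y₁ q a d (u j) ≈ 0#
      Y-vanish with parity h′
      ... | j , inj₂ ≡.refl = j , s≤s (ℕₚ.m≤m+n j j) , trans (*-congʳ e) (zeroˡ _)
        where
        e : q - u j ≈ 0#
        e = lin₃ (- q) (- 1#) 0# q^m (trans (u-pw j) (reflexive (≡.cong (pw q) (exponent j)))) refl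
          (solve 3 (λ q u p → q :- u :- :0 := (:- q) :* (p :- :1) :+ (:- :1) :* (u :- p :* q) :+ :0 :* (:1 :- :1)) ≡.refl q (u j) (pw q m))
          where
          exponent : ∀ j → (suc j ℕ.+ suc j) ℕ.+ (suc j ℕ.+ suc j) ≡ suc (suc (suc (j ℕ.+ j) ℕ.+ suc (j ℕ.+ j)))
          exponent = S.solve 1 (λ j → let s = S.con 1 S.:+ j in (s S.:+ s) S.:+ (s S.:+ s) S.:= S.con 2 S.:+ ((S.con 1 S.:+ (j S.:+ j)) S.:+ (S.con 1 S.:+ (j S.:+ j)))) ≡.refl
      ... | zero , inj₁ ≡.refl = contradiction h′>0 λ ()
      ... | suc j , inj₁ ≡.refl = j , s≤s (ℕₚ.m≤m+n j (suc j)) , trans (*-congˡ e) (zeroʳ _)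
        where
        e : 1# - q * u j ≈ 0#
        e = lin₂ (- 1#) (- q) q^m (trans (u-pw j) (reflexive (≡.cong (pw q) (exponent j))))
          (solve 3 (λ q u p → :1 :- q :* u :- :0 := (:- :1) :* (p :* q :- :1) :+ (:- q) :* (u :- p)) ≡.refl q (u j) (pw q (h′ ℕ.+ h′)))
          where
          exponent : ∀ j → (suc j ℕ.+ suc j) ℕ.+ (suc j ℕ.+ suc j) ≡ (suc j ℕ.+ suc j) ℕ.+ (suc j ℕ.+ suc j)
          exponent j = ≡.refl

      module _
        (reg-a : ∀ j → Reg (pair a (pw q (j ℕ.+ j))))
        (reg-b : ∀ j → Reg (pair b (pw q (j ℕ.+ j))))
        (last-term : (gU h′ + wt q (K h′) * gP h′) * ∏ (λ j → X₁ q a d (u j) * X₂ q a d (u j)) h′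
                     ≈ gD h′ * (wt q (K 0) * ∏ (λ j → Y₁ q a d (u j) * Y₂ q a d (u j)) h′))
        where

        reg-q : Reg q
        reg-q = reg-factorˡ (reg-cong (trans (sym q^m) (*-comm _ _)) reg-1)

        reg-b−u : ∀ j → Reg (b - pw q (j ℕ.+ j))
        reg-b−u j = reg-factorˡ (reg-b j)

        -- With d = bq, X consists up to powers of q of b - q^(4j+4), b - q^(4j+2) and the pair of a
        -- with q^(4j+4). All exponents are even, as `reg-a` and `reg-b` require.
        reg-X : ∀ j → Reg (X₁ q a d (u j) * X₂ q a d (u j))
        reg-X j = reg-* (reg-* (reg-cong left (reg-* (reg-neg reg-q) (reg-b−u (suc j ℕ.+ suc j))))
                               (reg-cong right (reg-* (reg-neg (reg-* reg-q reg-q)) (reg-b−u (suc (j ℕ.+ j))))))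
                        (reg-cong (pair-cong (sym (u-pw j))) (reg-a (suc j ℕ.+ suc j)))
          where
          left : - q * (b - pw q ((suc j ℕ.+ suc j) ℕ.+ (suc j ℕ.+ suc j))) ≈ u j * q - d
          left = lin₁ (- q) (u-pw j) (solve 4 (λ q b u p → (:- q) :* (b :- p) :- (u :* q :- b :* q) := (:- q) :* (u :- p)) ≡.refl q b (u j) (pw q ((suc j ℕ.+ suc j) ℕ.+ (suc j ℕ.+ suc j))))
          right : - (q * q) * (b - pw q (suc (j ℕ.+ j) ℕ.+ suc (j ℕ.+ j))) ≈ u j - d * q
          right = lin₂ (- 1#) (- 1#) (trans (u-pw j) (reflexive (≡.cong (pw q) (exponent j)))) refl
            (solve 4 (λ q b u p → (:- (q :* q)) :* (b :- p) :- (u :- b :* q :* q) := (:- :1) :* (u :- p :* q :* q) :+ (:- :1) :* (:1 :- :1)) ≡.refl q b (u j) (pw q (suc (j ℕ.+ j) ℕ.+ suc (j ℕ.+ j))))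
            where
            exponent : ∀ j → (suc j ℕ.+ suc j) ℕ.+ (suc j ℕ.+ suc j) ≡ suc (suc (suc (j ℕ.+ j) ℕ.+ suc (j ℕ.+ j)))
            exponent = S.solve 1 (λ j → let s = S.con 1 S.:+ j in (s S.:+ s) S.:+ (s S.:+ s) S.:= S.con 2 S.:+ ((S.con 1 S.:+ (j S.:+ j)) S.:+ (S.con 1 S.:+ (j S.:+ j)))) ≡.refl

        first-block-vanishes : U (suc h′) ≈ 0#
        first-block-vanishes = first-block
          (λ k _ → reg-* (reg-cong (pair-cong (sym (u-pw k))) (reg-a (suc k ℕ.+ suc k)))
                         (reg-cong (pair-cong (sym (K-pw q (suc k)))) (reg-b (suc k))))
          (reg-∏ h′ (λ j _ → reg-X j) (trans (*-comm _ _) (trans last-term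
            (trans (*-congˡ (trans (*-congˡ (∏-zero (proj₁ Y-vanish) h′ (proj₁ (proj₂ Y-vanish))
              (trans (*-congʳ (proj₂ (proj₂ Y-vanish))) (zeroˡ _)))) (zeroʳ _))) (zeroʳ _)))))

    module Blocks (first-block : U (suc h′) ≈ 0#) where

      U-vanish : ∀ j → j ℕ.+ suc h′ ≤ m → U (j ℕ.+ suc h′) ≈ 0#
      U-vanish zero    _ = first-block
      U-vanish (suc j) l = lin₂ (denom k) (W k * ∏ numer k * denom k) (U-vanish j (ℕₚ.<⇒≤ l)) (C-vanish j l)
        (solve 5 (λ u w c p d → (u :+ w :* (c :* p)) :* d :- :0 := d :* (u :- :0) :+ w :* p :* d :* (c :- :0)) ≡.refl (U k) (W k) (C k) (∏ numer k) (denom k))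
        where k = j ℕ.+ suc h′

      ∏num-block : ∀ i k → ∏ numer (k ℕ.+ i ℕ.* m) ≈ ∏ numer (i ℕ.* m) * ∏ numer k
      ∏num-block i zero    = sym (*-identityʳ _)
      ∏num-block i (suc k) = trans (*-cong (∏num-block i k) (num-period i k)) (*-assoc _ _ _)

      -- By periodicity the terms of block i are those of the first block times the value of P at
      -- im, and the earlier part only picks up further denominator factors.
      U-block : ∀ i k → k ≤ m → U (k ℕ.+ i ℕ.* m) ≈ U (i ℕ.* m) * D k + C (i ℕ.* m) * ∏ numer (i ℕ.* m) * U k
      U-block i zero    _   = solve 2 (λ u c → u := u :* :1 :+ c :* :0) ≡.refl (U (i ℕ.* m)) (C (i ℕ.* m) * ∏ numer (i ℕ.* m))
      U-block i (suc k) k<m = trans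
        (*-cong (+-cong (U-block i k (ℕₚ.<⇒≤ k<m)) (*-cong (W-period i k) (*-cong (C-block i k k<m) (∏num-block i k)))) (den-period i k))
        (solve 9 (λ u D c p v w c′ p′ d → (u :* D :+ c :* p :* v :+ w :* (c :* c′ :* (p :* p′))) :* d := u :* (D :* d) :+ c :* p :* ((v :+ w :* (c′ :* p′)) :* d)) ≡.refl
          (U (i ℕ.* m)) (D k) (C (i ℕ.* m)) (∏ numer (i ℕ.* m)) (U k) (W k) (C k) (∏ numer k) (denom k))

      block-vanish : ∀ i k → k ≤ m → U (i ℕ.* m) ≈ 0# → U k ≈ 0# → U (k ℕ.+ i ℕ.* m) ≈ 0#
      block-vanish i k k≤m u v = trans (U-block i k k≤m) (trans (+-cong (trans (*-congʳ u) (zeroˡ _)) (trans (*-congˡ v) (zeroʳ _))) (+-identityˡ 0#))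

      U-multiple : ∀ i → U (i ℕ.* m) ≈ 0#
      U-multiple zero    = refl
      U-multiple (suc i) = block-vanish i m ℕₚ.≤-refl (U-multiple i)
        (≡.subst (λ k → U k ≈ 0#) (ℕₚ.+-suc h′ h′) (U-vanish h′ (ℕₚ.≤-reflexive (ℕₚ.+-suc h′ h′))))

      U-half : ∀ i → U (suc h′ ℕ.+ i ℕ.* m) ≈ 0#
      U-half i = block-vanish i (suc h′) (ℕₚ.<⇒≤ h′+1<m) (U-multiple i) first-block

-- Evaluation of the terminating sums in generic variables

module Evaluation (R : CommutativeRing 0ℓ 0ℓ) where

  open RingReasoning R
  open Powers R
  open Summation₁ R using (module GenericSum)
  open Summation₂ R using (module OddSum)
  open Reduction R
  open CommutativeRing R hiding (zero)
  open Formulas _+_ _*_ -_ 0# 1#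

  -- The hypotheses hold for three independent variables over an integral domain.
  module Generic (q a b : Carrier)
    (reg-q      : Reg q)
    (reg-cyc    : ∀ i → Reg (1# - pw q (suc i)))
    (reg-parity : ∀ i j → Reg (pw q (i ℕ.+ i) - pw q (suc (j ℕ.+ j))))
    (reg-a      : ∀ i j → Reg (a * pw q i - pw q j))
    (reg-b      : ∀ i j → Reg (b * pw q i - pw q j))
    where

    K : ℕ → Carrier
    K = pw (sq q)

    -- Each factor to be cancelled compares monomials. These classes decide which regularity
    -- hypothesis applies to it; two powers of q are told apart by the parity of their exponents.
    QPower EvenQ OddQ PosQ : Carrier → Set
    QPower x = ∃ λ i → x ≈ pw q i
    EvenQ x  = ∃ λ i → x ≈ pw q (i ℕ.+ i)
    OddQ x   = ∃ λ i → x ≈ pw q (suc (i ℕ.+ i))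
    PosQ x   = ∃ λ i → x ≈ pw q (suc i)

    even⇒power : ∀ {x} → EvenQ x → QPower x
    even⇒power (i , e) = i ℕ.+ i , e

    odd⇒pos : ∀ {x} → OddQ x → PosQ x
    odd⇒pos (i , e) = i ℕ.+ i , e

    pos⇒power : ∀ {x} → PosQ x → QPower x
    pos⇒power (i , e) = suc i , e

    odd⇒power : ∀ {x} → OddQ x → QPower x
    odd⇒power = pos⇒power ∘ odd⇒pos

    power-* : ∀ {x y} → QPower x → QPower y → QPower (x * y)
    power-* (i , e) (j , f) = i ℕ.+ j , trans (*-cong e f) (sym (pw-+ q i j))

    pos-* : ∀ {x y} → PosQ x → QPower y → PosQ (x * y)
    pos-* (i , e) (j , f) = i ℕ.+ j , trans (*-cong e f) (sym (pw-+ q (suc i) j))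

    even-* : ∀ {x y} → EvenQ x → EvenQ y → EvenQ (x * y)
    even-* (i , e) (j , f) = i ℕ.+ j , trans (trans (*-cong e f) (sym (pw-+ q (i ℕ.+ i) (j ℕ.+ j))))
      (reflexive (≡.cong (pw q) (ℕ-interchange i i j j)))

    odd-even : ∀ {x y} → OddQ x → EvenQ y → OddQ (x * y)
    odd-even (i , e) (j , f) = i ℕ.+ j , trans (trans (*-cong e f) (sym (pw-+ q (suc (i ℕ.+ i)) (j ℕ.+ j))))
      (reflexive (≡.cong (pw q ∘ suc) (ℕ-interchange i i j j)))

    even-odd : ∀ {x y} → EvenQ x → OddQ y → OddQ (x * y)
    even-odd e o with odd-even o e
    ... | i , f = i , trans (*-comm _ _) f

    even-1 : EvenQ 1#
    even-1 = 0 , refl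

    odd-q : OddQ q
    odd-q = 0 , sym (*-identityˡ q)

    even-qq : EvenQ (sq q)
    even-qq = 1 , *-congʳ (sym (*-identityˡ q))

    even-K : ∀ k → EvenQ (K k)
    even-K k = k , K-pw q k

    even-sq : ∀ {x} → EvenQ x → EvenQ (sq x)
    even-sq e = even-* e e

    pos-K : ∀ k → PosQ (K (suc k))
    pos-K k = k ℕ.+ suc k , K-pw q (suc k)

    pos-sqK : ∀ k → PosQ (sq (K (suc k)))
    pos-sqK k = pos-* (pos-K k) (even⇒power (even-K (suc k)))

    difference-cong : ∀ {x y z w} → x ≈ z → y ≈ w → Reg (z - w) → Reg (x - y)
    difference-cong e f = reg-cong (+-cong (sym e) (-‿cong (sym f)))

    reg-swap : ∀ {x y} → Reg (x - y) → Reg (y - x)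
    reg-swap {x} {y} r = reg-cong (solve 2 (λ x y → :- (x :- y) := y :- x) ≡.refl x y) (reg-neg r)

    even−odd : ∀ {x y} → EvenQ x → OddQ y → Reg (x - y)
    even−odd (i , e) (j , f) = difference-cong e f (reg-parity i j)

    odd−even : ∀ {x y} → OddQ x → EvenQ y → Reg (x - y)
    odd−even o e = reg-swap (even−odd e o)

    1−pos : ∀ {x} → PosQ x → Reg (1# - x)
    1−pos (i , e) = difference-cong refl e (reg-cyc i)

    Letter : Carrier → Set
    Letter y = ∀ i j → Reg (y * pw q i - pw q j)

    letter−Q : ∀ {y x z} → Letter y → QPower x → QPower z → Reg (y * x - z)
    letter−Q l (i , e) (j , f) = difference-cong (*-congˡ e) f (l i j)

    Q−letter : ∀ {y x z} → Letter y → QPower x → QPower z → Reg (z - y * x)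
    Q−letter l p r = reg-swap (letter−Q l p r)

    pair-letter : ∀ {y x} → Letter y → QPower x → Reg (pair y x)
    pair-letter {y} {x} l p = reg-* (reg-cong (+-congʳ (*-identityʳ y)) (letter−Q l (even⇒power even-1) p)) (Q−letter l p (even⇒power even-1))

    pair-odd-even : ∀ {x y} → OddQ x → EvenQ y → Reg (pair x y)
    pair-odd-even o e = reg-* (odd−even o e) (1−pos (odd⇒pos (odd-even o e)))

    reg-sqK : ∀ k → Reg (1# - sq (K (suc k)))
    reg-sqK k = 1−pos (pos-sqK k)

    pw⁴ : ∀ i → Carrier
    pw⁴ i = sq (K i)

    y₂ y₄ : ℕ → Carrier
    y₂ i = sq q * pw⁴ i
    y₄ i = pw⁴ (suc i)

    -- A chain of four evaluations: reduced sum to certificate form, the product formula, the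
    -- quotient of the products, and f/(1 - q) = ι. Afterwards (1 - q) D̂ X cancels.
    conclude : ∀ {U Û D D̂ X Y w₀ f Dm Nm ι} → Reg D̂ → Reg X → w₀ ≈ 1# - q →
      (1# - q) * U * D̂ ≈ Û * D → Û * X ≈ D̂ * (w₀ * Y) → Y * (1# - q) * Dm ≈ X * f * Nm → (1# - q) * ι ≈ f →
      U * Dm ≈ D * (ι * Nm)
    conclude {U} {Û} {D} {D̂} {X} {Y} {w₀} {f} {Dm} {Nm} {ι} rD rX w e₁ e₂ e₃ e₄ =
      cancel (reg-* (reg-* reg-1−q rD) rX) (lin₂ (D * D̂ * Y * Dm) (- (D * D̂ * X * Nm)) w e₄
        (lin₃ (X * Dm) (Dm * D) (D * D̂) e₁ e₂ e₃
          (solve 12 (λ q U Û D D̂ X Y w f Dm Nm ι → let s = :1 :- q in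
            s :* D̂ :* X :* (U :* Dm) :- s :* D̂ :* X :* (D :* (ι :* Nm)) :- (D :* D̂ :* Y :* Dm :* (w :- s) :+ (:- (D :* D̂ :* X :* Nm)) :* (s :* ι :- f))
            := X :* Dm :* (s :* U :* D̂ :- Û :* D) :+ Dm :* D :* (Û :* X :- D̂ :* (w :* Y)) :+ D :* D̂ :* (Y :* s :* Dm :- X :* f :* Nm)) ≡.refl
            q U Û D D̂ X Y w₀ f Dm Nm ι)))
      where
      reg-1−q : Reg (1# - q)
      reg-1−q = 1−pos (odd⇒pos odd-q)

    w₀≈ : wt q (K 0) ≈ 1# - q
    w₀≈ = solve 1 (λ q → (:1 :- q :* (:1 :* (:1 :* :1))) :* :1 := :1 :- q) ≡.refl q

    -- The instance for the first block at a root of unity: there q² = q^(-4h′) plays the part of f,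
    -- and bq remains as d.
    module SumC where

      d : Carrier
      d = b * q

      open GenericSum q a d public hiding (K)

      dK : ∀ k → b * (q * K k) ≈ d * K k
      dK k = sym (*-assoc b q (K k))

      odd-qK : ∀ k → OddQ (q * K k)
      odd-qK k = odd-even odd-q (even-K k)

      even-u : ∀ N → EvenQ (u N)
      even-u N = even-sq (even-K (suc N))

      odd-vq : ∀ N → OddQ (sq (K N) * q)
      odd-vq N = even-odd (even-sq (even-K N)) odd-q

      reg-δ : ∀ N k → Reg (δ N k)
      reg-δ N k = reg-* (reg-* (reg-* (reg-* (reg-sqK k) (pair-letter reg-a (pos⇒power (pos-sqK k))))
          (letter−Q reg-b (odd⇒power odd-q) (odd⇒power (odd-qK (suc k)))))
          (1−pos (odd⇒pos (odd-even (odd-vq N) (even-K (suc k))))))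
        (reg-cong (+-congˡ (-‿cong (dK k))) (Q−letter reg-b (odd⇒power (odd-qK k)) (odd⇒power (odd-vq N))))

      open Summation
        (λ N k → letter−Q reg-b (odd⇒power odd-q) (even⇒power (even-* (even-u N) (even-sq (even-K k)))))
        (λ N k → reg-cong (+-congˡ (-‿cong (dK k))) (Q−letter reg-b (odd⇒power (odd-qK k)) (odd⇒power (even-odd (even-u N) odd-q))))
        (λ N k → reg-cong (+-congˡ (-‿cong (trans (sym (*-assoc b (q * q) (K k))) (*-congʳ (sym (*-assoc b q q))))))
          (Q−letter reg-b (even⇒power (even-* even-qq (even-K k))) (even⇒power (even-u N))))
        (λ N → reg-swap (1−pos (pos-sqK N)))
        (λ N → pair-odd-even odd-q (even-u N))
        reg-δ public

      -- δ N N contains 1 - q^(6N+3), which becomes zero once q^(2N+1) = 1. It is therefore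
      -- cancelled here, where it is still regular, before the identity is carried to a quotient.
      last-term : ∀ N → (U N N + w N * P N N) * ∏ X N ≈ D N N * (w 0 * ∏ Y N)
      last-term N = cancel (reg-δ N N) (trans (solve 3 (λ d u x → d :* (u :* x) := u :* d :* x) ≡.refl (δ N N) (U N N + w N * P N N) (∏ X N))
        (trans (sums N 0) (solve 3 (λ d u x → u :* d :* x := d :* (u :* x)) ≡.refl (δ N N) (D N N) (w 0 * ∏ Y N))))

    -- b = q^(4N+1) makes q/b = q^(-4N) the terminating parameter f, while q² is d.
    module SumB where

      d : Carrier
      d = sq q

      open GenericSum q a d public hiding (K)

      even-u : ∀ N → EvenQ (u N)
      even-u N = even-sq (even-K (suc N))

      odd-vq : ∀ N → OddQ (sq (K N) * q)
      odd-vq N = even-odd (even-sq (even-K N)) odd-q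

      reg-δ : ∀ N k → Reg (δ N k)
      reg-δ N k = reg-* (reg-* (reg-* (reg-* (reg-sqK k) (pair-letter reg-a (pos⇒power (pos-sqK k))))
          (even−odd even-qq (odd-even odd-q (even-K (suc k)))))
          (1−pos (odd⇒pos (odd-even (odd-vq N) (even-K (suc k))))))
        (odd−even (odd-vq N) (even-* even-qq (even-K k)))

      reg-pos : ∀ N k → PosQ (sq (K N) * sq q * sq (K k))
      reg-pos N k = pos-* (pos-cong (*-comm (sq q) (sq (K N))) (pos-* pos-qq (even⇒power (even-sq (even-K N))))) (even⇒power (even-sq (even-K k)))
        where
        pos-qq : PosQ (sq q)
        pos-qq = 1 , *-congʳ (sym (*-identityˡ q))
        pos-cong : ∀ {x y} → x ≈ y → PosQ x → PosQ y
        pos-cong e (i , f) = i , trans (sym e) f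

      open Summation
        (λ N k → reg-cong (solve 3 (λ q L κ → E.sq q :* (:1 :- E.sq L :* E.sq q :* κ) := E.sq q :- E.sq (L :* E.sq q) :* κ) ≡.refl q (K N) (sq (K k)))
          (reg-* (reg-* reg-q reg-q) (1−pos (reg-pos N k))))
        (λ N k → odd−even (even-odd (even-u N) odd-q) (even-* even-qq (even-K k)))
        (λ N k → even−odd (even-u N) (odd-even (even-odd even-qq odd-q) (even-K k)))
        (λ N → reg-swap (1−pos (pos-sqK N)))
        (λ N → pair-odd-even odd-q (even-u N))
        reg-δ public

      reg-X : ∀ N → Reg (X N)
      reg-X N = reg-* (reg-* (odd−even (even-odd (even-u N) odd-q) even-qq) (even−odd (even-u N) (even-odd even-qq odd-q)))
        (pair-letter reg-a (even⇒power (even-u N)))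

      -- At d = q², Y₁/X₁ reduces to (1 - q^(4N+5))/(1 - q^(4N+1)) up to a power of q and
      -- telescopes; Y₂/X₂ puts the pair at q^(4N+2) over the pair at q^(4N+4), and the powers of q
      -- cancel.
      product-form : ∀ N → ∏ Y N * (1# - q) * ∏ (λ i → pair a (y₄ i)) N ≈ ∏ X N * (1# - q * pw⁴ N) * ∏ (λ i → pair a (y₂ i)) N
      product-form zero    = solve 1 (λ q → :1 :* (:1 :- q) :* :1 := :1 :* (:1 :- q :* (:1 :* :1)) :* :1) ≡.refl q
      product-form (suc N) = lin₁ (sq q * sq q * (q - u N) * (1# - q * u N) * pair a (y₂ N) * pair a (y₄ N)) (product-form N)
        (solve 7 (λ q K a y d x n → let u = E.sq (K :* E.sq q) ; p = E.pair a (E.sq q :* E.sq K) in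
          y :* (E.pair q u :* ((E.sq q :- a :* u) :* (a :* E.sq q :- u))) :* (:1 :- q) :* (d :* E.pair a u)
            :- x :* ((u :* q :- E.sq q) :* (u :- E.sq q :* q) :* E.pair a u) :* (:1 :- q :* u) :* (n :* p)
          := E.sq q :* E.sq q :* (q :- u) :* (:1 :- q :* u) :* p :* E.pair a u :* (y :* (:1 :- q) :* d :- x :* (:1 :- q :* E.sq K) :* n)) ≡.refl
          q (K N) a (∏ Y N) (∏ (λ i → pair a (y₄ i)) N) (∏ X N) (∏ (λ i → pair a (y₂ i)) N))

      ƛ : ℕ → Carrier
      ƛ k = sq q * (1# - q * K k)

      match-ν : ∀ N k → ν N k ≈ ƛ k * oν q a (q * pw⁴ N) (K k)
      match-ν N k = solve 4 (λ q a L K → E.gν q a (E.sq q) L K := E.sq q :* (:1 :- q :* K) :* E.oν q a (q :* E.sq L) K) ≡.refl q a (K N) (K k)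

      match-δ : ∀ N k → δ N k ≈ ƛ k * oδ q a (q * pw⁴ N) (K k)
      match-δ N k = solve 4 (λ q a L K → E.gδ q a (E.sq q) L K := E.sq q :* (:1 :- q :* K) :* E.oδ q a (q :* E.sq L) K) ≡.refl q a (K N) (K k)

      sum-at-odd-power : ∀ N j ι → (1# - q) * ι ≈ 1# - q * pw⁴ N → let k = suc j ℕ.+ N in
        Reduced.U q a (q * pw⁴ N) k * ∏ (λ i → pair a (y₄ i)) N ≈ Reduced.D q a (q * pw⁴ N) k * (ι * ∏ (λ i → pair a (y₂ i)) N)
      sum-at-odd-power N j ι hι = conclude (reg-D reg-δ N k) (reg-∏ N λ i _ → reg-X i) w₀≈
        (reduced-sum q a (q * pw⁴ N) (ν N) (δ N) ƛ (match-ν N) (match-δ N) k (λ i _ → 1−pos (pos-K i)) k ℕₚ.≤-refl)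
        (sums N j) (product-form N) hι
        where k = suc j ℕ.+ N

    module SumA where

      open OddSum q b public hiding (K)

      odd-x : ∀ N → OddQ (x N)
      odd-x zero    = odd-q
      odd-x (suc N) = odd-even (odd-x N) (even-sq even-qq)

      x≈ : ∀ N → x N ≈ q * pw⁴ N
      x≈ zero    = solve 1 (λ q → q := q :* (:1 :* :1)) ≡.refl q
      x≈ (suc N) = trans (*-congʳ (x≈ N)) (solve 2 (λ q K → q :* (K :* K) :* (q :* q :* (q :* q)) := q :* (K :* (q :* q) :* (K :* (q :* q)))) ≡.refl q (K N))

      reg-δ : ∀ N k → Reg (δ N k)
      reg-δ N k = reg-* (reg-* (reg-sqK k) (pair-odd-even (odd-x N) (even-sq (even-K (suc k))))) (pair-letter reg-b (even⇒power (even-K (suc k))))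

      pos-x : ∀ N {z} → QPower z → PosQ (x N * z)
      pos-x N z = pos-* (odd⇒pos (odd-x N)) z

      power-q* : ∀ {z} → QPower z → QPower (q * z)
      power-q* z = power-* (odd⇒power odd-q) z

      open Summation
        (λ N k → 1−pos (pos-x N (power-q* (even⇒power (even-K k)))))
        (λ N k → 1−pos (pos-x N (power-* (power-q* (even⇒power even-qq)) (even⇒power (even-K k)))))
        (λ N k → odd−even (odd-x N) (even-sq (even-K k)))
        (λ N → 1−pos (odd⇒pos (odd-x (suc N))))
        reg-δ public

      reg-pair-u : ∀ N → Reg (pair b (x N * (q * sq q)))
      reg-pair-u N = pair-letter reg-b (power-* (odd⇒power (odd-x N)) (power-q* (even⇒power even-qq)))

      reg-X : ∀ N → Reg (X N)
      reg-X N = reg-* (1−pos (odd⇒pos (odd-x N))) (reg-pair-u N)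

      product-form : ∀ N → ∏ Y N * (1# - q) * ∏ (λ i → pair b (y₄ i)) N ≈ ∏ X N * (1# - x N) * ∏ (λ i → pair b (y₂ i)) N
      product-form zero    = solve 1 (λ q → :1 :* (:1 :- q) :* :1 := :1 :* (:1 :- q) :* :1) ≡.refl q
      product-form (suc N) = trans
        (*-congˡ (*-congˡ (pair-cong (solve 2 (λ q K → K :* (q :* q) :* (K :* (q :* q)) := q :* (K :* K) :* (q :* (q :* q))) ≡.refl q (K N) ⟨ trans ⟩ *-congʳ (sym (x≈ N))))))
        (trans (lin₁ ((1# - x (suc N)) * pair b (x N * q) * pair b (x N * (q * sq q))) (product-form N)
          (solve 9 (λ y s d x f n z p r → y :* (z :* p) :* s :* (d :* r) :- x :* (f :* r) :* z :* (n :* p)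
              := z :* p :* r :* (y :* s :* d :- x :* f :* n)) ≡.refl
            (∏ Y N) (1# - q) (∏ (λ i → pair b (y₄ i)) N) (∏ X N) (1# - x N) (∏ (λ i → pair b (y₂ i)) N)
            (1# - x (suc N)) (pair b (x N * q)) (pair b (x N * (q * sq q)))))
        (*-congˡ (*-congˡ (pair-cong (trans (*-congʳ (x≈ N)) (solve 2 (λ q K → q :* (K :* K) :* q := q :* q :* (K :* K)) ≡.refl q (K N)))))))

      sum-at-odd-power : ∀ N j ι → (1# - q) * ι ≈ 1# - q * pw⁴ N → let k = suc j ℕ.+ double N in
        Reduced.U q (x N) b k * ∏ (λ i → pair b (y₄ i)) N ≈ Reduced.D q (x N) b k * (ι * ∏ (λ i → pair b (y₂ i)) N)
      sum-at-odd-power N j ι hι = conclude (reg-D reg-δ N k) (reg-∏ N λ i _ → reg-X i) w₀≈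
        (reduced-sum q (x N) b (ν N) (δ N) (λ _ → 1#) (λ i → sym (*-identityˡ _)) (λ i → sym (*-identityˡ _)) k (λ i _ → 1−pos (pos-K i)) k ℕₚ.≤-refl)
        (sums N j) (product-form N) (trans hι (+-congˡ (-‿cong (sym (x≈ N)))))
        where k = suc j ℕ.+ double N

      double≡ : ∀ N → double N ≡ N ℕ.+ N
      double≡ zero    = ≡.refl
      double≡ (suc N) = ≡.cong suc (≡.trans (≡.cong suc (double≡ N)) (≡.sym (ℕₚ.+-suc N N)))

    module _ {X : Carrier} (N : ℕ) (hX : q * pw⁴ N ≈ X) (ι : Carrier) (hι : (1# - q) * ι ≈ 1# - X) where

      private
        hι′ : (1# - q) * ι ≈ 1# - q * pw⁴ N
        hι′ = trans hι (+-congˡ (-‿cong (sym hX)))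

      -- Every truncation at or past the end of the series is covered, hence both values of M.
      sum-a : ∀ j → let k = suc j ℕ.+ (N ℕ.+ N) in
        Reduced.U q X b k * ∏ (λ i → pair b (y₄ i)) N ≈ Reduced.D q X b k * (ι * ∏ (λ i → pair b (y₂ i)) N)
      sum-a j = ≡.subst (λ l → let k = suc j ℕ.+ l in Reduced.U q X b k * ∏ (λ i → pair b (y₄ i)) N ≈ Reduced.D q X b k * (ι * ∏ (λ i → pair b (y₂ i)) N))
        (SumA.double≡ N) (trans (*-congʳ (sym (U-cong x≈X refl k))) (trans (SumA.sum-at-odd-power N j ι hι′) (*-congʳ (D-cong x≈X refl k))))
        where
        k = suc j ℕ.+ SumA.double N
        x≈X : SumA.x N ≈ X
        x≈X = trans (SumA.x≈ N) hX

      sum-b : ∀ j → let k = suc j ℕ.+ N in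
        Reduced.U q a X k * ∏ (λ i → pair a (y₄ i)) N ≈ Reduced.D q a X k * (ι * ∏ (λ i → pair a (y₂ i)) N)
      sum-b j = trans (*-congʳ (sym (U-cong refl hX k))) (trans (SumB.sum-at-odd-power N j ι hι′) (*-congʳ (D-cong refl hX k)))
        where k = suc j ℕ.+ N

    reg-oδ : ∀ k → Reg (oδ q a b (K k))
    reg-oδ k = reg-* (reg-* (reg-sqK k) (pair-letter reg-a (pos⇒power (pos-sqK k)))) (pair-letter reg-b (even⇒power (even-K (suc k))))

    reg-1−K : ∀ k → Reg (1# - K (suc k))
    reg-1−K k = 1−pos (pos-K k)

    reg-1−q : Reg (1# - q)
    reg-1−q = 1−pos (odd⇒pos odd-q)

    reg-odd : ∀ i → Reg (1# - q * pw (pw q 4) i)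
    reg-odd i = 1−pos (odd⇒pos (odd-even odd-q (i ℕ.+ i , trans (pw-pw q 4 i) (reflexive (≡.cong (pw q) (four i))))))
      where
      four : ∀ i → i ℕ.* 4 ≡ (i ℕ.+ i) ℕ.+ (i ℕ.+ i)
      four = S.solve 1 (λ i → i S.:* S.con 4 S.:= (i S.:+ i) S.:+ (i S.:+ i)) ≡.refl

    reg-a-y₄ : ∀ i → Reg (pair a (y₄ i))
    reg-a-y₄ i = pair-letter reg-a (pos⇒power (pos-sqK i))

    reg-b-y₄ : ∀ i → Reg (pair b (y₄ i))
    reg-b-y₄ i = pair-letter reg-b (pos⇒power (pos-sqK i))

-- Translation from q-shifted factorials

module Pochhammer (R : CommutativeRing 0ℓ 0ℓ) where

  open RingReasoning R
  open Powers R
  open Reduction R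
  open CommutativeRing R hiding (zero)
  open Formulas _+_ _*_ -_ 0# 1#

  ∏-* : ∀ (f g : ℕ → Carrier) n → ∏ f n * ∏ g n ≈ ∏ (λ k → f k * g k) n
  ∏-* f g zero    = *-identityˡ 1#
  ∏-* f g (suc n) = trans (solve 4 (λ a b c d → a :* b :* (c :* d) := a :* c :* (b :* d)) ≡.refl (∏ f n) (f n) (∏ g n) (g n)) (*-congʳ (∏-* f g n))

  ∏-*₅ : ∀ (f₁ f₂ f₃ f₄ f₅ : ℕ → Carrier) n → ∏ f₁ n * ∏ f₂ n * ∏ f₃ n * ∏ f₄ n * ∏ f₅ n ≈ ∏ (λ k → f₁ k * f₂ k * f₃ k * f₄ k * f₅ k) n
  ∏-*₅ f₁ f₂ f₃ f₄ f₅ n = trans (*-congʳ (trans (*-congʳ (trans (*-congʳ (∏-* f₁ f₂ n)) (∏-* _ f₃ n))) (∏-* _ f₄ n))) (∏-* _ f₅ n)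

  -- d^n (u/d; t)_n, so that no division is needed.
  pochhammer : Carrier → Carrier → Carrier → ℕ → Carrier
  pochhammer u d t = ∏ (λ k → d - u * pw t k)

  module _ (q a b : Carrier) where
    open Reduced q a b

    q² q⁴ : Carrier
    q² = pw q 2
    q⁴ = pw q 4

    base² : ∀ k → pw q² k ≈ K k
    base² k = pw-cong k (solve 1 (λ q → E.pw q 2 := E.sq q) ≡.refl q)

    base⁴ : ∀ k → pw q⁴ k ≈ sq (K k)
    base⁴ k = trans (pw-cong k (solve 1 (λ q → E.pw q 4 := E.sq q :* E.sq q) ≡.refl q)) (pw-* (sq q) (sq q) k)

    factor² : ∀ u d k → d - u * pw q² k ≈ d - u * K k
    factor² u d k = +-congˡ (-‿cong (*-congˡ (base² k)))

    factor⁴ : ∀ u d k → d - u * pw q⁴ k ≈ d - u * sq (K k)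
    factor⁴ u d k = +-congˡ (-‿cong (*-congˡ (base⁴ k)))

    plain-num plain-den : ℕ → Carrier
    plain-num k = pochhammer (a * q) 1# q² k * pochhammer q a q² k * pochhammer q² 1# q⁴ k * pochhammer (b * q) 1# q⁴ k * pochhammer q b q⁴ k
    plain-den k = pochhammer q⁴ 1# q⁴ k * pochhammer q⁴ a q⁴ k * pochhammer (a * q⁴) 1# q⁴ k * pochhammer q² b q² k * pochhammer (b * q²) 1# q² k

    plain-num≈ : ∀ k → plain-num k ≈ ∏ (λ j → oν q a b (K j)) k
    plain-num≈ k = trans (∏-*₅ _ _ _ _ _ k) (∏-cong k λ j → trans
      (*-cong (*-cong (*-cong (*-cong (factor² (a * q) 1# j) (factor² q a j)) (factor⁴ q² 1# j)) (factor⁴ (b * q) 1# j)) (factor⁴ q b j))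
      (solve 4 (λ q a b K → (:1 :- a :* q :* K) :* (a :- q :* K) :* (:1 :- E.pw q 2 :* E.sq K) :* (:1 :- b :* q :* E.sq K) :* (b :- q :* E.sq K) := E.oν q a b K) ≡.refl q a b (K j)))

    plain-den≈ : ∀ k → plain-den k ≈ ∏ (λ j → oδ q a b (K j)) k
    plain-den≈ k = trans (∏-*₅ _ _ _ _ _ k) (∏-cong k λ j → trans
      (*-cong (*-cong (*-cong (*-cong (factor⁴ q⁴ 1# j) (factor⁴ q⁴ a j)) (factor⁴ (a * q⁴) 1# j)) (factor² q² b j)) (factor² (b * q²) 1# j))
      (solve 4 (λ q a b K → (:1 :- E.pw q 4 :* E.sq K) :* (a :- E.pw q 4 :* E.sq K) :* (:1 :- a :* E.pw q 4 :* E.sq K) :* (b :- E.pw q 2 :* K) :* (:1 :- b :* E.pw q 2 :* K) := E.oδ q a b K) ≡.refl q a b (K j)))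

    module _ (reg-K : ∀ k → Reg (1# - K (suc k))) where

      plain-reduced : ∀ k → P k * plain-den k ≈ plain-num k * D k
      plain-reduced k = trans (*-congˡ (plain-den≈ k)) (trans
        (reduced-ratio q a b (λ j → oν q a b (K j)) (λ j → oδ q a b (K j)) (λ _ → 1#) (λ j → sym (*-identityˡ _)) (λ j → sym (*-identityˡ _)) k (λ j _ → reg-K j) k ℕₚ.≤-refl)
        (*-congʳ (sym (plain-num≈ k))))

      term-form : ∀ k → (1# - pw q (6 ℕ.* k ℕ.+ 1)) * plain-num k * pw q (2 ℕ.* k) * D k ≈ W k * P k * ((1# - q) * plain-den k)
      term-form k = lin₃ (- (D k * plain-num k * pw q (2 ℕ.* k))) (- (W k * (1# - q))) (plain-num k * D k * (1# - q) * q-int q (6 ℕ.* k ℕ.+ 1))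
        (q-int-cyc q (6 ℕ.* k ℕ.+ 1)) (plain-reduced k) (sym (trans (K-pw q k) (reflexive (≡.cong (λ j → pw q (k ℕ.+ j)) (≡.sym (ℕₚ.+-identityʳ k))))))
        (solve 9 (λ q i x N D P M K x² → (:1 :- x) :* N :* x² :* D :- i :* K :* P :* ((:1 :- q) :* M)
          := (:- (D :* N :* x²)) :* ((:1 :- q) :* i :- (:1 :- x)) :+ (:- (i :* K :* (:1 :- q))) :* (P :* M :- N :* D) :+ N :* D :* (:1 :- q) :* i :* (x² :- K)) ≡.refl
          q (q-int q (6 ℕ.* k ℕ.+ 1)) (pw q (6 ℕ.* k ℕ.+ 1)) (plain-num k) (D k) (P k) (plain-den k) (K k) (pw q (2 ℕ.* k)))

  module _ (q x : Carrier) where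

    private
      K y₂ y₄ : ℕ → Carrier
      K = pw (sq q)
      y₂ i = sq q * sq (K i)
      y₄ i = sq (K (suc i))

    product-num product-den : ℕ → Carrier
    product-num N = pochhammer (pw q 5) 1# (pw q 4) N * pochhammer (x * pw q 2) 1# (pw q 4) N * pochhammer (pw q 2) x (pw q 4) N
    product-den N = pochhammer q 1# (pw q 4) N * pochhammer (pw q 4) x (pw q 4) N * pochhammer (x * pw q 4) 1# (pw q 4) N

    -- All but the extreme factors of (q⁵; q⁴)_N / (q; q⁴)_N cancel. The quotient (1 - q^(4N+1))/(1
    -- - q) is the factor [n] hidden in the right-hand side of the theorem.
    telescoping : ∀ N → (1# - q) * pochhammer (pw q 5) 1# (pw q 4) N ≈ pochhammer q 1# (pw q 4) N * (1# - q * pw (pw q 4) N)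
    telescoping zero    = solve 1 (λ q → (:1 :- q) :* :1 := :1 :* (:1 :- q :* :1)) ≡.refl q
    telescoping (suc N) = lin₁ (1# - pw q 5 * pw (pw q 4) N) (telescoping N)
      (solve 4 (λ q t f g → (:1 :- q) :* (f :* (:1 :- E.pw q 5 :* t)) :- g :* (:1 :- q :* t) :* (:1 :- q :* (t :* E.pw q 4))
        := (:1 :- E.pw q 5 :* t) :* ((:1 :- q) :* f :- g :* (:1 :- q :* t))) ≡.refl q (pw (pw q 4) N) (pochhammer (pw q 5) 1# (pw q 4) N) (pochhammer q 1# (pw q 4) N))

    pairs-num : ∀ N → pochhammer (x * pw q 2) 1# (pw q 4) N * pochhammer (pw q 2) x (pw q 4) N ≈ ∏ (λ i → pair x (y₂ i)) N
    pairs-num N = trans (∏-* _ _ N) (∏-cong N λ i → trans (*-cong (factor⁴ q x x (x * pw q 2) 1# i) (factor⁴ q x x (pw q 2) x i))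
      (solve 3 (λ q x K → (:1 :- x :* E.pw q 2 :* E.sq K) :* (x :- E.pw q 2 :* E.sq K) := E.pair x (E.sq q :* E.sq K)) ≡.refl q x (K i)))

    pairs-den : ∀ N → pochhammer (pw q 4) x (pw q 4) N * pochhammer (x * pw q 4) 1# (pw q 4) N ≈ ∏ (λ i → pair x (y₄ i)) N
    pairs-den N = trans (∏-* _ _ N) (∏-cong N λ i → trans (*-cong (factor⁴ q x x (pw q 4) x i) (factor⁴ q x x (x * pw q 4) 1# i))
      (solve 3 (λ q x K → (x :- E.pw q 4 :* E.sq K) :* (:1 :- x :* E.pw q 4 :* E.sq K) := E.pair x (E.sq (K :* E.sq q))) ≡.refl q x (K i)))

    product-form : ∀ N ι → Reg (1# - q) → (1# - q) * ι ≈ 1# - q * sq (K N) →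
      product-num N * ∏ (λ i → pair x (y₄ i)) N ≈ ι * ∏ (λ i → pair x (y₂ i)) N * product-den N
    product-form N ι reg e = cancel reg (trans (*-congˡ (*-congˡ (sym (pairs-den N)))) (trans
      (lin₃ (f₂ * f₃ * (g₂ * g₃)) (- (g₁ * f₂ * f₃ * g₂ * g₃)) (- (g₁ * f₂ * f₃ * g₂ * g₃ * q)) (telescoping N) e (base⁴ q x x N)
        (solve 10 (λ q ι f₁ f₂ f₃ g₁ g₂ g₃ t s →
          (:1 :- q) :* (f₁ :* f₂ :* f₃ :* (g₂ :* g₃)) :- (:1 :- q) :* (ι :* (f₂ :* f₃) :* (g₁ :* g₂ :* g₃))
          := f₂ :* f₃ :* (g₂ :* g₃) :* ((:1 :- q) :* f₁ :- g₁ :* (:1 :- q :* t)) :+ (:- (g₁ :* f₂ :* f₃ :* g₂ :* g₃)) :* ((:1 :- q) :* ι :- (:1 :- q :* s))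
            :+ (:- (g₁ :* f₂ :* f₃ :* g₂ :* g₃ :* q)) :* (t :- s)) ≡.refl q ι f₁ f₂ f₃ g₁ g₂ g₃ (pw (pw q 4) N) (sq (K N))))
      (*-congˡ (*-congʳ (*-congˡ (pairs-num N))))))
      where
      f₁ = pochhammer (pw q 5) 1# (pw q 4) N
      f₂ = pochhammer (x * pw q 2) 1# (pw q 4) N
      f₃ = pochhammer (pw q 2) x (pw q 4) N
      g₁ = pochhammer q 1# (pw q 4) N
      g₂ = pochhammer (pw q 4) x (pw q 4) N
      g₃ = pochhammer (x * pw q 4) 1# (pw q 4) N

-- Congruences modulo each factor and their combination

module Combination (R : CommutativeRing 0ℓ 0ℓ) where

  open RingReasoning R
  open CommutativeRing R hiding (zero)
  open Formulas _+_ _*_ -_ 0# 1#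

  Transfer : Carrier → Carrier → Carrier → ℕ → Carrier → Carrier → Set
  Transfer X a c k x y = ∃ λ z → pw X k * x - pw a k * y ≈ c * z

  -- X · pair a y - a · pair X y = y · pair a X. So, scaled by X^k and a^k, products of pairs at a
  -- and at X agree modulo pair a X, and the one evaluation a = q^n also accounts for a = q^(-n).
  module Homogeneous (X a c : Carrier) (f g d e w C : ℕ → Carrier)
    (hf : ∀ k → ∃ λ z → X * f k - a * g k ≈ c * z)
    (hd : ∀ k → ∃ λ z → X * d k - a * e k ≈ c * z)
    where

    transfer-∏ : ∀ {f g : ℕ → Carrier} → (∀ k → ∃ λ z → X * f k - a * g k ≈ c * z) → ∀ k → Transfer X a c k (∏ f k) (∏ g k)
    transfer-∏ h zero    = 0# , solve 1 (λ c → :1 :* :1 :- :1 :* :1 := c :* :0) ≡.refl c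
    transfer-∏ {f} {g} h (suc k) with transfer-∏ h k | h k
    ... | z , p | z′ , p′ = z * X * f k + z′ * pw a k * ∏ g k , lin₂ (X * f k) (pw a k * ∏ g k) p p′
      (solve 11 (λ X a c x α F G f g z z′ → x :* X :* (F :* f) :- α :* a :* (G :* g) :- c :* (z :* X :* f :+ z′ :* α :* G)
        := X :* f :* (x :* F :- α :* G :- c :* z) :+ α :* G :* (X :* f :- a :* g :- c :* z′)) ≡.refl
        X a c (pw X k) (pw a k) (∏ f k) (∏ g k) (f k) (g k) z z′)

    transfer-hor : ∀ k → Transfer X a c k (hor w (λ j → C j * ∏ f j) d k) (hor w (λ j → C j * ∏ g j) e k)
    transfer-hor zero    = 0# , solve 1 (λ c → :1 :* :0 :- :1 :* :0 := c :* :0) ≡.refl c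
    transfer-hor (suc k) with transfer-hor k | transfer-∏ hf k | hd k
    ... | z₁ , p₁ | z₂ , p₂ | z₃ , p₃ =
      (z₁ + w k * C k * z₂) * X * d k + z₃ * (pw a k * (hor w (λ j → C j * ∏ g j) e k + w k * (C k * ∏ g k))) ,
      lin₃ (X * d k) (w k * C k * X * d k) (pw a k * (hor w (λ j → C j * ∏ g j) e k + w k * (C k * ∏ g k))) p₁ p₂ p₃
      (solve 16 (λ X a c x α u v F G d e w C z₁ z₂ z₃ →
        x :* X :* ((u :+ w :* (C :* F)) :* d) :- α :* a :* ((v :+ w :* (C :* G)) :* e) :- c :* ((z₁ :+ w :* C :* z₂) :* X :* d :+ z₃ :* (α :* (v :+ w :* (C :* G))))
        := X :* d :* (x :* u :- α :* v :- c :* z₁) :+ w :* C :* X :* d :* (x :* F :- α :* G :- c :* z₂) :+ α :* (v :+ w :* (C :* G)) :* (X :* d :- a :* e :- c :* z₃)) ≡.refl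
        X a c (pw X k) (pw a k) (hor w (λ j → C j * ∏ f j) d k) (hor w (λ j → C j * ∏ g j) e k) (∏ f k) (∏ g k) (d k) (e k) (w k) (C k) z₁ z₂ z₃)

    transfer-den : ∀ k → Transfer X a c k (∏ d k) (∏ e k)
    transfer-den = transfer-∏ hd

    transfer-sum : ∀ k s t → hor w (λ j → C j * ∏ g j) e k * s ≈ ∏ e k * t →
      ∃ λ z → pw X k * (hor w (λ j → C j * ∏ f j) d k * s - ∏ d k * t) ≈ c * z
    transfer-sum k s t h with transfer-hor k | transfer-den k
    ... | z₁ , p₁ | z₂ , p₂ = z₁ * s - z₂ * t , lin₃ s (- t) (pw a k) p₁ p₂ h
      (solve 11 (λ x α u v D E s t c z₁ z₂ → x :* (u :* s :- D :* t) :- c :* (z₁ :* s :- z₂ :* t)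
        := s :* (x :* u :- α :* v :- c :* z₁) :+ (:- t) :* (x :* D :- α :* E :- c :* z₂) :+ α :* (v :* s :- E :* t)) ≡.refl
        (pw X k) (pw a k) (hor w (λ j → C j * ∏ f j) d k) (hor w (λ j → C j * ∏ g j) e k) (∏ d k) (∏ e k) s t c z₁ z₂)

  module _ (q X : Carrier) where

    -- Modulo (a − X)(1 − a X) one has X (a + 1/a) = X² + 1.
    sum-mod-a : ∀ a b k s t → Reduced.U q X b k * s ≈ Reduced.D q X b k * t →
      ∃ λ z → pw X k * (Reduced.U q a b k * s - Reduced.D q a b k * t) ≈ pair a X * z
    sum-mod-a a b = Homogeneous.transfer-sum X a (pair a X) (Reduced.numer q a b) (Reduced.numer q X b) (Reduced.denom q a b) (Reduced.denom q X b) (Reduced.W q a b) (Reduced.C q a b)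
      (λ k → q * K k * pair b (q * sq (K k)) , solve 4 (λ X a y p → X :* (E.pair a y :* p) :- a :* (E.pair X y :* p) := E.pair a X :* (y :* p)) ≡.refl
        X a (q * K k) (pair b (q * sq (K k))))
      (λ k → sq (1# + K (suc k)) * sq (K (suc k)) * pair b (K (suc k)) , solve 5 (λ X a y p s → X :* (s :* (E.pair a y :* p)) :- a :* (s :* (E.pair X y :* p)) := E.pair a X :* (s :* y :* p)) ≡.refl
        X a (sq (K (suc k))) (pair b (K (suc k))) (sq (1# + K (suc k))))
      where
      K : ℕ → Carrier
      K = pw (sq q)

    sum-mod-b : ∀ a b k s t → Reduced.U q a X k * s ≈ Reduced.D q a X k * t →
      ∃ λ z → pw X k * (Reduced.U q a b k * s - Reduced.D q a b k * t) ≈ pair b X * z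
    sum-mod-b a b = Homogeneous.transfer-sum X b (pair b X) (Reduced.numer q a b) (Reduced.numer q a X) (Reduced.denom q a b) (Reduced.denom q a X) (Reduced.W q a b) (Reduced.C q a b)
      (λ k → q * sq (K k) * pair a (q * K k) , solve 4 (λ X b y p → X :* (p :* E.pair b y) :- b :* (p :* E.pair X y) := E.pair b X :* (y :* p)) ≡.refl
        X b (q * sq (K k)) (pair a (q * K k)))
      (λ k → sq (1# + K (suc k)) * K (suc k) * pair a (sq (K (suc k))) , solve 5 (λ X b y p s → X :* (s :* (p :* E.pair b y)) :- b :* (s :* (p :* E.pair X y)) := E.pair b X :* (s :* y :* p)) ≡.refl
        X b (K (suc k)) (pair a (sq (K (suc k)))) (sq (1# + K (suc k))))
      where
      K : ℕ → Carrier
      K = pw (sq q)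

  -- The left-hand side U/D against the right-hand side, whose numerator and denominator are V and E.
  module Congruence (q X a b ι U D Da Db Na Nb s w e zA zB : Carrier)
    (hX : (1# - q) * ι ≈ 1# - X)
    (hA : e * (U * Db - D * (ι * Nb)) ≈ pair a X * zA)
    (hB : e * (U * Da - D * (ι * Na)) ≈ pair b X * zB)
    (hι : s * U ≈ ι * w)
    where

    PA PB r r′ ca cb V E₂ : Carrier
    PA = pair a X
    PB = pair b X
    r  = (b - a) * (1# - b * a)
    r′ = (a - b) * (1# - a * b)
    cb = 1# - 1# - 1# - b * b + b * X
    ca = 1# - 1# - 1# - a * a + a * X
    V  = (1# - a * X) * (a - X) * cb * (ι * Na) * (r′ * Db) + (1# - b * X) * (b - X) * ca * (ι * Nb) * (r * Da)
    E₂ = r * Da * (r′ * Db)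

    y z₁ z₂ v w′ Z : Carrier
    y  = U * (r * (Da * Db)) - D * (ι * (PA * cb * Na * Db - PB * ca * Nb * Da))
    z₁ = a * PB * Da * zA + e * (- (b * U * Da * Db) - ι * D * X * cb * Na * Db + ι * D * PB * Nb * Da)
    z₂ = - (b * PA * Db * zB) + e * (a * U * Da * Db - ι * D * PA * Na * Db + ι * D * X * ca * Nb * Da)
    v  = (1# + a * a - a * (1# + X)) * PB + pair a 1# * (1# + b * b - b * (1# + X))
    w′ = w * (r * (Da * Db)) - s * (D * (PA * cb * Na * Db - PB * ca * Nb * Da))
    Z  = w′ * (X * r) * (X * e) - (1# - q) * v * s * (a * z₁ - b * z₂)

    -- Modulo PA, X r is a PB and, by `Xc`, X ca is -a. Hence the coefficient -PB ca / r of ι Nb /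
    -- Db is 1 modulo PA, while PA cb / r is 0; symmetrically modulo PB. The right-hand side is a
    -- Chinese remainder combination, which explains -1 - a² + a q^n.
    Xr : X * r ≈ a * PB - b * PA
    Xr = solve 3 (λ X a b → X :* ((b :- a) :* (:1 :- b :* a)) := a :* E.pair b X :- b :* E.pair a X) ≡.refl X a b

    Xc : ∀ a → X * (1# - 1# - 1# - a * a + a * X) ≈ pair a X - a
    Xc a = solve 2 (λ X a → X :* (:1 :- :1 :- :1 :- a :* a :+ a :* X) := E.pair a X :- a) ≡.refl X a

    y-mod-a : X * e * y ≈ PA * z₁
    y-mod-a = lin₃ (a * PB * Da) (e * U * Da * Db) (e * ι * D * PB * Nb * Da) hA Xr (Xc a)
      (solve 17 (λ X a b ι U D Da Db Na Nb e zA PA PB r ca cb →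
        X :* e :* (U :* (r :* (Da :* Db)) :- D :* (ι :* (PA :* cb :* Na :* Db :- PB :* ca :* Nb :* Da)))
          :- PA :* (a :* PB :* Da :* zA :+ e :* (:- (b :* U :* Da :* Db) :- ι :* D :* X :* cb :* Na :* Db :+ ι :* D :* PB :* Nb :* Da))
        := a :* PB :* Da :* (e :* (U :* Db :- D :* (ι :* Nb)) :- PA :* zA) :+ e :* U :* Da :* Db :* (X :* r :- (a :* PB :- b :* PA))
          :+ e :* ι :* D :* PB :* Nb :* Da :* (X :* ca :- (PA :- a))) ≡.refl X a b ι U D Da Db Na Nb e zA PA PB r ca cb)

    y-mod-b : X * e * y ≈ PB * z₂
    y-mod-b = lin₃ (- (b * PA * Db)) (e * U * Da * Db) (- (e * ι * D * PA * Na * Db)) hB Xr (Xc b)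
      (solve 17 (λ X a b ι U D Da Db Na Nb e zB PA PB r ca cb →
        X :* e :* (U :* (r :* (Da :* Db)) :- D :* (ι :* (PA :* cb :* Na :* Db :- PB :* ca :* Nb :* Da)))
          :- PB :* (:- (b :* PA :* Db :* zB) :+ e :* (a :* U :* Da :* Db :- ι :* D :* PA :* Na :* Db :+ ι :* D :* X :* ca :* Nb :* Da))
        := (:- (b :* PA :* Db)) :* (e :* (U :* Da :- D :* (ι :* Na)) :- PB :* zB) :+ e :* U :* Da :* Db :* (X :* r :- (a :* PB :- b :* PA))
          :+ (:- (e :* ι :* D :* PA :* Na :* Db)) :* (X :* cb :- (PB :- b))) ≡.refl X a b ι U D Da Db Na Nb e zB PA PB r ca cb)

    y-mod-ab : X * r * (X * e * y) ≈ PA * PB * (a * z₁ - b * z₂)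
    y-mod-ab = lin₃ (X * e * y) (a * PB) (- (b * PA)) Xr y-mod-a y-mod-b
      (solve 8 (λ t u PA PB a b z₁ z₂ → t :* u :- PA :* PB :* (a :* z₁ :- b :* z₂)
        := u :* (t :- (a :* PB :- b :* PA)) :+ a :* PB :* (u :- PA :* z₁) :+ (:- (b :* PA)) :* (u :- PB :* z₂)) ≡.refl
        (X * r) (X * e * y) PA PB a b z₁ z₂)

    y-mod-ι : s * y ≈ ι * w′
    y-mod-ι = lin₁ (r * (Da * Db)) hι (solve 8 (λ s U D ι w t x y →
        s :* (U :* t :- D :* (ι :* x)) :- ι :* (w :* t :- s :* (D :* x)) := t :* (s :* U :- ι :* w)) ≡.refl
        s U D ι w (r * (Da * Db)) (PA * cb * Na * Db - PB * ca * Nb * Da) 0#)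

    -- Since 1 - X = (1 - q) ι, replacing X by 1 in PA PB changes it by a multiple of ι; `v` is the
    -- cofactor.
    units : pair a 1# * pair b 1# ≈ PA * PB - (1# - q) * ι * v
    units = lin₁ v hX (solve 5 (λ q X a b ι →
      let v = (:1 :+ a :* a :- a :* (:1 :+ X)) :* E.pair b X :+ E.pair a :1 :* (:1 :+ b :* b :- b :* (:1 :+ X)) in
      E.pair a :1 :* E.pair b :1 :- (E.pair a X :* E.pair b X :- (:1 :- q) :* ι :* v) := v :* ((:1 :- q) :* ι :- (:1 :- X))) ≡.refl q X a b ι)

    -- Collects what the difference is multiplied by on the way to divisibility. Each factor will be
    -- coprime to the modulus, so the product may enter the denominator of the congruence.
    multiplier : Carrier
    multiplier = pair a 1# * pair b 1# * s * (X * r) * (X * e)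

    divisible : multiplier * y ≈ ι * (PA * PB) * Z
    divisible = lin₃ (s * (X * r) * (X * e) * y) (PA * PB * (X * r) * (X * e)) (- ((1# - q) * ι * v * s)) units y-mod-ι y-mod-ab
      (solve 11 (λ δ P o ι v s t x y w z →
        δ :* s :* t :* x :* y :- ι :* P :* (w :* t :* x :- o :* v :* s :* z)
        := s :* t :* x :* y :* (δ :- (P :- o :* ι :* v)) :+ P :* t :* x :* (s :* y :- ι :* w) :+ (:- (o :* ι :* v :* s)) :* (t :* (x :* y) :- P :* z)) ≡.refl
        (pair a 1# * pair b 1#) (PA * PB) (1# - q) ι v s (X * r) (X * e) y w′ (a * z₁ - b * z₂))

    congruence : (U * E₂ - V * D) * multiplier ≈ ι * (1# - a * X) * (a - X) * (1# - b * X) * (b - X) * (r′ * Z)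
    congruence = lin₁ r′ divisible
      (solve 16 (λ X a b ι U D Da Db Na Nb ca cb M Z o t →
        let fa = :1 :- a :* X
            ga = a :- X
            fb = :1 :- b :* X
            gb = b :- X
            d  = a :- b
            ab = :1 :- a :* b
            r  = (b :- a) :* (:1 :- b :* a)
            r′ = d :* ab
            y  = U :* (r :* (Da :* Db)) :- D :* (ι :* (E.pair a X :* cb :* Na :* Db :- E.pair b X :* ca :* Nb :* Da))
        in (U :* (r :* Da :* (r′ :* Db)) :- (fa :* ga :* cb :* (ι :* Na) :* (r′ :* Db) :+ fb :* gb :* ca :* (ι :* Nb) :* (r :* Da)) :* D) :* M
             :- ι :* fa :* ga :* fb :* gb :* (r′ :* Z)
           := r′ :* (M :* y :- ι :* (E.pair a X :* E.pair b X) :* Z)) ≡.refl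
        X a b ι U D Da Db Na Nb ca cb multiplier Z 0# 0#)

-- ℤ[q, a, b] as a commutative ring

module PolynomialRing where

  open ≡ using (refl; sym; trans; cong; cong₂; subst₂; module ≡-Reasoning)
  open ≡-Reasoning

  mono-coeff : Mono → ℕ → ℕ → ℕ → ℤ
  mono-coeff (c , x , y , z) i j k = if (x ≡ᵇ i) ∧ ((y ≡ᵇ j) ∧ (z ≡ᵇ k)) then c else 0ℤ

  coeff-++ : ∀ p r i j k → coeff (p ++ r) i j k ≡ coeff p i j k ℤ.+ coeff r i j k
  coeff-++ []      r i j k = sym (ℤₚ.+-identityˡ _)
  coeff-++ (m ∷ p) r i j k = trans (cong₂ ℤ._+_ (refl {x = mono-coeff m i j k}) (coeff-++ p r i j k)) (sym (ℤₚ.+-assoc (mono-coeff m i j k) _ _))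

  coeff-neg : ∀ p i j k → coeff (negP p) i j k ≡ ℤ.- coeff p i j k
  coeff-neg []                    i j k = refl
  coeff-neg ((c , x , y , z) ∷ p) i j k =
    trans (cong₂ ℤ._+_ (if-neg ((x ≡ᵇ i) ∧ ((y ≡ᵇ j) ∧ (z ≡ᵇ k)))) (coeff-neg p i j k)) (sym (ℤₚ.neg-distrib-+ (mono-coeff (c , x , y , z) i j k) _))
    where
    if-neg : ∀ b → (if b then ℤ.- c else 0ℤ) ≡ ℤ.- (if b then c else 0ℤ)
    if-neg true  = refl
    if-neg false = refl

  +-≡ᵇ : ∀ x i j → (x ℕ.+ i ≡ᵇ x ℕ.+ j) ≡ (i ≡ᵇ j)
  +-≡ᵇ zero    i j = refl
  +-≡ᵇ (suc x) i j = +-≡ᵇ x i j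

  ≰-≡ᵇ : ∀ x y i → ¬ x ≤ i → (x ℕ.+ y ≡ᵇ i) ≡ false
  ≰-≡ᵇ zero    y i       h = ⊥-elim (h z≤n)
  ≰-≡ᵇ (suc x) y zero    h = refl
  ≰-≡ᵇ (suc x) y (suc i) h = ≰-≡ᵇ x y i (h ∘ s≤s)

  if-* : ∀ b c d → (if b then c ℤ.* d else 0ℤ) ≡ c ℤ.* (if b then d else 0ℤ)
  if-* true  c d = refl
  if-* false c d = sym (ℤₚ.*-zeroʳ c)

  coeff-shift : ∀ c x y z r i j k →
    coeff (map (mulM (c , x , y , z)) r) (x ℕ.+ i) (y ℕ.+ j) (z ℕ.+ k) ≡ c ℤ.* coeff r i j k
  coeff-shift c x y z [] i j k = sym (ℤₚ.*-zeroʳ c)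
  coeff-shift c x y z ((d , x′ , y′ , z′) ∷ r) i j k
    rewrite +-≡ᵇ x x′ i | +-≡ᵇ y y′ j | +-≡ᵇ z z′ k =
    trans (cong₂ ℤ._+_ (if-* ((x′ ≡ᵇ i) ∧ ((y′ ≡ᵇ j) ∧ (z′ ≡ᵇ k))) c d) (coeff-shift c x y z r i j k))
          (sym (ℤₚ.*-distribˡ-+ c _ _))

  outside : ∀ x y z x′ y′ z′ i j k → ¬ (x ≤ i × y ≤ j × z ≤ k) →
    (x ℕ.+ x′ ≡ᵇ i) ∧ ((y ℕ.+ y′ ≡ᵇ j) ∧ (z ℕ.+ z′ ≡ᵇ k)) ≡ false
  outside x y z x′ y′ z′ i j k h with x ℕ.≤? i | y ℕ.≤? j | z ℕ.≤? k
  ... | no x≰i  | _       | _       rewrite ≰-≡ᵇ x x′ i x≰i = refl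
  ... | yes _   | no y≰j  | _       rewrite ≰-≡ᵇ y y′ j y≰j = ∧-zeroʳ _
  ... | yes _   | yes _   | no z≰k  rewrite ≰-≡ᵇ z z′ k z≰k | ∧-zeroʳ (y ℕ.+ y′ ≡ᵇ j) = ∧-zeroʳ _
  ... | yes x≤i | yes y≤j | yes z≤k = ⊥-elim (h (x≤i , y≤j , z≤k))

  coeff-shift-0 : ∀ c x y z r i j k → ¬ (x ≤ i × y ≤ j × z ≤ k) →
    coeff (map (mulM (c , x , y , z)) r) i j k ≡ 0ℤ
  coeff-shift-0 c x y z [] i j k h = refl
  coeff-shift-0 c x y z ((d , x′ , y′ , z′) ∷ r) i j k h
    rewrite outside x y z x′ y′ z′ i j k h = trans (ℤₚ.+-identityˡ _) (coeff-shift-0 c x y z r i j k h)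

  ≈-trans : ∀ p r s → p ≈P r → r ≈P s → p ≈P s
  ≈-trans _ _ _ e f i j k = trans (e i j k) (f i j k)

  ≡⇒≈ : ∀ {p r} → p ≡ r → p ≈P r
  ≡⇒≈ refl i j k = refl

  ++-cong : ∀ p p′ r r′ → p ≈P p′ → r ≈P r′ → (p ++ r) ≈P (p′ ++ r′)
  ++-cong p p′ r r′ e f i j k =
    trans (coeff-++ p r i j k) (trans (cong₂ ℤ._+_ (e i j k) (f i j k)) (sym (coeff-++ p′ r′ i j k)))

  ++-comm : ∀ p r → (p ++ r) ≈P (r ++ p)
  ++-comm p r i j k = trans (coeff-++ p r i j k) (trans (ℤₚ.+-comm (coeff p i j k) _) (sym (coeff-++ r p i j k)))

  neg-cong : ∀ p r → p ≈P r → negP p ≈P negP r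
  neg-cong p r e i j k = trans (coeff-neg p i j k) (trans (cong ℤ.-_ (e i j k)) (sym (coeff-neg r i j k)))

  neg-inverseˡ : ∀ p → (negP p ++ p) ≈P zeroP
  neg-inverseˡ p i j k = trans (coeff-++ (negP p) p i j k)
    (trans (cong₂ ℤ._+_ (coeff-neg p i j k) refl) (ℤₚ.+-inverseˡ (coeff p i j k)))

  -- The coefficients of a monomial multiple are shifted coefficients, or zero where some exponent
  -- is too small; the three comparisons separate these cases.
  map-mulM-cong : ∀ m r s → r ≈P s → map (mulM m) r ≈P map (mulM m) s
  map-mulM-cong (c , x , y , z) r s e i j k with x ℕ.≤? i | y ℕ.≤? j | z ℕ.≤? k
  ... | yes x≤i | yes y≤j | yes z≤k =
    subst₂ _≡_ (at r) (at s) (trans (coeff-shift c x y z r _ _ _)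
      (trans (cong (c ℤ.*_) (e _ _ _)) (sym (coeff-shift c x y z s (i ℕ.∸ x) (j ℕ.∸ y) (k ℕ.∸ z)))))
    where
    at : ∀ r → coeff (map (mulM (c , x , y , z)) r) (x ℕ.+ (i ℕ.∸ x)) (y ℕ.+ (j ℕ.∸ y)) (z ℕ.+ (k ℕ.∸ z))
             ≡ coeff (map (mulM (c , x , y , z)) r) i j k
    at r rewrite ℕₚ.m+[n∸m]≡n x≤i | ℕₚ.m+[n∸m]≡n y≤j | ℕₚ.m+[n∸m]≡n z≤k = refl
  ... | no h | _ | _ = trans (coeff-shift-0 c x y z r i j k (h ∘ proj₁)) (sym (coeff-shift-0 c x y z s i j k (h ∘ proj₁)))
  ... | yes _ | no h | _ = trans (coeff-shift-0 c x y z r i j k (h ∘ proj₁ ∘ proj₂)) (sym (coeff-shift-0 c x y z s i j k (h ∘ proj₁ ∘ proj₂)))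
  ... | yes _ | yes _ | no h = trans (coeff-shift-0 c x y z r i j k (h ∘ proj₂ ∘ proj₂)) (sym (coeff-shift-0 c x y z s i j k (h ∘ proj₂ ∘ proj₂)))

  mulM-assoc : ∀ m l n → mulM (mulM m l) n ≡ mulM m (mulM l n)
  mulM-assoc (c , x , y , z) (c′ , x′ , y′ , z′) (c″ , x″ , y″ , z″) =
    cong₂ _,_ (ℤₚ.*-assoc c c′ c″) (cong₂ _,_ (ℕₚ.+-assoc x x′ x″) (cong₂ _,_ (ℕₚ.+-assoc y y′ y″) (ℕₚ.+-assoc z z′ z″)))

  mulM-comm : ∀ m l → mulM m l ≡ mulM l m
  mulM-comm (c , x , y , z) (c′ , x′ , y′ , z′) =
    cong₂ _,_ (ℤₚ.*-comm c c′) (cong₂ _,_ (ℕₚ.+-comm x x′) (cong₂ _,_ (ℕₚ.+-comm y y′) (ℕₚ.+-comm z z′)))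

  *-distribʳ : ∀ s p r → (p ++ r) *P s ≡ p *P s ++ r *P s
  *-distribʳ s p r = Listₚ.concatMap-++ (λ m → map (mulM m) s) p r

  map-mulM-* : ∀ m p s → map (mulM m) (p *P s) ≡ map (mulM m) p *P s
  map-mulM-* m []      s = refl
  map-mulM-* m (l ∷ p) s = begin
    map (mulM m) (map (mulM l) s ++ p *P s)                ≡⟨ Listₚ.map-++ (mulM m) (map (mulM l) s) (p *P s) ⟩
    map (mulM m) (map (mulM l) s) ++ map (mulM m) (p *P s) ≡⟨ cong₂ _++_ (sym (Listₚ.map-∘ s)) (map-mulM-* m p s) ⟩
    map (mulM m ∘ mulM l) s ++ map (mulM m) p *P s         ≡⟨ cong (_++ map (mulM m) p *P s) (Listₚ.map-cong (mulM-assoc m l) s) ⟨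
    map (mulM (mulM m l)) s ++ map (mulM m) p *P s         ∎

  *-assoc′ : ∀ p r s → (p *P r) *P s ≡ p *P (r *P s)
  *-assoc′ []      r s = refl
  *-assoc′ (m ∷ p) r s = begin
    (map (mulM m) r ++ p *P r) *P s          ≡⟨ *-distribʳ s (map (mulM m) r) (p *P r) ⟩
    map (mulM m) r *P s ++ (p *P r) *P s     ≡⟨ cong₂ _++_ (sym (map-mulM-* m r s)) (*-assoc′ p r s) ⟩
    map (mulM m) (r *P s) ++ p *P (r *P s)   ∎

  *-identityˡ′ : ∀ p → oneP *P p ≡ p
  *-identityˡ′ p = trans (Listₚ.++-identityʳ _) (trans (Listₚ.map-cong unit p) (Listₚ.map-id p))
    where
    unit : ∀ m → mulM (1ℤ , 0 , 0 , 0) m ≡ m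
    unit (c , e) = cong (_, e) (ℤₚ.*-identityˡ c)

  *-[] : ∀ p → p *P [] ≡ []
  *-[] []      = refl
  *-[] (m ∷ p) = *-[] p

  -- Products unfold along the first factor by definition; unfolding along the second as well is
  -- what gives commutativity.
  *-∷ : ∀ p l r → (p *P (l ∷ r)) ≈P (map (mulM l) p ++ p *P r)
  *-∷ []      l r i j k = refl
  *-∷ (m ∷ p) l r i j k = cong₂ ℤ._+_ (cong (λ n → mono-coeff n i j k) (mulM-comm m l)) (begin
    coeff (map (mulM m) r ++ p *P (l ∷ r)) i j k                       ≡⟨ coeff-++ (map (mulM m) r) _ i j k ⟩
    A ℤ.+ coeff (p *P (l ∷ r)) i j k                                   ≡⟨ cong₂ ℤ._+_ (refl {x = A}) (*-∷ p l r i j k) ⟩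
    A ℤ.+ coeff (map (mulM l) p ++ p *P r) i j k                       ≡⟨ cong₂ ℤ._+_ (refl {x = A}) (coeff-++ (map (mulM l) p) (p *P r) i j k) ⟩
    A ℤ.+ (B ℤ.+ coeff (p *P r) i j k)                                 ≡⟨ ℤₚ.+-assoc A B _ ⟨
    (A ℤ.+ B) ℤ.+ coeff (p *P r) i j k                                 ≡⟨ cong₂ ℤ._+_ (ℤₚ.+-comm A B) refl ⟩
    (B ℤ.+ A) ℤ.+ coeff (p *P r) i j k                                 ≡⟨ ℤₚ.+-assoc B A _ ⟩
    B ℤ.+ (A ℤ.+ coeff (p *P r) i j k)                                 ≡⟨ cong₂ ℤ._+_ (refl {x = B}) (coeff-++ (map (mulM m) r) (p *P r) i j k) ⟨
    B ℤ.+ coeff (map (mulM m) r ++ p *P r) i j k                       ≡⟨ coeff-++ (map (mulM l) p) _ i j k ⟨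
    coeff (map (mulM l) p ++ (map (mulM m) r ++ p *P r)) i j k         ∎)
    where
    A = coeff (map (mulM m) r) i j k
    B = coeff (map (mulM l) p) i j k

  *-comm′ : ∀ p r → (p *P r) ≈P (r *P p)
  *-comm′ p []            = ≡⇒≈ (*-[] p)
  *-comm′ p (l ∷ r) i j k = begin
    coeff (p *P (l ∷ r)) i j k                                ≡⟨ *-∷ p l r i j k ⟩
    coeff (map (mulM l) p ++ p *P r) i j k                    ≡⟨ coeff-++ (map (mulM l) p) _ i j k ⟩
    B ℤ.+ coeff (p *P r) i j k                                ≡⟨ cong₂ ℤ._+_ (refl {x = B}) (*-comm′ p r i j k) ⟩
    B ℤ.+ coeff (r *P p) i j k                                ≡⟨ coeff-++ (map (mulM l) p) _ i j k ⟨
    coeff (map (mulM l) p ++ r *P p) i j k                    ∎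
    where
    B = coeff (map (mulM l) p) i j k

  *-congˡ′ : ∀ p r s → r ≈P s → (p *P r) ≈P (p *P s)
  *-congˡ′ []      r s e i j k = refl
  *-congˡ′ (m ∷ p) r s e =
    ++-cong (map (mulM m) r) (map (mulM m) s) (p *P r) (p *P s) (map-mulM-cong m r s e) (*-congˡ′ p r s e)

  *-cong′ : ∀ p p′ r r′ → p ≈P p′ → r ≈P r′ → (p *P r) ≈P (p′ *P r′)
  *-cong′ p p′ r r′ e f i j k = trans (*-congˡ′ p r r′ f i j k)
    (trans (*-comm′ p r′ i j k) (trans (*-congˡ′ r′ p p′ e i j k) (*-comm′ r′ p′ i j k)))

  infix 4 _≋_

  -- A record rather than _≈P_ itself, so that the two sides can be inferred from the type.
  record _≋_ (p r : Poly) : Set where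
    constructor pointwise
    field
      at : p ≈P r
  open _≋_ public

  ≡⇒≋ : ∀ {p r} → p ≡ r → p ≋ r
  ≡⇒≋ refl = pointwise λ i j k → refl

  ≋-trans : ∀ {p r s} → p ≋ r → r ≋ s → p ≋ s
  ≋-trans {p} {r} {s} (pointwise e) (pointwise f) = pointwise (≈-trans p r s e f)

  *-comm″ : ∀ p r → (p *P r) ≋ (r *P p)
  *-comm″ p r = pointwise (*-comm′ p r)

  *-distribʳ″ : ∀ s p r → ((p ++ r) *P s) ≋ (p *P s ++ r *P s)
  *-distribʳ″ s p r = ≡⇒≋ (*-distribʳ s p r)

  polyRing : CommutativeRing 0ℓ 0ℓ
  polyRing = record
    { Carrier = Poly ; _≈_ = _≋_ ; _+_ = _+P_ ; _*_ = _*P_ ; -_ = negP ; 0# = zeroP ; 1# = oneP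
    ; isCommutativeRing = record
      { isRing = record
        { +-isAbelianGroup = record
          { isGroup = record
            { isMonoid = record
              { isSemigroup = record
                { isMagma = record
                  { isEquivalence = record
                    { refl  = ≡⇒≋ refl
                    ; sym   = λ e → pointwise λ i j k → sym (at e i j k)
                    ; trans = ≋-trans }
                  ; ∙-cong = λ {p} {p′} {r} {r′} e f → pointwise (++-cong p p′ r r′ (at e) (at f)) }
                ; assoc = λ p r s → ≡⇒≋ (Listₚ.++-assoc p r s) }
              ; identity = (λ p → ≡⇒≋ refl) , (λ p → ≡⇒≋ (Listₚ.++-identityʳ p)) }
            ; inverse = (λ p → pointwise (neg-inverseˡ p))
                      , (λ p → pointwise (≈-trans (p ++ negP p) (negP p ++ p) [] (++-comm p (negP p)) (neg-inverseˡ p)))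
            ; ⁻¹-cong = λ {p} {r} e → pointwise (neg-cong p r (at e)) }
          ; comm = λ p r → pointwise (++-comm p r) }
        ; *-cong = λ {p} {p′} {r} {r′} e f → pointwise (*-cong′ p p′ r r′ (at e) (at f))
        ; *-assoc = λ p r s → ≡⇒≋ (*-assoc′ p r s)
        ; *-identity = (λ p → ≡⇒≋ (*-identityˡ′ p))
                     , (λ p → ≋-trans (*-comm″ p oneP) (≡⇒≋ (*-identityˡ′ p)))
        ; distrib = (λ p r s → ≋-trans (*-comm″ p (r ++ s)) (≋-trans (*-distribʳ″ p r s)
                        (pointwise (++-cong (r *P p) (p *P r) (s *P p) (p *P s) (*-comm′ r p) (*-comm′ s p)))))
                  , *-distribʳ″ }
      ; *-comm = *-comm″ } }

-- Leading monomials; ℤ[q, a, b] is an integral domain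

module LeadingTerms where

  open PolynomialRing
  open RingReasoning polyRing using (Reg)
  open ≡ using (refl; sym; trans; cong₂; subst; subst₂; module ≡-Reasoning)

  Expo : Set
  Expo = ℕ × ℕ × ℕ

  coeffAt : Poly → Expo → ℤ
  coeffAt p (i , j , k) = coeff p i j k

  _⊞_ : Expo → Expo → Expo
  (x , y , z) ⊞ (x′ , y′ , z′) = (x ℕ.+ x′ , y ℕ.+ y′ , z ℕ.+ z′)

  infix 4 _≺_
  data _≺_ : Expo → Expo → Set where
    fst< : ∀ {x y z x′ y′ z′} → x < x′ → (x , y , z) ≺ (x′ , y′ , z′)
    snd< : ∀ {x y z y′ z′} → y < y′ → (x , y , z) ≺ (x , y′ , z′)
    trd< : ∀ {x y z z′} → z < z′ → (x , y , z) ≺ (x , y , z′)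

  data Compare (e f : Expo) : Set where
    lt : e ≺ f → Compare e f
    eq : e ≡ f → Compare e f
    gt : f ≺ e → Compare e f

  compare : ∀ e f → Compare e f
  compare (x , y , z) (x′ , y′ , z′) with ℕₚ.<-cmp x x′
  ... | tri< a _ _ = lt (fst< a)
  ... | tri> _ _ c = gt (fst< c)
  ... | tri≈ _ refl _ with ℕₚ.<-cmp y y′
  ...   | tri< a _ _ = lt (snd< a)
  ...   | tri> _ _ c = gt (snd< c)
  ...   | tri≈ _ refl _ with ℕₚ.<-cmp z z′
  ...     | tri< a _ _ = lt (trd< a)
  ...     | tri> _ _ c = gt (trd< c)
  ...     | tri≈ _ refl _ = eq refl

  ≺-trans : ∀ {e f g} → e ≺ f → f ≺ g → e ≺ g
  ≺-trans (fst< a) (fst< b) = fst< (ℕₚ.<-trans a b)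
  ≺-trans (fst< a) (snd< b) = fst< a
  ≺-trans (fst< a) (trd< b) = fst< a
  ≺-trans (snd< a) (fst< b) = fst< b
  ≺-trans (snd< a) (snd< b) = snd< (ℕₚ.<-trans a b)
  ≺-trans (snd< a) (trd< b) = snd< a
  ≺-trans (trd< a) (fst< b) = fst< b
  ≺-trans (trd< a) (snd< b) = snd< b
  ≺-trans (trd< a) (trd< b) = trd< (ℕₚ.<-trans a b)

  ≺-irrefl : ∀ {e} → ¬ e ≺ e
  ≺-irrefl (fst< a) = ℕₚ.<-irrefl refl a
  ≺-irrefl (snd< a) = ℕₚ.<-irrefl refl a
  ≺-irrefl (trd< a) = ℕₚ.<-irrefl refl a

  ⊞-monoʳ : ∀ g {e f} → e ≺ f → (g ⊞ e) ≺ (g ⊞ f)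
  ⊞-monoʳ (x , y , z) (fst< a) = fst< (ℕₚ.+-monoʳ-< x a)
  ⊞-monoʳ (x , y , z) (snd< a) = snd< (ℕₚ.+-monoʳ-< y a)
  ⊞-monoʳ (x , y , z) (trd< a) = trd< (ℕₚ.+-monoʳ-< z a)

  ⊞-comm : ∀ e f → e ⊞ f ≡ f ⊞ e
  ⊞-comm (x , y , z) (x′ , y′ , z′) = cong₂ _,_ (ℕₚ.+-comm x x′) (cong₂ _,_ (ℕₚ.+-comm y y′) (ℕₚ.+-comm z z′))

  ⊞-monoˡ : ∀ g {e f} → e ≺ f → (e ⊞ g) ≺ (f ⊞ g)
  ⊞-monoˡ g {e} {f} a = subst₂ _≺_ (⊞-comm g e) (⊞-comm g f) (⊞-monoʳ g a)

  Below : Expo → Poly → Set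
  Below e = All (λ m → proj₂ m ≺ e)

  ≡ᵇ-refl : ∀ x → (x ≡ᵇ x) ≡ true
  ≡ᵇ-refl zero    = refl
  ≡ᵇ-refl (suc x) = ≡ᵇ-refl x

  ≡ᵇ-sound : ∀ x y → (x ≡ᵇ y) ≡ true → x ≡ y
  ≡ᵇ-sound x y e = ℕₚ.≡ᵇ⇒≡ x y (subst T (sym e) _)

  mono-at : ∀ c e → coeffAt ((c , e) ∷ []) e ≡ c
  mono-at c (x , y , z) rewrite ≡ᵇ-refl x | ≡ᵇ-refl y | ≡ᵇ-refl z = ℤₚ.+-identityʳ c

  mono-off : ∀ c e f → e ≢ f → coeffAt ((c , e) ∷ []) f ≡ 0ℤ
  mono-off c (x , y , z) (i , j , k) h with x ≡ᵇ i in ex | y ≡ᵇ j in ey | z ≡ᵇ k in ez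
  ... | false | _     | _     = refl
  ... | true  | false | _     = refl
  ... | true  | true  | false = refl
  ... | true  | true  | true  =
    contradiction (cong₂ _,_ (≡ᵇ-sound x i ex) (cong₂ _,_ (≡ᵇ-sound y j ey) (≡ᵇ-sound z k ez))) h

  coeffAt-∷ : ∀ m p e → coeffAt (m ∷ p) e ≡ coeffAt (m ∷ []) e ℤ.+ coeffAt p e
  coeffAt-∷ m p (i , j , k) = coeff-++ (m ∷ []) p i j k

  below-0 : ∀ {e} p → Below e p → ∀ f → (f ≡ e ⊎ e ≺ f) → coeffAt p f ≡ 0ℤ
  below-0 []            []       f h = refl
  below-0 ((c , g) ∷ p) (b ∷ bs) f h = trans (coeffAt-∷ (c , g) p f)
    (cong₂ ℤ._+_ (mono-off c g f (λ { refl → ≺-irrefl ([ (λ { refl → b }) , ≺-trans b ]′ h) })) (below-0 p bs f h))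

  ≋-sym : ∀ {p r} → p ≋ r → r ≋ p
  ≋-sym e = pointwise λ i j k → sym (at e i j k)

  -- The length bound on `r` serves termination: when two leading coefficients cancel, the search
  -- restarts on that shorter remainder.
  data Leading (p : Poly) : Set where
    zero : p ≈P zeroP → Leading p
    lead : ∀ c e r → c ≢ 0ℤ → Below e r → length r < length p → p ≈P (c , e) ∷ r → Leading p

  ∷-cong : ∀ m {p r} → p ≈P r → (m ∷ p) ≈P (m ∷ r)
  ∷-cong m e i j k = cong₂ ℤ._+_ (refl {x = mono-coeff m i j k}) (e i j k)

  swap-∷ : ∀ m l p → (m ∷ l ∷ p) ≈P (l ∷ m ∷ p)
  swap-∷ m l p i j k = trans (sym (ℤₚ.+-assoc M L C))
    (trans (cong₂ ℤ._+_ (ℤₚ.+-comm M L) (refl {x = C})) (ℤₚ.+-assoc L M C))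
    where
    M = mono-coeff m i j k
    L = mono-coeff l i j k
    C = coeff p i j k

  merge : ∀ c d e p → ((c , e) ∷ (d , e) ∷ p) ≈P ((c ℤ.+ d , e) ∷ p)
  merge c d (x , y , z) p i j k = trans (sym (ℤₚ.+-assoc (mono-coeff (c , x , y , z) i j k) _ _))
    (cong₂ ℤ._+_ (if-+ ((x ≡ᵇ i) ∧ ((y ≡ᵇ j) ∧ (z ≡ᵇ k)))) refl)
    where
    if-+ : ∀ b → (if b then c else 0ℤ) ℤ.+ (if b then d else 0ℤ) ≡ (if b then c ℤ.+ d else 0ℤ)
    if-+ true  = refl
    if-+ false = refl

  drop-0 : ∀ c e p → c ≡ 0ℤ → ((c , e) ∷ p) ≈P p
  drop-0 c (x , y , z) p refl i j k = trans (cong₂ ℤ._+_ (if-0 ((x ≡ᵇ i) ∧ ((y ≡ᵇ j) ∧ (z ≡ᵇ k)))) refl) (ℤₚ.+-identityˡ _)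
    where
    if-0 : ∀ b → (if b then 0ℤ else 0ℤ) ≡ 0ℤ
    if-0 true  = refl
    if-0 false = refl

  leading-cong : ∀ {p r} → p ≈P r → length r ≤ length p → Leading r → Leading p
  leading-cong {p} {r} e l (zero h)             = zero (≈-trans p r [] e h)
  leading-cong {p} {r} e l (lead c f s h b k t) = lead c f s h b (ℕₚ.<-≤-trans k l) (≈-trans p r ((c , f) ∷ s) e t)

  leading′ : ∀ n p → length p ≤ n → Leading p
  leading′ n       []            l       = zero (λ i j k → refl)
  leading′ (suc n) ((c , e) ∷ p) (s≤s l) with leading′ n p l
  ... | zero h with c ℤ.≟ 0ℤ
  ...   | yes c0 = zero (≈-trans ((c , e) ∷ p) p [] (drop-0 c e p c0) h)
  ...   | no  c≢ = lead c e [] c≢ [] (s≤s z≤n) (∷-cong (c , e) {p} {[]} h)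
  leading′ (suc n) ((c , e) ∷ p) (s≤s l) | lead d f r d≢ b k t with compare e f
  ... | lt e≺f = lead d f ((c , e) ∷ r) d≢ (e≺f ∷ b) (s≤s k)
                   (≈-trans ((c , e) ∷ p) ((c , e) ∷ (d , f) ∷ r) ((d , f) ∷ (c , e) ∷ r) (∷-cong (c , e) {p} {(d , f) ∷ r} t) (swap-∷ (c , e) (d , f) r))
  ... | gt f≺e with c ℤ.≟ 0ℤ
  ...   | yes c0 = lead d f r d≢ b (ℕₚ.m≤n⇒m≤1+n k) (≈-trans ((c , e) ∷ p) p ((d , f) ∷ r) (drop-0 c e p c0) t)
  ...   | no  c≢ = lead c e ((d , f) ∷ r) c≢ (f≺e ∷ All.map (λ a → ≺-trans a f≺e) b) (s≤s k) (∷-cong (c , e) {p} {(d , f) ∷ r} t)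
  leading′ (suc n) ((c , e) ∷ p) (s≤s l) | lead d f r d≢ b k t | eq refl with c ℤ.+ d ℤ.≟ 0ℤ
  ... | no s≢  = lead (c ℤ.+ d) e r s≢ b (ℕₚ.m≤n⇒m≤1+n k)
                   (≈-trans ((c , e) ∷ p) ((c , e) ∷ (d , e) ∷ r) ((c ℤ.+ d , e) ∷ r) (∷-cong (c , e) {p} {(d , e) ∷ r} t) (merge c d e r))
  ... | yes s0 = leading-cong {_} {r}
                   (≈-trans ((c , e) ∷ p) ((c , e) ∷ (d , e) ∷ r) r (∷-cong (c , e) {p} {(d , e) ∷ r} t)
                     (≈-trans ((c , e) ∷ (d , e) ∷ r) ((c ℤ.+ d , e) ∷ r) r (merge c d e r) (drop-0 (c ℤ.+ d) e r s0)))
                   (ℕₚ.≤-trans (ℕₚ.<⇒≤ k) (ℕₚ.n≤1+n _))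
                   (leading′ n r (ℕₚ.≤-trans (ℕₚ.<⇒≤ k) l))

  leading : ∀ p → Leading p
  leading p = leading′ (length p) p ℕₚ.≤-refl

  below-map : ∀ c e f p → Below f p → Below (e ⊞ f) (map (mulM (c , e)) p)
  below-map c e f p b = Allₚ.map⁺ (All.map (⊞-monoʳ e) b)

  below-* : ∀ e f p r → Below e p → (∀ m → m ≺ e → Below (e ⊞ f) (map (mulM (1ℤ , m)) r)) → Below (e ⊞ f) (p *P r)
  below-* e f []            r []       h = []
  below-* e f ((c , m) ∷ p) r (b ∷ bs) h =
    Allₚ.++⁺ (Allₚ.map⁺ (All.map (λ a → a) (Allₚ.map⁻ (h m b)))) (below-* e f p r bs h)

  leading-* : ∀ c e p d f r → Below e p → Below f r →
    coeffAt (((c , e) ∷ p) *P ((d , f) ∷ r)) (e ⊞ f) ≡ c ℤ.* d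
  leading-* c e p d f r b b′ = begin
    coeffAt ((c ℤ.* d , e ⊞ f) ∷ s) (e ⊞ f)               ≡⟨ coeffAt-∷ (c ℤ.* d , e ⊞ f) s (e ⊞ f) ⟩
    _                                                     ≡⟨ cong₂ ℤ._+_ (mono-at (c ℤ.* d) (e ⊞ f)) (below-0 s below (e ⊞ f) (inj₁ refl)) ⟩
    c ℤ.* d ℤ.+ 0ℤ                                        ≡⟨ ℤₚ.+-identityʳ _ ⟩
    c ℤ.* d                                               ∎
    where
    open ≡-Reasoning
    s = map (mulM (c , e)) r ++ p *P ((d , f) ∷ r)
    below : Below (e ⊞ f) s
    below = Allₚ.++⁺ (below-map c e f r b′)
      (below-* e f p ((d , f) ∷ r) b λ m m≺e →
        ⊞-monoˡ f m≺e ∷ Allₚ.map⁺ (All.map (λ {n} a → ≺-trans (⊞-monoʳ m a) (⊞-monoˡ f m≺e)) b′))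

  NonZero : Poly → Set
  NonZero p = ¬ p ≋ zeroP

  -- Leading monomials multiply to a monomial that really occurs in the product. This bounds the
  -- degree of a divisor by exponents found in its multiple.
  nonZero-leading : ∀ h g {r} → NonZero r → h *P g ≋ r →
    ∃ λ e → ∃ λ f → coeffAt r (e ⊞ f) ≢ 0ℤ × (∀ e′ → e ≺ e′ → coeffAt h e′ ≡ 0ℤ)
  nonZero-leading h g {r} r≢ hg with leading h | leading g
  ... | zero h0 | _ = contradiction
          (≋-trans (≋-sym hg) (pointwise (*-cong′ h [] g g h0 (λ _ _ _ → refl)))) r≢
  ... | lead _ _ _ _ _ _ _ | zero g0 = contradiction
          (≋-trans (≋-sym hg) (≋-trans (pointwise (*-congˡ′ h g [] g0)) (≡⇒≋ (*-[] h)))) r≢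
  ... | lead c e h′ c≢ b _ t | lead d f g′ d≢ b′ _ t′ = e , f , nz , above
    where
    nz : coeffAt r (e ⊞ f) ≢ 0ℤ
    nz z = [ c≢ , d≢ ]′ (ℤₚ.i*j≡0⇒i≡0∨j≡0 c (trans (sym (leading-* c e h′ d f g′ b b′))
      (trans (sym (*-cong′ h ((c , e) ∷ h′) g ((d , f) ∷ g′) t t′ _ _ _)) (trans (at hg _ _ _) z))))
    above : ∀ e′ → e ≺ e′ → coeffAt h e′ ≡ 0ℤ
    above e′ a = trans (t _ _ _) (below-0 ((c , e) ∷ h′) (a ∷ All.map (λ x → ≺-trans x a) b) e′ (inj₁ refl))

  lead-nonZero : ∀ {p} c e r → c ≢ 0ℤ → Below e r → p ≈P (c , e) ∷ r → NonZero p
  lead-nonZero {p} c e r c≢ b t z = c≢ (begin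
    c                             ≡⟨ mono-at c e ⟨
    M                             ≡⟨ ℤₚ.+-identityʳ M ⟨
    M ℤ.+ 0ℤ                      ≡⟨ cong₂ ℤ._+_ (refl {x = M}) (below-0 r b e (inj₁ refl)) ⟨
    M ℤ.+ coeffAt r e             ≡⟨ coeffAt-∷ (c , e) r e ⟨
    coeffAt ((c , e) ∷ r) e       ≡⟨ t _ _ _ ⟨
    coeffAt p e                   ≡⟨ at z _ _ _ ⟩
    0ℤ                            ∎)
    where
    open ≡-Reasoning
    M = coeffAt ((c , e) ∷ []) e

  nonZero-* : ∀ {p r} → NonZero p → NonZero r → NonZero (p *P r)
  nonZero-* {p} {r} p≢ r≢ z with leading p | leading r
  ... | zero p0 | _ = p≢ (pointwise p0)
  ... | lead _ _ _ _ _ _ _ | zero r0 = r≢ (pointwise r0)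
  ... | lead c e p′ c≢ b _ t | lead d f r′ d≢ b′ _ t′ =
    [ c≢ , d≢ ]′ (ℤₚ.i*j≡0⇒i≡0∨j≡0 c (trans (sym (leading-* c e p′ d f r′ b b′))
      (trans (sym (*-cong′ p ((c , e) ∷ p′) r ((d , f) ∷ r′) t t′ _ _ _)) (at z _ _ _))))

  nonZero⇒reg : ∀ {p} → NonZero p → Reg p
  nonZero⇒reg {p} p≢ {y} e with leading y
  ... | zero y0              = pointwise y0
  ... | lead c f y′ c≢ b _ t = contradiction e (nonZero-* {p} {y} p≢ (lead-nonZero {y} c f y′ c≢ b t))

-- Coprimality by elimination of variables

module Elimination where

  open PolynomialRing
  open LeadingTerms
  open ≡ using (refl; cong; cong₂)
  open CommutativeRing polyRing using (_≈_; _+_; _*_; -_; _-_; 0#; 1#; trans; sym; reflexive)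
  open RingReasoning polyRing
  open Formulas _+P_ _*P_ negP zeroP oneP

  data Var : Set where
    vq va vb : Var

  deg : Var → Expo → ℕ
  deg vq (x , y , z) = x
  deg va (x , y , z) = y
  deg vb (x , y , z) = z

  -- Rotation carries a, and applied twice b, to the first place of the lexicographic order, so that
  -- the degree argument is made for q alone.
  rotM : Mono → Mono
  rotM (c , x , y , z) = (c , y , z , x)

  rot : Poly → Poly
  rot = map rotM

  coeff-rot : ∀ p i j k → coeff (rot p) i j k ≡ coeff p k i j
  coeff-rot [] i j k = refl
  coeff-rot ((c , x , y , z) ∷ p) i j k = cong₂ ℤ._+_
    (cong (λ b → if b then c else 0ℤ) (≡.trans (≡.sym (∧-assoc (y ≡ᵇ i) (z ≡ᵇ j) (x ≡ᵇ k))) (∧-comm _ (x ≡ᵇ k))))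
    (coeff-rot p i j k)

  rot-cong : ∀ {p r} → p ≈ r → rot p ≈ rot r
  rot-cong {p} {r} e = pointwise λ i j k → ≡.trans (coeff-rot p i j k) (≡.trans (at e k i j) (≡.sym (coeff-rot r i j k)))

  rot-* : ∀ p r → rot (p *P r) ≡ rot p *P rot r
  rot-* []      r = refl
  rot-* (m ∷ p) r = ≡.trans (Listₚ.map-++ rotM (map (mulM m) r) (p *P r))
    (cong₂ _++_ (≡.trans (≡.sym (Listₚ.map-∘ r)) (Listₚ.map-∘ r)) (rot-* p r))

  rot-nonZero : ∀ {p} → NonZero p → NonZero (rot p)
  rot-nonZero {p} h z = h (pointwise λ i j k → ≡.trans (≡.sym (coeff-rot p j k i)) (at z j k i))

  FreeOf : Var → Poly → Set
  FreeOf v p = All (λ m → deg v (proj₂ m) ≡ 0) p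

  Degree0 : Var → Poly → Set
  Degree0 v p = ∀ e → 0 < deg v e → coeffAt p e ≡ 0ℤ

  freeOf⇒degree0 : ∀ v p → FreeOf v p → Degree0 v p
  freeOf⇒degree0 v []            []       e h = refl
  freeOf⇒degree0 v ((c , f) ∷ p) (d ∷ ds) e h = ≡.trans (coeffAt-∷ (c , f) p e)
    (cong₂ ℤ._+_ (mono-off c f e λ { refl → ℕₚ.<-irrefl (≡.sym d) h }) (freeOf⇒degree0 v p ds e h))

  -- With q first in the order, the leading monomial of h has its largest q-degree. Were that
  -- positive, the product of the leading monomials of h and g would be a term of r of positive
  -- q-degree.
  factor-degree0 : ∀ h g r → h *P g ≈ r → NonZero r → Degree0 vq r → Degree0 vq h
  factor-degree0 h g r e r≢ d f f>0 with nonZero-leading h g r≢ e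
  ... | (zero , y , z) , _ , _ , above = above f (lift f f>0)
    where
    lift : ∀ f → 0 < deg vq f → (zero , y , z) ≺ f
    lift (suc x , _ , _) _ = fst< (s≤s z≤n)
  ... | (suc x , y , z) , g′ , nz , _ = contradiction (d _ (s≤s z≤n)) nz

  factor-degree0′ : ∀ v h g r → h *P g ≈ r → NonZero r → Degree0 v r → Degree0 v h
  factor-degree0′ vq = factor-degree0
  factor-degree0′ va h g r e r≢ d (i , j , k) j>0 = ≡.trans (≡.sym (coeff-rot h j k i))
    (factor-degree0 (rot h) (rot g) (rot r) (trans (reflexive (≡.sym (rot-* h g))) (rot-cong e)) (rot-nonZero r≢)
      (λ { (x , y , z) x>0 → ≡.trans (coeff-rot r x y z) (d (z , x , y) x>0) }) (j , k , i) j>0)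
  factor-degree0′ vb h g r e r≢ d (i , j , k) k>0 = ≡.trans (≡.sym (coeff-rot h j k i))
    (factor-degree0′ va (rot h) (rot g) (rot r) (trans (reflexive (≡.sym (rot-* h g))) (rot-cong e)) (rot-nonZero r≢)
      (λ { (x , y , z) y>0 → ≡.trans (coeff-rot r x y z) (d (z , x , y) y>0) }) (j , k , i) k>0)

  -- Plays the part of a resultant: a common divisor of s and t divides r, and as r is nonzero and
  -- free of v, the divisor has degree 0 in v.
  record Elim (v : Var) (s t : Poly) : Set where
    constructor elim
    field
      r u w   : Poly
      free    : FreeOf v r
      nonZero : NonZero r
      combo   : r ≈ u * s + w * t

  coprime : ∀ s t → (∀ v → Elim v s t) → CoprimeP s t
  coprime s t el h (g , hg) (g′ , hg′) i j k pos = go i j k pos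
    where
    deg0 : ∀ v → Degree0 v h
    deg0 v = factor-degree0′ v h (u * g + w * g′) r
        (trans (lin₂ u w (pointwise {h *P g} {s} hg) (pointwise {h *P g′} {t} hg′) (solve 7 (λ h g g′ u w s t → h :* (u :* g :+ w :* g′) :- (u :* s :+ w :* t) := u :* (h :* g :- s) :+ w :* (h :* g′ :- t)) ≡.refl h g g′ u w s t)) (sym combo))
        nonZero (freeOf⇒degree0 v r free)
      where open Elim (el v)
    go : ∀ i j k → 0 < i ℕ.+ j ℕ.+ k → coeff h i j k ≡ 0ℤ
    go (suc i) j       k       _ = deg0 vq _ (s≤s z≤n)
    go zero    (suc j) k       _ = deg0 va _ (s≤s z≤n)
    go zero    zero    (suc k) _ = deg0 vb _ (s≤s z≤n)

  deg-⊞ : ∀ v e f → deg v e ≡ 0 → deg v f ≡ 0 → deg v (e ⊞ f) ≡ 0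
  deg-⊞ vq _ _ p r = cong₂ ℕ._+_ p r
  deg-⊞ va _ _ p r = cong₂ ℕ._+_ p r
  deg-⊞ vb _ _ p r = cong₂ ℕ._+_ p r

  free-mulM : ∀ v m r → deg v (proj₂ m) ≡ 0 → FreeOf v r → FreeOf v (map (mulM m) r)
  free-mulM v m []      d []       = []
  free-mulM v m (l ∷ r) d (e ∷ es) = deg-⊞ v (proj₂ m) (proj₂ l) d e ∷ free-mulM v m r d es

  free-* : ∀ v {p r} → FreeOf v p → FreeOf v r → FreeOf v (p *P r)
  free-* v {[]} []                    f = []
  free-* v {m ∷ p} {r} (d ∷ ds) f = Allₚ.++⁺ (free-mulM v m r d f) (free-* v ds f)

  free-neg : ∀ v {p} → FreeOf v p → FreeOf v (negP p)
  free-neg v []       = []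
  free-neg v (d ∷ ds) = d ∷ free-neg v ds

  free-− : ∀ v {p r} → FreeOf v p → FreeOf v r → FreeOf v (p -P r)
  free-− v f g = Allₚ.++⁺ f (free-neg v g)

  free-1 : ∀ v → FreeOf v oneP
  free-1 vq = refl ∷ []
  free-1 va = refl ∷ []
  free-1 vb = refl ∷ []

  free-pw : ∀ v {p} n → FreeOf v p → FreeOf v (pw p n)
  free-pw v zero    f = free-1 v
  free-pw v (suc n) f = free-* v (free-pw v n f) f

  elim-*ˡ : ∀ {v s s′ t} → Elim v s t → Elim v s′ t → Elim v (s * s′) t
  elim-*ˡ {v} {s} {s′} {t} (elim r u w f nz e) (elim r′ u′ w′ f′ nz′ e′) =
    elim (r * r′) (u * u′) (w * r′ + u * s * w′) (free-* v f f′) (nonZero-* {r} {r′} nz nz′)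
      (lin₂ r′ (u * s) e e′ (solve 9 (λ r u w r′ u′ w′ s s′ t →
        r :* r′ :- (u :* u′ :* (s :* s′) :+ (w :* r′ :+ u :* s :* w′) :* t)
        := r′ :* (r :- (u :* s :+ w :* t)) :+ u :* s :* (r′ :- (u′ :* s′ :+ w′ :* t))) ≡.refl r u w r′ u′ w′ s s′ t))

  elim-sym : ∀ {v s t} → Elim v s t → Elim v t s
  elim-sym {s = s} {t} (elim r u w f nz e) = elim r w u f nz
    (trans e (solve 4 (λ a b c d → a :* b :+ c :* d := c :* d :+ a :* b) ≡.refl u s w t))

  elim-*ʳ : ∀ {v s t t′} → Elim v s t → Elim v s t′ → Elim v s (t * t′)
  elim-*ʳ x y = elim-sym (elim-*ˡ (elim-sym x) (elim-sym y))

  elim-∣ : ∀ {v s s′ t} k → s * k ≈ s′ → Elim v s′ t → Elim v s t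
  elim-∣ {v} {s} {s′} {t} k h (elim r u w f nz e) = elim r (u * k) w f nz
    (lin₂ 1# (- u) e h (solve 7 (λ r u w s s′ t k → r :- (u :* k :* s :+ w :* t) := :1 :* (r :- (u :* s′ :+ w :* t)) :+ (:- u) :* (s :* k :- s′)) ≡.refl r u w s s′ t k))

  elim-∣ʳ : ∀ {v s t t′} k → t * k ≈ t′ → Elim v s t′ → Elim v s t
  elim-∣ʳ k h x = elim-sym (elim-∣ k h (elim-sym x))

  elim-free : ∀ {v s t} → FreeOf v s → NonZero s → Elim v s t
  elim-free {s = s} {t} f nz = elim s 1# 0# f nz (solve 2 (λ s t → s := :1 :* s :+ :0 :* t) ≡.refl s t)

  elim-freeʳ : ∀ {v s t} → FreeOf v t → NonZero t → Elim v s t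
  elim-freeʳ f nz = elim-sym (elim-free f nz)

-- Factors coprime to the modulus

module Coprimality where

  open PolynomialRing
  open LeadingTerms
  open Elimination
  open ≡ using (refl; cong; cong₂; subst)
  open CommutativeRing polyRing using (_≈_; _+_; _*_; -_; _-_; 0#; 1#; trans; sym; reflexive; *-cong; *-congʳ; +-cong; +-congʳ; +-congˡ; -‿cong)
    renaming (refl to ≈-refl)
  open RingReasoning polyRing
  open Powers polyRing
  open Formulas _+P_ _*P_ negP zeroP oneP

  mono : Expo → Poly
  mono e = (1ℤ , e) ∷ []

  _⊠_ : ℕ → Expo → Expo
  zero  ⊠ e = (0 , 0 , 0)
  suc k ⊠ e = (k ⊠ e) ⊞ e

  mono-pw : ∀ e k → pw (mono e) k ≈ mono (k ⊠ e)
  mono-pw e zero    = ≈-refl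
  mono-pw e (suc k) = *-congʳ (mono-pw e k)

  deg-⊞-+ : ∀ v e f → deg v (e ⊞ f) ≡ deg v e ℕ.+ deg v f
  deg-⊞-+ vq e f = refl
  deg-⊞-+ va e f = refl
  deg-⊞-+ vb e f = refl

  deg-⊠ : ∀ v k e → deg v (k ⊠ e) ≡ k ℕ.* deg v e
  deg-⊠ vq zero e = refl
  deg-⊠ va zero e = refl
  deg-⊠ vb zero e = refl
  deg-⊠ v (suc k) e = ≡.trans (deg-⊞-+ v (k ⊠ e) e) (≡.trans (cong (ℕ._+ deg v e) (deg-⊠ v k e)) (ℕₚ.+-comm (k ℕ.* deg v e) _))

  mono-injective : ∀ e f → mono e ≈ mono f → e ≡ f
  mono-injective e f h with compare e f
  ... | eq e≡f = e≡f
  ... | lt e≺f = contradiction (≡.trans (≡.sym (mono-at 1ℤ e)) (≡.trans (at h _ _ _) (mono-off 1ℤ f e λ { refl → ≺-irrefl e≺f }))) λ ()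
  ... | gt f≺e = contradiction (≡.trans (≡.sym (mono-at 1ℤ e)) (≡.trans (at h _ _ _) (mono-off 1ℤ f e λ { refl → ≺-irrefl f≺e }))) λ ()

  nonZero-cong : ∀ {p r} → p ≈ r → NonZero p → NonZero r
  nonZero-cong e nz z = nz (trans e z)

  mono-nonZero : ∀ e f → e ≢ f → NonZero (mono e - mono f)
  mono-nonZero e f h z = h (mono-injective e f (x-y≈0⇒x≈y z))

  variable′ : Var → Poly
  variable′ vq = qP
  variable′ va = aP
  variable′ vb = bP

  -- X is, up to sign, a difference x^s A − B of monomials with A and B free of the variable x.
  record Binomial (v : Var) (X : Poly) : Set where
    constructor binomial
    field
      s       : ℕ
      A B     : Expo
      freeA   : deg v A ≡ 0
      freeB   : deg v B ≡ 0
      unit    : Poly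
      form    : X * unit ≈ pw (variable′ v) s * mono A - mono B

  free-mono : ∀ v e → deg v e ≡ 0 → FreeOf v (mono e)
  free-mono v e d = d ∷ []

  -- x^s A = B and x^t C = E give B^t C^s = x^(st) A^t C^s = E^s A^t.
  elim-binomials : ∀ {v X Y} (x : Binomial v X) (y : Binomial v Y) (let open Binomial) (c : Var) →
    s y ℕ.* deg c (B x) ℕ.+ s x ℕ.* deg c (A y) ≢ s x ℕ.* deg c (B y) ℕ.+ s y ℕ.* deg c (A x) →
    Elim v X Y
  elim-binomials {v} {X} {Y} (binomial s A B fA fB k kX) (binomial t C E fC fE l lY) c ne =
    elim-∣ k kX (elim-∣ʳ l lY (elim r (- (γ * g)) (α * g′)
      (free-− v (free-* v (free-pw v t (free-mono v B fB)) (free-pw v s (free-mono v C fC)))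
                (free-* v (free-pw v s (free-mono v E fE)) (free-pw v t (free-mono v A fA))))
      nz combination))
    where
    V α γ r : Poly
    V = variable′ v
    α = pw (mono A) t
    γ = pw (mono C) s
    r = pw (mono B) t * γ - pw (mono E) s * α
    dX = pw-difference (pw V s * mono A) (mono B) t
    dY = pw-difference (pw V t * mono C) (mono E) s
    g  = proj₁ dX
    g′ = proj₁ dY
    -- The two monomials of r have different degrees in the variable `c`.
    nz : NonZero r
    nz = nonZero-cong (sym (+-cong (*-cong (mono-pw B t) (mono-pw C s)) (-‿cong (*-cong (mono-pw E s) (mono-pw A t)))))
      (mono-nonZero ((t ⊠ B) ⊞ (s ⊠ C)) ((s ⊠ E) ⊞ (t ⊠ A)) λ h → ne
        (≡.trans (≡.sym (split t B s C)) (≡.trans (cong (deg c) h) (split s E t A))))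
      where
      split : ∀ i e j f → deg c ((i ⊠ e) ⊞ (j ⊠ f)) ≡ i ℕ.* deg c e ℕ.+ j ℕ.* deg c f
      split i e j f = ≡.trans (deg-⊞-+ c (i ⊠ e) (j ⊠ f)) (cong₂ ℕ._+_ (deg-⊠ c i e) (deg-⊠ c j f))
    β ε x y : Poly
    β = pw (mono B) t
    ε = pw (mono E) s
    x = pw V s * mono A - mono B
    y = pw V t * mono C - mono E
    h₁ : pw (pw V s) t * α - β ≈ x * g
    h₁ = trans (+-congʳ { - β} (sym (pw-* (pw V s) (mono A) t))) (proj₂ dX)
    h₂ : pw (pw V t) s * γ - ε ≈ y * g′
    h₂ = trans (+-congʳ { - ε} (sym (pw-* (pw V t) (mono C) s))) (proj₂ dY)
    combination : r ≈ - (γ * g) * x + α * g′ * y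
    combination = lin₃ (- γ) α (α * γ) h₁ h₂ (pw-swap V s t)
      (solve 10 (λ x y α γ β ε g g′ p p′ →
        β :* γ :- ε :* α :- ((:- (γ :* g)) :* x :+ α :* g′ :* y)
        := (:- γ) :* (p :* α :- β :- x :* g) :+ α :* (p′ :* γ :- ε :- y :* g′) :+ α :* γ :* (p :- p′)) ≡.refl
        x y α γ β ε g g′ (pw (pw V s) t) (pw (pw V t) s))

  data Letter : Set where
    ℓa ℓb : Letter

  var-of : Letter → Var
  var-of ℓa = va
  var-of ℓb = vb

  expo : Letter → Expo
  expo ℓa = (0 , 1 , 0)
  expo ℓb = (0 , 0 , 1)

  letter : Letter → Poly
  letter y = mono (expo y)

  1ₑ qₑ : Expo
  1ₑ = (0 , 0 , 0)
  qₑ = (1 , 0 , 0)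

  Q : ℕ → Poly
  Q = pw qP

  Q-mono : ∀ k → Q k ≈ mono (k ⊠ qₑ)
  Q-mono = mono-pw qₑ

  diff prod : Letter → ℕ → Poly
  diff y k = letter y - Q k
  prod y k = 1# - letter y * Q k

  cyc : ℕ → Poly
  cyc k = 1# - Q k

  deg-letter : ∀ y → deg (var-of y) (expo y) ≡ 1
  deg-letter ℓa = refl
  deg-letter ℓb = refl

  deg-q-letter : ∀ y → deg vq (expo y) ≡ 0
  deg-q-letter ℓa = refl
  deg-q-letter ℓb = refl

  deg-1 : ∀ v → deg v 1ₑ ≡ 0
  deg-1 vq = refl
  deg-1 va = refl
  deg-1 vb = refl

  deg-letter-q : ∀ y k → deg (var-of y) (k ⊠ qₑ) ≡ 0
  deg-letter-q ℓa k = ≡.trans (deg-⊠ va k qₑ) (ℕₚ.*-zeroʳ k)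
  deg-letter-q ℓb k = ≡.trans (deg-⊠ vb k qₑ) (ℕₚ.*-zeroʳ k)

  variable-letter : ∀ y → variable′ (var-of y) ≡ letter y
  variable-letter ℓa = refl
  variable-letter ℓb = refl

  cyc-binomial : ∀ k → Binomial vq (cyc k)
  cyc-binomial k = binomial k 1ₑ 1ₑ refl refl (- 1#)
    (solve 1 (λ x → (:1 :- x) :* (:- :1) := x :* :1 :- :1) ≡.refl (Q k))

  diff-binomial-q : ∀ y k → Binomial vq (diff y k)
  diff-binomial-q y k = binomial k 1ₑ (expo y) refl (deg-q-letter y) (- 1#)
    (solve 2 (λ x y → (y :- x) :* (:- :1) := x :* :1 :- y) ≡.refl (Q k) (letter y))

  prod-binomial-q : ∀ y k → Binomial vq (prod y k)
  prod-binomial-q y k = binomial k (expo y) 1ₑ (deg-q-letter y) refl (- 1#)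
    (solve 2 (λ x y → (:1 :- y :* x) :* (:- :1) := x :* y :- :1) ≡.refl (Q k) (letter y))

  diff-binomial : ∀ y k → Binomial (var-of y) (diff y k)
  diff-binomial y k = binomial 1 1ₑ (k ⊠ qₑ) (deg-1 (var-of y)) (deg-letter-q y k) 1#
    (subst (λ v → diff y k * 1# ≈ pw v 1 * 1# - mono (k ⊠ qₑ)) (≡.sym (variable-letter y))
      (lin₁ (- 1#) (Q-mono k)
        (solve 3 (λ x y z → (y :- x) :* :1 :- (:1 :* y :* :1 :- z) := (:- :1) :* (x :- z)) ≡.refl (Q k) (letter y) (mono (k ⊠ qₑ)))))

  prod-binomial : ∀ y k → Binomial (var-of y) (prod y k)
  prod-binomial y k = binomial 1 (k ⊠ qₑ) 1ₑ (deg-letter-q y k) (deg-1 (var-of y)) (- 1#)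
    (subst (λ v → prod y k * - 1# ≈ pw v 1 * mono (k ⊠ qₑ) - 1#) (≡.sym (variable-letter y))
      (lin₁ (letter y) (Q-mono k)
        (solve 3 (λ x y z → (:1 :- y :* x) :* (:- :1) :- (:1 :* y :* z :- :1) := y :* (x :- z)) ≡.refl (Q k) (letter y) (mono (k ⊠ qₑ)))))

  a−b 1−ab : Poly
  a−b  = letter ℓa - letter ℓb
  1−ab = 1# - letter ℓa * letter ℓb

  a−b-binomial : ∀ y → Binomial (var-of y) a−b
  a−b-binomial ℓa = binomial 1 1ₑ (expo ℓb) refl refl 1#
    (solve 2 (λ x y → (x :- y) :* :1 := :1 :* x :* :1 :- y) ≡.refl (letter ℓa) (letter ℓb))
  a−b-binomial ℓb = binomial 1 1ₑ (expo ℓa) refl refl (- 1#)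
    (solve 2 (λ x y → (x :- y) :* (:- :1) := :1 :* y :* :1 :- x) ≡.refl (letter ℓa) (letter ℓb))

  1−ab-binomial : ∀ y → Binomial (var-of y) 1−ab
  1−ab-binomial ℓa = binomial 1 (expo ℓb) 1ₑ refl refl (- 1#)
    (solve 2 (λ x y → (:1 :- x :* y) :* (:- :1) := :1 :* x :* y :- :1) ≡.refl (letter ℓa) (letter ℓb))
  1−ab-binomial ℓb = binomial 1 (expo ℓa) 1ₑ refl refl (- 1#)
    (solve 2 (λ x y → (:1 :- x :* y) :* (:- :1) := :1 :* y :* x :- :1) ≡.refl (letter ℓa) (letter ℓb))

  free-Q : ∀ y k → FreeOf (var-of y) (Q k)
  free-Q ℓa k = free-pw va k (refl ∷ [])
  free-Q ℓb k = free-pw vb k (refl ∷ [])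

  cyc-free : ∀ y k → FreeOf (var-of y) (cyc k)
  cyc-free y k = free-− (var-of y) (free-1 (var-of y)) (free-Q y k)

  other : Letter → Letter
  other ℓa = ℓb
  other ℓb = ℓa

  other-free : ∀ y → FreeOf (var-of (other y)) (letter y)
  other-free ℓa = refl ∷ []
  other-free ℓb = refl ∷ []

  diff-free : ∀ y k → FreeOf (var-of (other y)) (diff y k)
  diff-free y k = free-− (var-of (other y)) (other-free y) (free-Q (other y) k)

  prod-free : ∀ y k → FreeOf (var-of (other y)) (prod y k)
  prod-free y k = free-− (var-of (other y)) (free-1 (var-of (other y))) (free-* (var-of (other y)) (other-free y) (free-Q (other y) k))

  monos-nonZero : ∀ {p} v e f → p ≈ mono e - mono f → deg v e ≢ deg v f → NonZero p
  monos-nonZero v e f h ne = nonZero-cong (sym h) (mono-nonZero e f (ne ∘ cong (deg v)))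

  cyc-nonZero : ∀ k → NonZero (cyc (suc k))
  cyc-nonZero k = monos-nonZero vq 1ₑ (suc k ⊠ qₑ) (+-congˡ (-‿cong (Q-mono (suc k))))
    λ e → contradiction (≡.trans e (deg-⊠ vq (suc k) qₑ)) λ ()

  diff-nonZero : ∀ y k → NonZero (diff y k)
  diff-nonZero y k = monos-nonZero (var-of y) (expo y) (k ⊠ qₑ) (+-congˡ (-‿cong (Q-mono k)))
    λ e → contradiction (≡.trans (≡.sym (deg-letter y)) (≡.trans e (deg-letter-q y k))) λ ()

  prod-nonZero : ∀ y k → NonZero (prod y k)
  prod-nonZero y k = monos-nonZero (var-of y) 1ₑ (expo y ⊞ (k ⊠ qₑ))
    (lin₁ (- letter y) (Q-mono k)
      (solve 3 (λ x y z → :1 :- y :* x :- (:1 :- y :* z) := (:- y) :* (x :- z)) ≡.refl (Q k) (letter y) (mono (k ⊠ qₑ))))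
    λ e → contradiction (≡.trans (≡.sym (deg-1 (var-of y))) (≡.trans e (≡.trans (deg-⊞-+ (var-of y) (expo y) (k ⊠ qₑ))
      (cong (ℕ._+ deg (var-of y) (k ⊠ qₑ)) (deg-letter y))))) λ ()

  a−b-nonZero : NonZero a−b
  a−b-nonZero = mono-nonZero (expo ℓa) (expo ℓb) λ ()

  1−ab-nonZero : NonZero 1−ab
  1−ab-nonZero = mono-nonZero 1ₑ (expo ℓa ⊞ expo ℓb) λ ()

  even≢odd : ∀ x y → x ℕ.+ x ≢ suc (y ℕ.+ y)
  even≢odd x y e = ℕₚ.even≢odd x y (≡.trans (cong (x ℕ.+_) (ℕₚ.+-identityʳ x))
    (≡.trans e (cong (λ z → suc (y ℕ.+ z)) (≡.sym (ℕₚ.+-identityʳ y)))))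

  -- Parity drives the coprimality proofs: the letters of the modulus meet q^n with n odd, those of
  -- the reduced denominators meet even powers of q.
  module Odd (h : ℕ) where

    n : ℕ
    n = suc (h ℕ.+ h)

    separate : ∀ j c e → n ℕ.* 1 ℕ.+ (j ℕ.+ j) ℕ.* c ≢ (j ℕ.+ j) ℕ.* e ℕ.+ n ℕ.* 0
    separate j c e p = even≢odd (j ℕ.* e) (h ℕ.+ j ℕ.* c) (≡.sym (≡.trans
      (S.solve 3 (λ h j c → S.con 1 S.:+ ((h S.:+ j S.:* c) S.:+ (h S.:+ j S.:* c)) S.:= (S.con 1 S.:+ (h S.:+ h)) S.:* S.con 1 S.:+ (j S.:+ j) S.:* c) refl h j c)
      (≡.trans p (S.solve 3 (λ h j e → (j S.:+ j) S.:* e S.:+ (S.con 1 S.:+ (h S.:+ h)) S.:* S.con 0 S.:= j S.:* e S.:+ j S.:* e) refl h j e))))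

    separate′ : ∀ j c e → n ℕ.* 0 ℕ.+ (j ℕ.+ j) ℕ.* c ≢ (j ℕ.+ j) ℕ.* e ℕ.+ n ℕ.* 1
    separate′ j c e p = separate j e c (≡.trans (ℕₚ.+-comm (n ℕ.* 1) _) (≡.trans (≡.sym p) (ℕₚ.+-comm (n ℕ.* 0) _)))

    separate₁ : ∀ x y → 1 ℕ.* (x ℕ.+ x) ℕ.+ 1 ℕ.* 0 ≢ 1 ℕ.* n ℕ.+ 1 ℕ.* (y ℕ.+ y)
    separate₁ x y p = even≢odd x (h ℕ.+ y) (≡.trans
      (S.solve 1 (λ x → x S.:+ x S.:= S.con 1 S.:* (x S.:+ x) S.:+ S.con 1 S.:* S.con 0) refl x)
      (≡.trans p (S.solve 2 (λ h y → S.con 1 S.:* (S.con 1 S.:+ (h S.:+ h)) S.:+ S.con 1 S.:* (y S.:+ y) S.:= S.con 1 S.:+ ((h S.:+ y) S.:+ (h S.:+ y))) refl h y)))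

    separate₂ : ∀ x y → 1 ℕ.* (x ℕ.+ x) ℕ.+ 1 ℕ.* n ≢ 1 ℕ.* 0 ℕ.+ 1 ℕ.* (y ℕ.+ y)
    separate₂ x y p = separate₁ y x (≡.trans (ℕₚ.+-comm (1 ℕ.* (y ℕ.+ y)) 0) (≡.trans (≡.sym p) (ℕₚ.+-comm (1 ℕ.* (x ℕ.+ x)) _)))

    data Factor : Set where
      cycF        : Factor
      diffF prodF : Letter → Factor

    factor : Factor → Poly
    factor cycF      = cyc n
    factor (diffF y) = diff y n
    factor (prodF y) = prod y n

    deg-q-Q : ∀ k → deg vq (k ⊠ qₑ) ≡ k
    deg-q-Q k = ≡.trans (deg-⊠ vq k qₑ) (ℕₚ.*-identityʳ k)

    -- From y = q^(2j) and z = q^n, with z one of 1, a^(±1), b^(±1), follows y^n = z^(2j). As n is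
    -- odd, this is never a trivial relation.
    diff-elim-q : ∀ y j f → Elim vq (diff y (j ℕ.+ j)) (factor f)
    diff-elim-q ℓa j cycF       = elim-binomials (diff-binomial-q ℓa (j ℕ.+ j)) (cyc-binomial n) va (separate j 0 0)
    diff-elim-q ℓb j cycF       = elim-binomials (diff-binomial-q ℓb (j ℕ.+ j)) (cyc-binomial n) vb (separate j 0 0)
    diff-elim-q ℓa j (diffF ℓa) = elim-binomials (diff-binomial-q ℓa (j ℕ.+ j)) (diff-binomial-q ℓa n) va (separate j 0 1)
    diff-elim-q ℓa j (diffF ℓb) = elim-binomials (diff-binomial-q ℓa (j ℕ.+ j)) (diff-binomial-q ℓb n) va (separate j 0 0)
    diff-elim-q ℓb j (diffF ℓa) = elim-binomials (diff-binomial-q ℓb (j ℕ.+ j)) (diff-binomial-q ℓa n) vb (separate j 0 0)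
    diff-elim-q ℓb j (diffF ℓb) = elim-binomials (diff-binomial-q ℓb (j ℕ.+ j)) (diff-binomial-q ℓb n) vb (separate j 0 1)
    diff-elim-q ℓa j (prodF ℓa) = elim-binomials (diff-binomial-q ℓa (j ℕ.+ j)) (prod-binomial-q ℓa n) va (separate j 1 0)
    diff-elim-q ℓa j (prodF ℓb) = elim-binomials (diff-binomial-q ℓa (j ℕ.+ j)) (prod-binomial-q ℓb n) va (separate j 0 0)
    diff-elim-q ℓb j (prodF ℓa) = elim-binomials (diff-binomial-q ℓb (j ℕ.+ j)) (prod-binomial-q ℓa n) vb (separate j 0 0)
    diff-elim-q ℓb j (prodF ℓb) = elim-binomials (diff-binomial-q ℓb (j ℕ.+ j)) (prod-binomial-q ℓb n) vb (separate j 1 0)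

    prod-elim-q : ∀ y j f → Elim vq (prod y (j ℕ.+ j)) (factor f)
    prod-elim-q ℓa j cycF       = elim-binomials (prod-binomial-q ℓa (j ℕ.+ j)) (cyc-binomial n) va (separate′ j 0 0)
    prod-elim-q ℓb j cycF       = elim-binomials (prod-binomial-q ℓb (j ℕ.+ j)) (cyc-binomial n) vb (separate′ j 0 0)
    prod-elim-q ℓa j (diffF ℓa) = elim-binomials (prod-binomial-q ℓa (j ℕ.+ j)) (diff-binomial-q ℓa n) va (separate′ j 0 1)
    prod-elim-q ℓa j (diffF ℓb) = elim-binomials (prod-binomial-q ℓa (j ℕ.+ j)) (diff-binomial-q ℓb n) va (separate′ j 0 0)
    prod-elim-q ℓb j (diffF ℓa) = elim-binomials (prod-binomial-q ℓb (j ℕ.+ j)) (diff-binomial-q ℓa n) vb (separate′ j 0 0)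
    prod-elim-q ℓb j (diffF ℓb) = elim-binomials (prod-binomial-q ℓb (j ℕ.+ j)) (diff-binomial-q ℓb n) vb (separate′ j 0 1)
    prod-elim-q ℓa j (prodF ℓa) = elim-binomials (prod-binomial-q ℓa (j ℕ.+ j)) (prod-binomial-q ℓa n) va (separate′ j 1 0)
    prod-elim-q ℓa j (prodF ℓb) = elim-binomials (prod-binomial-q ℓa (j ℕ.+ j)) (prod-binomial-q ℓb n) va (separate′ j 0 0)
    prod-elim-q ℓb j (prodF ℓa) = elim-binomials (prod-binomial-q ℓb (j ℕ.+ j)) (prod-binomial-q ℓa n) vb (separate′ j 0 0)
    prod-elim-q ℓb j (prodF ℓb) = elim-binomials (prod-binomial-q ℓb (j ℕ.+ j)) (prod-binomial-q ℓb n) vb (separate′ j 1 0)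

    -- A binomial in the letter y whose monomials have even q-exponents.
    record EvenIn (y : Letter) (X : Poly) : Set where
      constructor even
      field
        bin   : Binomial (var-of y) X
        one   : Binomial.s bin ≡ 1
        i j   : ℕ
        evenA : deg vq (Binomial.A bin) ≡ i ℕ.+ i
        evenB : deg vq (Binomial.B bin) ≡ j ℕ.+ j

    even-elim : ∀ {y X} → EvenIn y X → ∀ f → Elim (var-of y) X (factor f)
    even-elim {y} e cycF = elim-freeʳ (cyc-free y n) (cyc-nonZero (h ℕ.+ h))
    even-elim {ℓa} e (diffF ℓb) = elim-freeʳ (diff-free ℓb n) (diff-nonZero ℓb n)
    even-elim {ℓb} e (diffF ℓa) = elim-freeʳ (diff-free ℓa n) (diff-nonZero ℓa n)
    even-elim {ℓa} e (prodF ℓb) = elim-freeʳ (prod-free ℓb n) (prod-nonZero ℓb n)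
    even-elim {ℓb} e (prodF ℓa) = elim-freeʳ (prod-free ℓa n) (prod-nonZero ℓa n)
    even-elim {ℓa} (even bin refl i j eA eB) (diffF ℓa) = elim-binomials bin (diff-binomial ℓa n) vq
      λ p → separate₁ j i (≡.trans (cong (λ x → 1 ℕ.* x ℕ.+ 0) (≡.sym eB)) (≡.trans p (cong₂ (λ x y → 1 ℕ.* x ℕ.+ 1 ℕ.* y) (deg-q-Q n) eA)))
    even-elim {ℓb} (even bin refl i j eA eB) (diffF ℓb) = elim-binomials bin (diff-binomial ℓb n) vq
      λ p → separate₁ j i (≡.trans (cong (λ x → 1 ℕ.* x ℕ.+ 0) (≡.sym eB)) (≡.trans p (cong₂ (λ x y → 1 ℕ.* x ℕ.+ 1 ℕ.* y) (deg-q-Q n) eA)))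
    even-elim {ℓa} (even bin refl i j eA eB) (prodF ℓa) = elim-binomials bin (prod-binomial ℓa n) vq
      λ p → separate₂ j i (≡.trans (cong₂ (λ x y → 1 ℕ.* x ℕ.+ 1 ℕ.* y) (≡.sym eB) (≡.sym (deg-q-Q n))) (≡.trans p (cong (λ x → 1 ℕ.* 0 ℕ.+ 1 ℕ.* x) eA)))
    even-elim {ℓb} (even bin refl i j eA eB) (prodF ℓb) = elim-binomials bin (prod-binomial ℓb n) vq
      λ p → separate₂ j i (≡.trans (cong₂ (λ x y → 1 ℕ.* x ℕ.+ 1 ℕ.* y) (≡.sym eB) (≡.sym (deg-q-Q n))) (≡.trans p (cong (λ x → 1 ℕ.* 0 ℕ.+ 1 ℕ.* x) eA)))

    diff-even : ∀ y j → EvenIn y (diff y (j ℕ.+ j))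
    diff-even y j = even (diff-binomial y (j ℕ.+ j)) refl 0 j refl (deg-q-Q (j ℕ.+ j))

    prod-even : ∀ y j → EvenIn y (prod y (j ℕ.+ j))
    prod-even y j = even (prod-binomial y (j ℕ.+ j)) refl j 0 (deg-q-Q (j ℕ.+ j)) refl

    a−b-even : ∀ y → EvenIn y a−b
    a−b-even ℓa = even (a−b-binomial ℓa) refl 0 0 refl refl
    a−b-even ℓb = even (a−b-binomial ℓb) refl 0 0 refl refl

    1−ab-even : ∀ y → EvenIn y 1−ab
    1−ab-even ℓa = even (1−ab-binomial ℓa) refl 0 0 refl refl
    1−ab-even ℓb = even (1−ab-binomial ℓb) refl 0 0 refl refl

    -- Used in place of `CoprimeP` because elimination relations multiply, so products stay good;
    -- for coprimality itself that would call for unique factorization or the like.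
    Good : Poly → Set
    Good s = ∀ v f → Elim v s (factor f)

    good-diff : ∀ y j → Good (diff y (j ℕ.+ j))
    good-diff y  j vq f = diff-elim-q y j f
    good-diff ℓa j va f = even-elim (diff-even ℓa j) f
    good-diff ℓa j vb f = elim-free (diff-free ℓa (j ℕ.+ j)) (diff-nonZero ℓa (j ℕ.+ j))
    good-diff ℓb j vb f = even-elim (diff-even ℓb j) f
    good-diff ℓb j va f = elim-free (diff-free ℓb (j ℕ.+ j)) (diff-nonZero ℓb (j ℕ.+ j))

    good-prod : ∀ y j → Good (prod y (j ℕ.+ j))
    good-prod y  j vq f = prod-elim-q y j f
    good-prod ℓa j va f = even-elim (prod-even ℓa j) f
    good-prod ℓa j vb f = elim-free (prod-free ℓa (j ℕ.+ j)) (prod-nonZero ℓa (j ℕ.+ j))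
    good-prod ℓb j vb f = even-elim (prod-even ℓb j) f
    good-prod ℓb j va f = elim-free (prod-free ℓb (j ℕ.+ j)) (prod-nonZero ℓb (j ℕ.+ j))

    good-a−b : Good a−b
    good-a−b vq f = elim-free (refl ∷ refl ∷ []) a−b-nonZero
    good-a−b va f = even-elim (a−b-even ℓa) f
    good-a−b vb f = even-elim (a−b-even ℓb) f

    good-1−ab : Good 1−ab
    good-1−ab vq f = elim-free (refl ∷ refl ∷ []) 1−ab-nonZero
    good-1−ab va f = even-elim (1−ab-even ℓa) f
    good-1−ab vb f = even-elim (1−ab-even ℓb) f

    good-* : ∀ {s t} → Good s → Good t → Good (s * t)
    good-* gs gs′ v f = elim-*ˡ (gs v f) (gs′ v f)

    good-∣ : ∀ {s t} k → s * k ≈ t → Good t → Good s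
    good-∣ k e g v f = elim-∣ k e (g v f)

    good-cong : ∀ {s t} → s ≈ t → Good s → Good t
    good-cong {s} {t} e = good-∣ 1# (trans (solve 1 (λ t → t :* :1 := t) ≡.refl t) (sym e))

    good-1 : Good 1#
    good-1 v f = elim-free (free-1 v) (lead-nonZero {1#} 1ℤ 1ₑ [] (λ ()) [] (λ i j k → refl))

    good-pw : ∀ {s} k → Good s → Good (pw s k)
    good-pw zero    g = good-1
    good-pw (suc k) g = good-* (good-pw k g) g

    q-nonZero : NonZero qP
    q-nonZero = lead-nonZero {qP} 1ℤ qₑ [] (λ ()) [] (λ i j k → refl)

    letter-nonZero : ∀ y → NonZero (letter y)
    letter-nonZero y = lead-nonZero {letter y} 1ℤ (expo y) [] (λ ()) [] (λ i j k → refl)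

    good-q : Good qP
    good-q va f         = elim-free (refl ∷ []) q-nonZero
    good-q vb f         = elim-free (refl ∷ []) q-nonZero
    good-q vq cycF      = elim 1# (Q (h ℕ.+ h)) 1# (free-1 vq) (lead-nonZero {1#} 1ℤ 1ₑ [] (λ ()) [] (λ i j k → refl))
      (solve 2 (λ q x → :1 := x :* q :+ :1 :* (:1 :- x :* q)) ≡.refl qP (Q (h ℕ.+ h)))
    good-q vq (diffF y) = elim (letter y) (Q (h ℕ.+ h)) 1# (letter-free-q y) (letter-nonZero y)
      (solve 3 (λ q x y → y := x :* q :+ :1 :* (y :- x :* q)) ≡.refl qP (Q (h ℕ.+ h)) (letter y))
      where
      letter-free-q : ∀ y → FreeOf vq (letter y)
      letter-free-q ℓa = refl ∷ []
      letter-free-q ℓb = refl ∷ []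
    good-q vq (prodF y) = elim 1# (letter y * Q (h ℕ.+ h)) 1# (free-1 vq) (lead-nonZero {1#} 1ℤ 1ₑ [] (λ ()) [] (λ i j k → refl))
      (solve 3 (λ q x y → :1 := y :* x :* q :+ :1 :* (:1 :- y :* (x :* q))) ≡.refl qP (Q (h ℕ.+ h)) (letter y))

    nat : ℕ → Poly
    nat zero    = 0#
    nat (suc k) = 1# + nat k

    nat-coeff : ∀ k → coeffAt (nat k) 1ₑ ≡ ℤ.+ k
    nat-coeff zero    = refl
    nat-coeff (suc k) = ≡.trans (coeff-++ 1# (nat k) 0 0 0) (cong (λ c → 1ℤ ℤ.+ c) (nat-coeff k))

    nat-nonZero : ∀ k → NonZero (nat (suc k))
    nat-nonZero k z = contradiction (≡.trans (≡.sym (nat-coeff (suc k))) (at z 0 0 0)) λ ()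

    free-nat : ∀ v k → FreeOf v (nat k)
    free-nat v zero     = []
    free-nat vq (suc k) = refl ∷ free-nat vq k
    free-nat va (suc k) = refl ∷ free-nat va k
    free-nat vb (suc k) = refl ∷ free-nat vb k

    -- `CoprimeP` admits constant common divisors, so nonzero integers count as coprime to the
    -- modulus. This permits division by n and by 2.
    good-nat : ∀ k → Good (nat (suc k))
    good-nat k v f = elim-free (free-nat v (suc k)) (nat-nonZero k)

    free-1+Q : ∀ y k → FreeOf (var-of y) (1# + Q k)
    free-1+Q ℓa k = refl ∷ free-Q ℓa k
    free-1+Q ℓb k = refl ∷ free-Q ℓb k

    1+Q-∣ : ∀ k → (1# + Q k) * (1# - Q k) ≈ cyc (k ℕ.+ k)
    1+Q-∣ k = lin₁ 1# (pw-+ qP k k)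
      (solve 2 (λ x y → (:1 :+ x) :* (:1 :- x) :- (:1 :- y) := :1 :* (y :- x :* x)) ≡.refl (Q k) (Q (k ℕ.+ k)))

    1+Q-nonZero : ∀ k → NonZero (1# + Q (suc k))
    1+Q-nonZero k z = cyc-nonZero (k ℕ.+ suc k) (trans (sym (1+Q-∣ (suc k)))
      (lin₁ (1# - Q (suc k)) z (solve 2 (λ x y → x :* y :- :0 := y :* (x :- :0)) ≡.refl (1# + Q (suc k)) (1# - Q (suc k)))))

    -- For x = q^(2k), 1 + x divides 1 + x^n because n is odd, and x^n is 1 modulo 1 - q^n; the
    -- combination reached is 2.
    1+Q-elim-cyc : ∀ k → Elim vq (1# + Q (k ℕ.+ k)) (cyc n)
    1+Q-elim-cyc k = elim (nat 2) (proj₁ W) (proj₁ V) (free-nat vq 2) (nat-nonZero 1)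
      (lin₃ 1# (- 1#) (- 1#) (proj₂ W) hV (pw-swap qP x n)
        (solve 6 (λ x y v w p r → :1 :+ (:1 :+ :0) :- (w :* (:1 :+ x) :+ v :* (:1 :- y))
           := :1 :* (p :+ :1 :- (:1 :+ x) :* w) :+ (:- :1) :* (r :- :1 :- (y :- :1) :* v) :+ (:- :1) :* (p :- r))
           ≡.refl (Q x) (Q n) (proj₁ V) (proj₁ W) (pw (Q x) n) (pw (Q n) x)))
      where
      x = k ℕ.+ k
      W = pw-odd+1 (Q x) h
      V = pw-difference (Q n) 1# x
      hV : pw (Q n) x - 1# ≈ (Q n - 1#) * proj₁ V
      hV = lin₂ 1# 1# (proj₂ V) (pw-1 x)
        (solve 4 (λ y v r o → r :- :1 :- (y :- :1) :* v := :1 :* (r :- o :- (y :- :1) :* v) :+ :1 :* (o :- :1)) ≡.refl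
          (Q n) (proj₁ V) (pw (Q n) x) (pw 1# x))

    separate₃ : ∀ k → n ℕ.* 0 ℕ.+ suc k ℕ.* 0 ≢ suc k ℕ.* 1 ℕ.+ n ℕ.* 0
    separate₃ k p = contradiction (≡.trans (≡.sym (cong₂ ℕ._+_ (ℕₚ.*-zeroʳ n) (ℕₚ.*-zeroʳ k))) p) λ ()

    separate₄ : ∀ k → n ℕ.* 0 ℕ.+ suc k ℕ.* 1 ≢ suc k ℕ.* 0 ℕ.+ n ℕ.* 0
    separate₄ k p = separate₃ k (≡.trans (ℕₚ.+-comm (n ℕ.* 0) _) (≡.trans (≡.sym p) (ℕₚ.+-comm (n ℕ.* 0) _)))

    cyc-elim-diff : ∀ k y → Elim vq (cyc (suc k)) (diff y n)
    cyc-elim-diff k ℓa = elim-binomials (cyc-binomial (suc k)) (diff-binomial-q ℓa n) va (separate₃ k)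
    cyc-elim-diff k ℓb = elim-binomials (cyc-binomial (suc k)) (diff-binomial-q ℓb n) vb (separate₃ k)

    cyc-elim-prod : ∀ k y → Elim vq (cyc (suc k)) (prod y n)
    cyc-elim-prod k ℓa = elim-binomials (cyc-binomial (suc k)) (prod-binomial-q ℓa n) va (separate₄ k)
    cyc-elim-prod k ℓb = elim-binomials (cyc-binomial (suc k)) (prod-binomial-q ℓb n) vb (separate₄ k)

    good-1+Q : ∀ k → Good (1# + Q (suc k ℕ.+ suc k))
    good-1+Q k va f         = elim-free (free-1+Q ℓa (suc k ℕ.+ suc k)) (1+Q-nonZero (k ℕ.+ suc k))
    good-1+Q k vb f         = elim-free (free-1+Q ℓb (suc k ℕ.+ suc k)) (1+Q-nonZero (k ℕ.+ suc k))
    good-1+Q k vq cycF      = 1+Q-elim-cyc (suc k)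
    good-1+Q k vq (diffF y) = elim-∣ (1# - Q (suc k ℕ.+ suc k)) (1+Q-∣ (suc k ℕ.+ suc k)) (cyc-elim-diff (k ℕ.+ suc k ℕ.+ (suc k ℕ.+ suc k)) y)
    good-1+Q k vq (prodF y) = elim-∣ (1# - Q (suc k ℕ.+ suc k)) (1+Q-∣ (suc k ℕ.+ suc k)) (cyc-elim-prod (k ℕ.+ suc k ℕ.+ (suc k ℕ.+ suc k)) y)

    ^P≡pw : ∀ x k → x ^P k ≡ pw x k
    ^P≡pw x zero    = refl
    ^P≡pw x (suc k) = cong (_*P x) (^P≡pw x k)

    qint-cyc : ∀ k → qintPoly k * (1# - qP) ≈ cyc k
    qint-cyc zero    = solve 1 (λ q → :0 :* (:1 :- q) := :1 :- :1) ≡.refl qP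
    qint-cyc (suc k) = lin₂ 1# (1# - qP) (qint-cyc k) (reflexive (^P≡pw qP k))
      (solve 4 (λ q i x y → (i :+ y) :* (:1 :- q) :- (:1 :- x :* q) := :1 :* (i :* (:1 :- q) :- (:1 :- x)) :+ (:1 :- q) :* (y :- x)) ≡.refl
        qP (qintPoly k) (Q k) (qP ^P k))

    modulus≡ : modulus n ≡ qintPoly n * prod ℓa n * diff ℓa n * prod ℓb n * diff ℓb n
    modulus≡ = cong (λ x → qintPoly n *P (oneP -P aP *P x) *P (aP -P x) *P (oneP -P bP *P x) *P (bP -P x)) (^P≡pw qP n)

    good⇒coprime : ∀ {s} → Good s → CoprimeP s (modulus n)
    good⇒coprime {s} g = subst (CoprimeP s) (≡.sym modulus≡) (coprime s (t₃ * diff ℓb n) λ v →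
      elim-*ʳ {v} {s} {t₃} {diff ℓb n} (elim-*ʳ {v} {s} {t₂} {prod ℓb n} (elim-*ʳ {v} {s} {t₁} {diff ℓa n}
        (elim-*ʳ {v} {s} {qintPoly n} {prod ℓa n} (elim-∣ʳ (1# - qP) (qint-cyc n) (g v cycF)) (g v (prodF ℓa)))
        (g v (diffF ℓa))) (g v (prodF ℓb))) (g v (diffF ℓb)))
      where
      t₁ t₂ t₃ : Poly
      t₁ = qintPoly n * prod ℓa n
      t₂ = t₁ * diff ℓa n
      t₃ = t₂ * prod ℓb n

-- Saturated ideals and the reduction to roots of unity

module Ideals where

  open PolynomialRing
  open Coprimality
  open ≡ using (refl; cong; subst)
  open CommutativeRing polyRing using (_≈_; _+_; _*_; -_; _-_; 0#; 1#; trans; sym; reflexive; *-comm; *-cong)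
    renaming (refl to ≈-refl)
  open RingReasoning polyRing
  open Powers polyRing
  open Formulas _+P_ _*P_ negP zeroP oneP

  module OddIdeal (h : ℕ) where
    open Odd h

    -- Saturated: factors coprime to the modulus may be cancelled.
    record SaturatedIdeal : Set₁ where
      field
        mem      : Poly → Set
        mem-0    : mem 0#
        mem-+    : ∀ {x y} → mem x → mem y → mem (x + y)
        mem-*    : ∀ r {x} → mem x → mem (r * x)
        mem-≈    : ∀ {x y} → x ≈ y → mem x → mem y
        saturate : ∀ {s x} → Good s → mem (s * x) → mem x

      mem-lin : ∀ {x y} a {z} → mem x → mem y → z ≈ a * x + y → mem z
      mem-lin a m m′ e = mem-≈ (sym e) (mem-+ (mem-* a m) m′)

      mem-lin₁ : ∀ {x} a {z} → mem x → z ≈ a * x → mem z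
      mem-lin₁ a m e = mem-≈ (sym e) (mem-* a m)

      infix 4 _≈ᴶ_
      record _≈ᴶ_ (x y : Poly) : Set where
        constructor congruent
        field
          difference : mem (x - y)
      open _≈ᴶ_ public

      ≈⇒≈ᴶ : ∀ {x y} → x ≈ y → x ≈ᴶ y
      ≈⇒≈ᴶ {x} {y} e = congruent (mem-≈ (sym (lin₁ 1# e (solve 2 (λ x y → x :- y :- :0 := :1 :* (x :- y)) ≡.refl x y))) mem-0)

      -- Carrier and operations are those of the polynomial ring and only the equality is coarser,
      -- so formulas and proved identities carry over without a homomorphism.
      quotient : CommutativeRing 0ℓ 0ℓ
      quotient = record
        { Carrier = Poly ; _≈_ = _≈ᴶ_ ; _+_ = _+P_ ; _*_ = _*P_ ; -_ = negP ; 0# = zeroP ; 1# = oneP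
        ; isCommutativeRing = record
          { isRing = record
            { +-isAbelianGroup = record
              { isGroup = record
                { isMonoid = record
                  { isSemigroup = record
                    { isMagma = record
                      { isEquivalence = record
                        { refl  = ≈⇒≈ᴶ ≈-refl
                        ; sym   = λ {x} {y} e → congruent (mem-lin₁ (- 1#) (difference e)
                                    (solve 2 (λ x y → y :- x := (:- :1) :* (x :- y)) ≡.refl x y))
                        ; trans = λ {x} {y} {z} e f → congruent (mem-lin 1# (difference e) (difference f)
                                    (solve 3 (λ x y z → x :- z := :1 :* (x :- y) :+ (y :- z)) ≡.refl x y z)) }
                      ; ∙-cong = λ {x} {y} {z} {w} e f → congruent (mem-lin 1# (difference e) (difference f)
                                    (solve 4 (λ x y z w → x :+ z :- (y :+ w) := :1 :* (x :- y) :+ (z :- w)) ≡.refl x y z w)) }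
                    ; assoc = λ x y z → ≈⇒≈ᴶ (+-assoc x y z) }
                  ; identity = (λ x → ≈⇒≈ᴶ (+-identityˡ x)) , (λ x → ≈⇒≈ᴶ (+-identityʳ x)) }
                ; inverse = (λ x → ≈⇒≈ᴶ (-‿inverseˡ x)) , (λ x → ≈⇒≈ᴶ (-‿inverseʳ x))
                ; ⁻¹-cong = λ {x} {y} e → congruent (mem-lin₁ (- 1#) (difference e)
                                    (solve 2 (λ x y → :- x :- :- y := (:- :1) :* (x :- y)) ≡.refl x y)) }
              ; comm = λ x y → ≈⇒≈ᴶ (+-comm x y) }
            ; *-cong = λ {x} {y} {z} {w} e f → congruent (mem-lin z (difference e) (mem-* y (difference f))
                                    (solve 4 (λ x y z w → x :* z :- y :* w := z :* (x :- y) :+ y :* (z :- w)) ≡.refl x y z w))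
            ; *-assoc = λ x y z → ≈⇒≈ᴶ (*-assoc x y z)
            ; *-identity = (λ x → ≈⇒≈ᴶ (*-identityˡ x)) , (λ x → ≈⇒≈ᴶ (*-identityʳ x))
            ; distrib = (λ x y z → ≈⇒≈ᴶ (distribˡ x y z)) , (λ x y z → ≈⇒≈ᴶ (distribʳ x y z)) }
          ; *-comm = λ x y → ≈⇒≈ᴶ (*-comm x y) } }
        where open CommutativeRing polyRing using (+-assoc; +-identityˡ; +-identityʳ; -‿inverseˡ; -‿inverseʳ; +-comm; *-assoc; *-identityˡ; *-identityʳ; distribˡ; distribʳ)

      -- Invertible up to a factor coprime to the modulus; unlike regularity, this passes to larger ideals.
      Unit : Poly → Set
      Unit c = ∃ λ s → ∃ λ v → Good s × mem (s - v * c)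

      unit-cancel : ∀ {c x} → Unit c → mem (c * x) → mem x
      unit-cancel {c} {x} (s , v , g , m) e = saturate g (mem-lin x m (mem-* v e)
        (solve 4 (λ s v c x → s :* x := x :* (s :- v :* c) :+ v :* (c :* x)) ≡.refl s v c x))

      mem-all : ∀ {c} → Unit c → mem c → ∀ x → mem x
      mem-all {c} u m x = unit-cancel u (mem-lin₁ x m (*-comm c x))

    open SaturatedIdeal

    generated : SaturatedIdeal
    generated = record
      { mem      = λ f → ∃ λ s → ∃ λ w → Good s × s * f ≈ qintPoly n * w
      ; mem-0    = 1# , 0# , good-1 , solve 1 (λ m → :1 :* :0 := m :* :0) ≡.refl (qintPoly n)
      ; mem-+    = λ {x} {y} (s , w , g , e) (s′ , w′ , g′ , e′) → s * s′ , s′ * w + s * w′ , good-* g g′ ,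
                     lin₂ s′ s e e′ (solve 7 (λ m x y s s′ w w′ → s :* s′ :* (x :+ y) :- m :* (s′ :* w :+ s :* w′)
                       := s′ :* (s :* x :- m :* w) :+ s :* (s′ :* y :- m :* w′)) ≡.refl (qintPoly n) x y s s′ w w′)
      ; mem-*    = λ r {x} (s , w , g , e) → s , r * w , g ,
                     lin₁ r e (solve 5 (λ m x s w r → s :* (r :* x) :- m :* (r :* w) := r :* (s :* x :- m :* w)) ≡.refl (qintPoly n) x s w r)
      ; mem-≈    = λ {x} {y} h (s , w , g , e) → s , w , g ,
                     lin₂ 1# (- s) e h (solve 5 (λ m x y s w → s :* y :- m :* w := :1 :* (s :* x :- m :* w) :+ (:- s) :* (x :- y)) ≡.refl (qintPoly n) x y s w)
      ; saturate = λ {t} {x} gt (s , w , g , e) → s * t , w , good-* g gt ,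
                     trans (solve 3 (λ s t x → s :* t :* x := s :* (t :* x)) ≡.refl s t x) e
      }

    extend : SaturatedIdeal → Poly → SaturatedIdeal
    extend J c = record
      { mem      = λ f → ∃ λ s → ∃ λ r → Good s × mem J (s * f - c * r)
      ; mem-0    = 1# , 0# , good-1 , mem-≈ J (solve 1 (λ c → :0 := :1 :* :0 :- c :* :0) ≡.refl c) (mem-0 J)
      ; mem-+    = λ {x} {y} (s , w , g , e) (s′ , w′ , g′ , e′) → s * s′ , s′ * w + s * w′ , good-* g g′ ,
                     mem-lin J s′ e (mem-* J s e′) (solve 7 (λ m x y s s′ w w′ → s :* s′ :* (x :+ y) :- m :* (s′ :* w :+ s :* w′)
                       := s′ :* (s :* x :- m :* w) :+ s :* (s′ :* y :- m :* w′)) ≡.refl c x y s s′ w w′)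
      ; mem-*    = λ r {x} (s , w , g , e) → s , r * w , g ,
                     mem-lin₁ J r e (solve 5 (λ m x s w r → s :* (r :* x) :- m :* (r :* w) := r :* (s :* x :- m :* w)) ≡.refl c x s w r)
      ; mem-≈    = λ {x} {y} h (s , w , g , e) → s , w , g ,
                     mem-≈ J (lin₁ s h (solve 5 (λ m x y s w → s :* x :- m :* w :- (s :* y :- m :* w) := s :* (x :- y)) ≡.refl c x y s w)) e
      ; saturate = λ {t} {x} gt (s , w , g , e) → s * t , w , good-* g gt ,
                     mem-≈ J (solve 5 (λ s t x c w → s :* (t :* x) :- c :* w := s :* t :* x :- c :* w) ≡.refl s t x c w) e
      }

    extend-⊇ : ∀ J c {x} → mem J x → mem (extend J c) x
    extend-⊇ J c {x} m = 1# , 0# , good-1 , mem-≈ J (solve 2 (λ x c → x := :1 :* x :- c :* :0) ≡.refl x c) m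

    extend-∋ : ∀ J c → mem (extend J c) c
    extend-∋ J c = 1# , 1# , good-1 , mem-≈ J (solve 1 (λ c → :0 := :1 :* c :- c :* :1) ≡.refl c) (mem-0 J)

    extend-unit : ∀ J c {x} → Unit J x → Unit (extend J c) x
    extend-unit J c (s , v , g , m) = s , v , g , extend-⊇ J c m

    geometric : ℕ → ℕ → Poly
    geometric j zero    = 0#
    geometric j (suc k) = geometric j k + pw (Q j) k

    geometric-* : ∀ j k → cyc j * geometric j k ≈ 1# - pw (Q j) k
    geometric-* j zero    = solve 1 (λ x → (:1 :- x) :* :0 := :1 :- :1) ≡.refl (Q j)
    geometric-* j (suc k) = lin₁ 1# (geometric-* j k)
      (solve 3 (λ x g p → (:1 :- x) :* (g :+ p) :- (:1 :- p :* x) := :1 :* ((:1 :- x) :* g :- (:1 :- p))) ≡.refl (Q j) (geometric j k) (pw (Q j) k))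

    -- Modulo 1 - q^j each of the k powers of q^j in the geometric sum is 1.
    geometric-nat : ∀ j k → ∃ λ v → nat k ≈ geometric j k + v * cyc j
    geometric-nat j zero    = 0# , solve 1 (λ x → :0 := :0 :+ :0 :* x) ≡.refl (cyc j)
    geometric-nat j (suc k) with geometric-nat j k | pw-difference (Q j) 1# k
    ... | v , e | g , d = v + g , lin₃ 1# (- 1#) (- 1#) e d (pw-1 k)
      (solve 7 (λ x ν γ p v g o → :1 :+ ν :- (γ :+ p :+ (v :+ g) :* (:1 :- x))
        := :1 :* (ν :- (γ :+ v :* (:1 :- x))) :+ (:- :1) :* (p :- o :- (x :- :1) :* g) :+ (:- :1) :* (o :- :1)) ≡.refl
        (Q j) (nat k) (geometric j k) (pw (Q j) k) v g (pw 1# k))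

    Q-* : ∀ j k → Q (k ℕ.* j) ≈ pw (Q j) k
    Q-* j k = sym (pw-pw qP j k)

    mem-cyc-* : ∀ J j k → mem J (cyc j) → mem J (cyc (k ℕ.* j))
    mem-cyc-* J j k m = mem-≈ J (trans (geometric-* j k) (lin₁ 1# (Q-* j k)
        (solve 2 (λ p r → :1 :- p :- (:1 :- r) := :1 :* (r :- p)) ≡.refl (pw (Q j) k) (Q (k ℕ.* j)))))
      (mem-lin₁ J (geometric j k) m (*-comm (cyc j) (geometric j k)))

    UnitsBelow : SaturatedIdeal → ℕ → Set
    UnitsBelow J j = ∀ i → 0 < i → i < j → Unit J (cyc i)

    -- In the quotient by J, q has exact order m: 1 - q^m is zero and the smaller 1 - q^i are
    -- invertible up to good factors. J is quantified because the case distinctions enlarge it.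
    RootCase : Poly → Set₁
    RootCase f = ∀ J m → 1 < m → m ∣ n → mem J (cyc m) → UnitsBelow J m → mem J f

    unitsBelow-suc : ∀ {J j} → UnitsBelow J j → Unit J (cyc j) → UnitsBelow J (suc j)
    unitsBelow-suc {J} {j} b u i i>0 (s≤s i≤j) with ℕₚ.<-cmp i j
    ... | tri< i<j _ _    = b i i>0 i<j
    ... | tri≈ _ refl _   = u
    ... | tri> _ _ j<i    = contradiction i≤j (ℕₚ.<⇒≱ j<i)

    -- A nonzero remainder r of n modulo m puts the invertible element 1 - q^r into J, which then
    -- contains everything. Otherwise m divides n and the root case applies.
    exact-order : ∀ {f} → RootCase f → ∀ J m → mem J (cyc n) → 1 < m → mem J (cyc m) → UnitsBelow J m → mem J f
    exact-order {f} H J m@(suc m-1) cn 1<m cm b with n % m in e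
    ... | zero  = H J m 1<m (divides (n ℕ./ m) (≡.trans (m≡m%n+[m/n]*n n m) (cong (ℕ._+ (n ℕ./ m) ℕ.* m) e))) cm b
    ... | suc r = mem-all J (b (suc r) (s≤s z≤n) (subst (_< m) e (m%n<n n m))) residue f
      where
      k = n ℕ./ m
      n≡ : n ≡ suc r ℕ.+ k ℕ.* m
      n≡ = ≡.trans (m≡m%n+[m/n]*n n m) (cong (ℕ._+ k ℕ.* m) e)
      residue : mem J (cyc (suc r))
      residue = mem-lin J (- Q (suc r)) (mem-cyc-* J m k cm) (subst (λ i → mem J (cyc i)) n≡ cn)
        (lin₁ 1# (pw-+ qP (suc r) (k ℕ.* m))
          (solve 3 (λ x y z → :1 :- x :- ((:- x) :* (:1 :- y) :+ (:1 :- z)) := :1 :* (z :- x :* y)) ≡.refl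
            (Q (suc r)) (Q (k ℕ.* m)) (Q (suc r ℕ.+ k ℕ.* m))))

    -- With C = 1 - q^j and N the geometric sum, C N lies in J and k = N + v C. So membership modulo
    -- C and modulo N yields membership up to the good factor k.
    combine : ∀ J j k f → 0 < k → mem J (cyc (k ℕ.* j)) → mem (extend J (cyc j)) f → mem (extend J (geometric j k)) f → mem J f
    combine J j (suc k) f _ c (s , x , g , e) (s′ , y , g′ , e′) =
      saturate J (good-* (good-nat k) (good-* g g′)) (mem-lin J (s′ * N) e (mem-lin J (v * s * C) e′ (mem-lin J (x * s′ + v * s * y) CN (mem-0 J) ≈-refl) ≈-refl)
        (lin₁ (s * s′ * f) ν (solve 11 (λ ν N v C s s′ f x y p o →
          ν :* (s :* s′) :* f :- (s′ :* N :* (s :* f :- C :* x) :+ (v :* s :* C :* (s′ :* f :- N :* y) :+ ((x :* s′ :+ v :* s :* y) :* (C :* N) :+ :0)))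
          := s :* s′ :* f :* (ν :- (N :+ v :* C))) ≡.refl (nat (suc k)) N v C s s′ f x y 0# 0#)))
      where
      N = geometric j (suc k)
      C = cyc j
      v = proj₁ (geometric-nat j (suc k))
      ν = proj₂ (geometric-nat j (suc k))
      CN : mem J (C * N)
      CN = mem-≈ J (lin₂ (- 1#) (- 1#) (Q-* j (suc k)) (geometric-* j (suc k))
        (solve 4 (λ C N p r → :1 :- r :- C :* N := (:- :1) :* (r :- p) :+ (:- :1) :* (C :* N :- (:1 :- p))) ≡.refl C N (pw (Q j) (suc k)) (Q (suc k ℕ.* j)))) c

    qint-nat : ∀ k → ∃ λ v → nat k ≈ qintPoly k + v * (1# - qP)
    qint-nat zero    = 0# , solve 1 (λ x → :0 := :0 :+ :0 :* x) ≡.refl (1# - qP)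
    qint-nat (suc k) with qint-nat k | pw-difference qP 1# k
    ... | v , e | g , d = v + g , lin₃ 1# (- 1#) 1# e hd (reflexive (≡.sym (^P≡pw qP k)))
      (solve 7 (λ q ν ι p p′ v g → :1 :+ ν :- (ι :+ p′ :+ (v :+ g) :* (:1 :- q))
        := :1 :* (ν :- (ι :+ v :* (:1 :- q))) :+ (:- :1) :* (p :- :1 :- (q :- :1) :* g) :+ :1 :* (p :- p′)) ≡.refl
        qP (nat k) (qintPoly k) (Q k) (qP ^P k) v g)
      where
      hd : Q k - 1# ≈ (qP - 1#) * g
      hd = lin₂ 1# 1# d (pw-1 k) (solve 4 (λ q p o g → p :- :1 :- (q :- :1) :* g := :1 :* (p :- o :- (q :- :1) :* g) :+ :1 :* (o :- :1)) ≡.refl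
        qP (Q k) (pw 1# k) g)

    -- Adjoining 1 - q^j makes j the exact order; adjoining the geometric sum instead makes 1 - q^j
    -- invertible, because n is. At j = n the element 1 - q^n is in J already.
    search : ∀ {f} → RootCase f → ∀ fuel j J → fuel ℕ.+ j ≡ n → 1 < j → mem J (cyc n) → UnitsBelow J j → mem J f
    search H zero    j J refl 1<j c b = exact-order H J j c 1<j c b
    search {f} H (suc l) j J e 1<j c b = combine J j n f (s≤s z≤n)
        (subst (λ i → mem J (cyc i)) (ℕₚ.*-comm j n) (mem-cyc-* J n j c))
        (exact-order H J₁ j (extend-⊇ J (cyc j) c) 1<j (extend-∋ J (cyc j)) (λ i p r → extend-unit J (cyc j) (b i p r)))
        (search H l (suc j) J₂ (≡.trans (ℕₚ.+-suc l j) e) (ℕₚ.m<n⇒m<1+n 1<j) (extend-⊇ J N c)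
          (unitsBelow-suc {J₂} {j} (λ i p r → extend-unit J N (b i p r)) unit))
      where
      N  = geometric j n
      J₁ = extend J (cyc j)
      J₂ = extend J N
      unit : Unit J₂ (cyc j)
      unit = nat n , proj₁ (geometric-nat j n) , good-nat (h ℕ.+ h) ,
        mem-≈ J₂ (lin₁ (- 1#) (proj₂ (geometric-nat j n))
          (solve 4 (λ N ν v C → N :- (ν :- v :* C) := (:- :1) :* (ν :- (N :+ v :* C))) ≡.refl N (nat n) (proj₁ (geometric-nat j n)) (cyc j)))
          (extend-∋ J N)

    root-of-unity : ∀ {f} → RootCase f → mem generated f
    root-of-unity {f} H = start h refl
      where
      J  = generated
      N  = geometric 1 n
      J₁ = extend J (cyc 1)
      J₂ = extend J N
      [n] : mem J (qintPoly n)
      [n] = 1# , 1# , good-1 , *-comm 1# (qintPoly n)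
      c : mem J (cyc n)
      c = mem-≈ J (qint-cyc n) (mem-lin₁ J (1# - qP) [n] (*-comm (qintPoly n) (1# - qP)))
      -- Modulo 1 - q the polynomial [n] becomes n, so this extension contains everything; that is
      -- why only orders m > 1 remain.
      f₁ : mem J₁ f
      f₁ = saturate J₁ (good-nat (h ℕ.+ h)) (mem-lin J₁ f (extend-⊇ J (cyc 1) [n])
        (mem-* J₁ (f * proj₁ (qint-nat n)) (extend-∋ J (cyc 1)))
        (lin₁ f (proj₂ (qint-nat n)) (solve 5 (λ ν f ι v q → ν :* f :- (f :* ι :+ f :* v :* (:1 :- :1 :* q)) := f :* (ν :- (ι :+ v :* (:1 :- q)))) ≡.refl
          (nat n) f (qintPoly n) (proj₁ (qint-nat n)) qP)))
      unit : Unit J₂ (cyc 1)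
      unit = nat n , proj₁ (geometric-nat 1 n) , good-nat (h ℕ.+ h) ,
        mem-≈ J₂ (lin₁ (- 1#) (proj₂ (geometric-nat 1 n))
          (solve 4 (λ N ν v C → N :- (ν :- v :* C) := (:- :1) :* (ν :- (N :+ v :* C))) ≡.refl N (nat n) (proj₁ (geometric-nat 1 n)) (cyc 1)))
          (extend-∋ J N)
      below : UnitsBelow J₂ 2
      below (suc zero)    _ _             = unit
      below (suc (suc i)) _ (s≤s (s≤s ()))
      start : ∀ h′ → h′ ≡ h → mem J f
      -- Here n = 1 and [n] = 1.
      start zero     refl = 1# , f , good-1 , ≈-refl
      start (suc h′) refl = combine J 1 n f (s≤s z≤n)
        (subst (λ i → mem J (cyc i)) (ℕₚ.*-comm 1 n) (mem-cyc-* J n 1 c)) f₁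
        (search H (h′ ℕ.+ suc h′) 2 J₂ (ℕₚ.+-comm (h′ ℕ.+ suc h′) 2) (s≤s (s≤s z≤n)) (extend-⊇ J N c) below)

-- The sum modulo [n]

module RootsOfUnity where

  open PolynomialRing
  open LeadingTerms
  open Elimination
  open Coprimality
  open Ideals
  open ≡ using (refl; cong; subst)
  open CommutativeRing polyRing using (_+_; _*_; -_; _-_; 0#; 1#; trans; sym)
  open RingReasoning polyRing
  open Reduction polyRing using (parity)
  open Formulas _+P_ _*P_ negP zeroP oneP

  deg-Q : ∀ k → deg vq (k ⊠ qₑ) ≡ k
  deg-Q k = ≡.trans (deg-⊠ vq k qₑ) (ℕₚ.*-identityʳ k)

  parity-nonZero : ∀ i j → NonZero (Q (i ℕ.+ i) - Q (suc (j ℕ.+ j)))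
  parity-nonZero i j = monos-nonZero vq ((i ℕ.+ i) ⊠ qₑ) (suc (j ℕ.+ j) ⊠ qₑ)
    (lin₂ 1# (- 1#) (Q-mono (i ℕ.+ i)) (Q-mono (suc (j ℕ.+ j)))
      (solve 4 (λ x y z w → x :- y :- (z :- w) := :1 :* (x :- z) :+ (:- :1) :* (y :- w)) ≡.refl
        (Q (i ℕ.+ i)) (Q (suc (j ℕ.+ j))) (mono ((i ℕ.+ i) ⊠ qₑ)) (mono (suc (j ℕ.+ j) ⊠ qₑ))))
    λ p → even≢odd i j (≡.trans (≡.sym (deg-Q (i ℕ.+ i))) (≡.trans p (deg-Q (suc (j ℕ.+ j)))))

  letter−Q-nonZero : ∀ y i j → NonZero (letter y * Q i - Q j)
  letter−Q-nonZero y i j = monos-nonZero (var-of y) (expo y ⊞ (i ⊠ qₑ)) (j ⊠ qₑ)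
    (lin₂ (letter y) (- 1#) (Q-mono i) (Q-mono j)
      (solve 5 (λ y x z v w → y :* x :- z :- (y :* v :- w) := y :* (x :- v) :+ (:- :1) :* (z :- w)) ≡.refl
        (letter y) (Q i) (Q j) (mono (i ⊠ qₑ)) (mono (j ⊠ qₑ))))
    λ p → contradiction (≡.trans (≡.sym (≡.trans (deg-⊞-+ (var-of y) (expo y) (i ⊠ qₑ)) (cong (ℕ._+ deg (var-of y) (i ⊠ qₑ)) (deg-letter y))))
      (≡.trans p (deg-letter-q y j))) λ ()

  module Identities = Evaluation.Generic polyRing qP aP bP
    (nonZero⇒reg {qP} (lead-nonZero {qP} _ qₑ _ (λ ()) All.[] (λ i j k → refl)))
    (λ i → nonZero⇒reg {cyc (suc i)} (cyc-nonZero i))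
    (λ i j → nonZero⇒reg {Q (i ℕ.+ i) - Q (suc (j ℕ.+ j))} (parity-nonZero i j))
    (λ i j → nonZero⇒reg {aP * Q i - Q j} (letter−Q-nonZero ℓa i j))
    (λ i j → nonZero⇒reg {bP * Q i - Q j} (letter−Q-nonZero ℓb i j))


  -- For n = (2i + 1) m the sum up to h = (n - 1)/2 has i m + (h′ + 1) terms: i full blocks and the
  -- first h′ + 1 terms of another, past which the terms of a block vanish.
  odd-factor : ∀ h k m → suc (h ℕ.+ h) ≡ k ℕ.* m → ∃ λ i → ∃ λ h′ → k ≡ suc (i ℕ.+ i) × m ≡ suc (h′ ℕ.+ h′) × h ≡ h′ ℕ.+ i ℕ.* m
  odd-factor h k m e with parity k | parity m
  ... | i , inj₁ refl | _ = contradiction (≡.sym (≡.trans e (ℕₚ.*-distribʳ-+ m i i))) (even≢odd (i ℕ.* m) h)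
  ... | i , inj₂ refl | j , inj₁ refl =
    contradiction (≡.sym (≡.trans e (ℕₚ.*-distribˡ-+ k j j))) (even≢odd (k ℕ.* j) h)
  ... | i , inj₂ refl | h′ , inj₂ refl = i , h′ , refl , refl ,
    ℕₚ.*-cancelˡ-≡ h (h′ ℕ.+ i ℕ.* m) 2 (ℕₚ.suc-injective (≡.trans (cong (λ x → suc (h ℕ.+ x)) (ℕₚ.+-identityʳ h))
      (≡.trans e (S.solve 2 (λ i j → let m = S.con 1 S.:+ (j S.:+ j) in
         (S.con 1 S.:+ (i S.:+ i)) S.:* m S.:= S.con 1 S.:+ S.con 2 S.:* (j S.:+ i S.:* m)) refl i h′))))

  module _ (h : ℕ) where
    open Odd h
    open OddIdeal h
    open SaturatedIdeal using (mem; congruent; difference; quotient; ≈⇒≈ᴶ; unit-cancel; saturate; mem-≈; mem-lin₁)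

    U : ℕ → Poly
    U = Reduced.U qP aP bP

    module OrderCase (J : SaturatedIdeal) (h′ : ℕ) (cm : mem J (cyc (suc (h′ ℕ.+ h′))))
      (units : UnitsBelow J (suc (h′ ℕ.+ h′))) (h′>0 : 0 < h′) where

      private
        module M = RingReasoning (quotient J)

      zero⇒mem : ∀ {x} → mem J (x - 0#) → mem J x
      zero⇒mem {x} = mem-≈ J (solve 1 (λ x → x :- :0 := x) ≡.refl x)

      mem⇒zero : ∀ {x} → mem J x → mem J (x - 0#)
      mem⇒zero {x} = mem-≈ J (solve 1 (λ x → x := x :- :0) ≡.refl x)

      good⇒reg : ∀ {x} → Good x → M.Reg x
      good⇒reg g e = congruent (mem⇒zero (saturate J g (zero⇒mem (difference e))))

      open Reduction.Periodic (quotient J) qP aP bP h′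
        (congruent (mem-lin₁ J (- 1#) cm (solve 1 (λ x → x :- :1 := (:- :1) :* (:1 :- x)) ≡.refl (Q (suc (h′ ℕ.+ h′))))))
        (λ j j>0 j<m e → congruent (mem⇒zero (unit-cancel J (units j j>0 j<m) (zero⇒mem (difference e)))))
        (good⇒reg (good-nat 1))
        h′>0

      open Blocks (FirstBlock.first-block-vanishes
        (λ j → good⇒reg (good-* (good-diff ℓa j) (good-prod ℓa j)))
        (λ j → good⇒reg (good-* (good-diff ℓb j) (good-prod ℓb j)))
        -- The evaluation is proved in ℤ[q, a, b], where its denominators are regular, and only then
        -- read modulo J.
        (≈⇒≈ᴶ J (Identities.SumC.last-term h′)))

      multiple : ∀ i → mem J (U (i ℕ.* suc (h′ ℕ.+ h′)))
      multiple i = zero⇒mem (difference (U-multiple i))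

      half : ∀ i → mem J (U (suc h′ ℕ.+ i ℕ.* suc (h′ ℕ.+ h′)))
      half i = zero⇒mem (difference (U-half i))

    positive : ∀ h′ → 1 < suc (h′ ℕ.+ h′) → 0 < h′
    positive (suc h′) _ = s≤s z≤n
    positive zero (s≤s ())

    full-sum : mem generated (U n)
    full-sum = root-of-unity case
      where
      case : RootCase (U n)
      case J m 1<m (divides k e) cm units with odd-factor h k m e
      ... | i , h′ , refl , refl , _ = subst (λ j → mem J (U j)) (≡.sym e) (OrderCase.multiple J h′ cm units (positive h′ 1<m) k)

    half-sum : mem generated (U (suc h))
    half-sum = root-of-unity case
      where
      case : RootCase (U (suc h))
      case J m 1<m (divides k e) cm units with odd-factor h k m e
      ... | i , h′ , refl , refl , e′ = subst (λ j → mem J (U (suc j))) (≡.sym e′) (OrderCase.half J h′ cm units (positive h′ 1<m) i)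

-- From formal fractions to chosen numerators and denominators

module Fractions where

  open PolynomialRing
  open CommutativeRing polyRing using (_≈_; _+_; _*_; -_; _-_; 0#; 1#; sym)
    renaming (refl to ≈-refl)
  open RingReasoning polyRing
  open Powers polyRing
  open Reduction polyRing
  open Pochhammer polyRing
  open Formulas _+P_ _*P_ negP zeroP oneP

  infix 4 _represents_/_
  -- The fractions of the statement carry unreduced numerators and denominators; the
  -- cross-multiplied relation lets a reduced pair stand for them.
  record _represents_/_ (x : Frac) (u d : Poly) : Set where
    constructor represent
    field
      cross : num x * d ≈ u * den x
  open _represents_/_ public

  rep-cong : ∀ {x u u′ d d′} → u ≈ u′ → d ≈ d′ → x represents u / d → x represents u′ / d′
  rep-cong {x} {u} {u′} {d} {d′} e f (represent c) = represent (lin₃ 1# (den x) (- num x) c e f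
    (solve 6 (λ n m u u′ d d′ → n :* d′ :- u′ :* m := :1 :* (n :* d :- u :* m) :+ m :* (u :- u′) :+ (:- n) :* (d :- d′)) ≡.refl (num x) (den x) u u′ d d′))

  -- The rule by which common factors are cancelled: regularity of the old denominator is its price.
  rep-change : ∀ {x u u′ d d′} → Reg d → u * d′ ≈ u′ * d → x represents u / d → x represents u′ / d′
  rep-change {x} {u} {u′} {d} {d′} r e (represent c) = represent (cancel {d} {num x * d′} {u′ * den x} r (lin₂ d′ (den x) c e
    (solve 6 (λ n m u u′ d d′ → d :* (n :* d′) :- d :* (u′ :* m) := d′ :* (n :* d :- u :* m) :+ m :* (u :* d′ :- u′ :* d)) ≡.refl (num x) (den x) u u′ d d′)))

  rep-scale : ∀ {x u d} c → x represents u / d → x represents u * c / (d * c)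
  rep-scale {x} {u} {d} c (represent e) = represent (lin₁ c e
    (solve 5 (λ n m u d c → n :* (d :* c) :- u :* c :* m := c :* (n :* d :- u :* m)) ≡.refl (num x) (den x) u d c))

  rep-fromP : ∀ p → fromP p represents p / 1#
  rep-fromP p = represent ≈-refl

  rep-one : oneF represents 1# / 1#
  rep-one = rep-fromP 1#

  rep-* : ∀ {x y u v d e} → x represents u / d → y represents v / e → (x *F y) represents u * v / (d * e)
  rep-* {x} {y} {u} {v} {d} {e} (represent p) (represent r) = represent (lin₂ (num y * e) (u * den x) p r
    (solve 8 (λ n m k l u v d e → n :* k :* (d :* e) :- u :* v :* (m :* l) := k :* e :* (n :* d :- u :* m) :+ u :* m :* (k :* e :- v :* l)) ≡.refl
      (num x) (den x) (num y) (den y) u v d e))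

  rep-/ : ∀ {x y u v d e} → x represents u / d → y represents v / e → (x /F y) represents u * e / (d * v)
  rep-/ {x} {y} {u} {v} {d} {e} (represent p) (represent r) = represent (lin₂ (den y * v) (- (u * den x)) p r
    (solve 8 (λ n m k l u v d e → n :* l :* (d :* v) :- u :* e :* (m :* k) := l :* v :* (n :* d :- u :* m) :+ (:- (u :* m)) :* (k :* e :- v :* l)) ≡.refl
      (num x) (den x) (num y) (den y) u v d e))

  rep-+ : ∀ {x y u v d e} → x represents u / d → y represents v / e → (x +F y) represents u * e + v * d / (d * e)
  rep-+ {x} {y} {u} {v} {d} {e} (represent p) (represent r) = represent (lin₂ (den y * e) (den x * d) p r
    (solve 8 (λ n m k l u v d e → (n :* l :+ k :* m) :* (d :* e) :- (u :* e :+ v :* d) :* (m :* l) := l :* e :* (n :* d :- u :* m) :+ m :* d :* (k :* e :- v :* l)) ≡.refl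
      (num x) (den x) (num y) (den y) u v d e))

  rep-+-common : ∀ {x y u v d} → x represents u / d → y represents v / d → (x +F y) represents u + v / d
  rep-+-common {x} {y} {u} {v} {d} (represent p) (represent r) = represent (lin₂ (den y) (den x) p r
    (solve 7 (λ n m k l u v d → (n :* l :+ k :* m) :* d :- (u :+ v) :* (m :* l) := l :* (n :* d :- u :* m) :+ m :* (k :* d :- v :* l)) ≡.refl
      (num x) (den x) (num y) (den y) u v d))

  rep-−-common : ∀ {x y u v d} → x represents u / d → y represents v / d → (x -F y) represents u - v / d
  rep-−-common {x} {y} {u} {v} {d} (represent p) (represent r) = represent (lin₂ (den y) (- den x) p r
    (solve 7 (λ n m k l u v d → (n :* l :- k :* m) :* d :- (u :- v) :* (m :* l) := l :* (n :* d :- u :* m) :+ (:- m) :* (k :* d :- v :* l)) ≡.refl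
      (num x) (den x) (num y) (den y) u v d))

  rep-*₁ : ∀ {x y u v} → x represents u / 1# → y represents v / 1# → (x *F y) represents u * v / 1#
  rep-*₁ {x} {y} {u} {v} p r = rep-cong {x *F y} (≈-refl {u * v}) (solve 0 (:1 :* :1 := :1) ≡.refl) (rep-* p r)

  rep-/₁ : ∀ {x y u v} → x represents u / 1# → y represents v / 1# → (x /F y) represents u / v
  rep-/₁ {x} {y} {u} {v} p r = rep-cong {x /F y} (solve 1 (λ x → x :* :1 := x) ≡.refl u) (solve 1 (λ x → :1 :* x := x) ≡.refl v) (rep-/ p r)

  rep-^ : ∀ {x u} → x represents u / 1# → ∀ k → (x ^F k) represents pw u k / 1#
  rep-^ p zero    = rep-one
  rep-^ p (suc k) = rep-*₁ (rep-^ p k) p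

  rep-poch : ∀ {x s u d t} → x represents u / d → s represents t / 1# → ∀ k → poch x s k represents pochhammer u d t k / pw d k
  rep-poch p r zero    = rep-one
  rep-poch {x} {s} {u} {d} {t} p r (suc k) = rep-* (rep-poch p r k)
    (rep-−-common (rep-cong {oneF} (solve 1 (λ x → :1 :* x := x) ≡.refl d) (solve 1 (λ x → :1 :* x := x) ≡.refl d) (rep-scale d rep-one))
      (rep-cong {x *F (s ^F k)} (≈-refl {u * pw t k}) (solve 1 (λ x → x :* :1 := x) ≡.refl d) (rep-* p (rep-^ r k))))

  rep-sum : ∀ {f : ℕ → Frac} (w P δ : ℕ → Poly) → (∀ k → f k represents w k * P k / ∏ δ k) →
    ∀ M → sumTo f M represents hor w P δ (suc M) / ∏ δ (suc M)
  rep-sum w P δ h zero    = rep-cong (solve 2 (λ t d → t :* d := (:0 :+ t) :* d) ≡.refl (w 0 * P 0) (δ 0)) ≈-refl (rep-scale (δ 0) (h 0))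
  rep-sum w P δ h (suc M) = rep-scale (δ (suc M)) (rep-+-common (rep-sum w P δ h M) (h (suc M)))

  -- The coprime witness is D E M, from reduced denominators. The formal denominators of X and Y
  -- could not serve: in the theorem they can share factors with the modulus.
  congF : ∀ X Y {U D V E P} M N → X represents U / D → Y represents V / E → CoprimeP (D * E * M) P →
    (U * E - V * D) * M ≈ P * N → CongF X Y P
  congF X Y {U} {D} {V} {E} {P} M N (represent x) (represent y) c h = N , D * E * M , c , at goal
    where
    goal : (num X * den Y - num Y * den X) * (D * E * M) ≈ P * N * (den X * den Y)
    goal = lin₃ (den Y * E * M) (- (den X * D * M)) (den X * den Y) x y h
      (solve 10 (λ n m k l U D V E M PN → (n :* l :- k :* m) :* (D :* E :* M) :- PN :* (m :* l)
        := l :* E :* M :* (n :* D :- U :* m) :+ (:- (m :* D :* M)) :* (k :* E :- V :* l) :+ m :* l :* ((U :* E :- V :* D) :* M :- PN)) ≡.refl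
        (num X) (den X) (num Y) (den Y) U D V E M (P * N))

  module _ {qf af bf : Frac} {q a b : Poly} (rq : qf represents q / 1#) (ra : af represents a / 1#) (rb : bf represents b / 1#)
    (reg-1−q : Reg (1# - q)) (reg-a : Reg a) (reg-b : Reg b) where

    open Reduced q a b

    -- The shape of `lhsTerm` over abstract fractions, known only through what they represent; at q,
    -- a, b it is `lhsTerm` by definition.
    term : ℕ → Frac
    term k =
      (oneF -F qf ^F (6 ℕ.* k ℕ.+ 1)) /F (oneF -F qf)
      *F (poch (af *F qf) (qf ^F 2) k *F poch (qf /F af) (qf ^F 2) k
          *F poch (qf ^F 2) (qf ^F 4) k *F poch (bf *F qf) (qf ^F 4) k
          *F poch (qf /F bf) (qf ^F 4) k)
      /F (poch (qf ^F 4) (qf ^F 4) k *F poch ((qf ^F 4) /F af) (qf ^F 4) k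
          *F poch (af *F (qf ^F 4)) (qf ^F 4) k
          *F poch ((qf ^F 2) /F bf) (qf ^F 2) k *F poch (bf *F (qf ^F 2)) (qf ^F 2) k)
      *F (qf ^F (2 ℕ.* k))

    rep-term : (∀ k → Reg (1# - K (suc k))) → (∀ k → Reg (oδ q a b (K k))) → ∀ k → term k represents W k * P k / D k
    rep-term reg-K reg-oδ k = rep-change {term k} {u} {W k * P k} {d} {D k}
        (reg-cong {α * β * (1# - q) * pd} {d} (sym den≈)
          (reg-* {α * β * (1# - q)} {pd} (reg-* {α * β} {1# - q} (reg-* {α} {β} (reg-pw k reg-a) (reg-pw k reg-b)) reg-1−q) reg-plain))
        (lin₃ (D k) (α * β) (- (W k * P k)) num≈ (term-form q a b reg-K k) den≈
          (solve 8 (λ u D w d c n f p → u :* D :- w :* d := D :* (u :- c :* n) :+ c :* (n :* D :- w :* (f :* p)) :+ (:- w) :* (d :- c :* f :* p)) ≡.refl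
            u (D k) (W k * P k) d (α * β) (x * pn * pw q (2 ℕ.* k)) (1# - q) pd))
        (rep-* (rep-/ (rep-* (rep-/₁ (rep-−-common rep-one (rep-^ rq (6 ℕ.* k ℕ.+ 1))) (rep-−-common rep-one rq)) numerators) denominators) (rep-^ rq (2 ℕ.* k)))
      where
      t² = rep-^ rq 2
      t⁴ = rep-^ rq 4
      numerators = rep-* (rep-* (rep-* (rep-* (rep-poch (rep-*₁ ra rq) t² k) (rep-poch (rep-/₁ rq ra) t² k)) (rep-poch t² t⁴ k)) (rep-poch (rep-*₁ rb rq) t⁴ k)) (rep-poch (rep-/₁ rq rb) t⁴ k)
      denominators = rep-* (rep-* (rep-* (rep-* (rep-poch t⁴ t⁴ k) (rep-poch (rep-/₁ t⁴ ra) t⁴ k)) (rep-poch (rep-*₁ ra t⁴) t⁴ k)) (rep-poch (rep-/₁ t² rb) t² k)) (rep-poch (rep-*₁ rb t²) t² k)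
      o = pw 1# k
      α = pw a k
      β = pw b k
      pn = plain-num q a b k
      pd = plain-den q a b k
      x = 1# - pw q (6 ℕ.* k ℕ.+ 1)
      u = x * pn * (o * α * o * β * o) * pw q (2 ℕ.* k)
      d = (1# - q) * (o * α * o * o * β) * pd * 1#
      num≈ : u ≈ α * β * (x * pn * pw q (2 ℕ.* k))
      num≈ = lin₁ (x * pn * pw q (2 ℕ.* k) * α * β * (o * o + o + 1#)) (pw-1 k)
        (solve 6 (λ x n o a b y → x :* n :* (o :* a :* o :* b :* o) :* y :- a :* b :* (x :* n :* y) := x :* n :* y :* a :* b :* (o :* o :+ o :+ :1) :* (o :- :1)) ≡.refl
          x pn o α β (pw q (2 ℕ.* k)))
      den≈ : d ≈ α * β * (1# - q) * pd
      den≈ = lin₁ ((1# - q) * pd * α * β * (o * o + o + 1#)) (pw-1 k)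
        (solve 5 (λ x n o a b → x :* (o :* a :* o :* o :* b) :* n :* :1 :- a :* b :* x :* n := x :* n :* a :* b :* (o :* o :+ o :+ :1) :* (o :- :1)) ≡.refl
          (1# - q) pd o α β)
      reg-plain : Reg pd
      reg-plain = reg-cong {∏ (λ j → oδ q a b (K j)) k} {pd} (sym (plain-den≈ q a b k)) (reg-∏ k λ j _ → reg-oδ j)

  module _ {qf xf yf : Frac} {q x y : Poly} (rq : qf represents q / 1#) (rx : xf represents x / 1#) (ry : yf represents y / 1#)
    (reg-1−q : Reg (1# - q)) (reg-x : Reg x) (reg-r : Reg ((y - x) * (1# - y * x))) where

    -- The length m is separated from n, because in `rhsPart` it is (n - 1)/4, which has to be
    -- rewritten to N.
    part : ℕ → ℕ → Frac
    part n m =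
      ((oneF -F xf *F qf ^F n) *F (xf -F qf ^F n)
         *F ((oneF -F oneF) -F oneF -F yf ^F 2 +F yf *F qf ^F n))
      /F ((yf -F xf) *F (oneF -F yf *F xf))
      *F ((poch (qf ^F 5) (qf ^F 4) m *F poch (xf *F qf ^F 2) (qf ^F 4) m
            *F poch ((qf ^F 2) /F xf) (qf ^F 4) m)
          /F (poch qf (qf ^F 4) m *F poch ((qf ^F 4) /F xf) (qf ^F 4) m
            *F poch (xf *F qf ^F 4) (qf ^F 4) m))

    rep-part : (∀ i → Reg (1# - q * pw (pw q 4) i)) → (∀ i → Reg (pair x (sq (pw (sq q) (suc i))))) →
      ∀ n m ι → (1# - q) * ι ≈ 1# - q * sq (pw (sq q) m) →
      part n m represents
        (1# - x * pw q n) * (x - pw q n) * (1# - 1# - 1# - y * y + y * pw q n) * (ι * ∏ (λ i → pair x (sq q * sq (pw (sq q) i))) m)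
        / ((y - x) * (1# - y * x) * ∏ (λ i → pair x (sq (pw (sq q) (suc i)))) m)
    rep-part reg-odd reg-y₄ n m ι hι = rep-change {part n m} {u} {u′} {d} {d′}
        (reg-* {r} {o * o * ξ * pd} reg-r (reg-* {o * o * ξ} {pd} (reg-* {o * o} {ξ} (reg-* {o} {o} reg-o reg-o) (reg-pw m reg-x)) reg-pd))
        (lin₁ (c * r * (o * ξ * o)) (product-form q x m ι reg-1−q hι)
          (solve 10 (λ x X y ι N D pn pd o ξ →
            let c = (:1 :- x :* X) :* (x :- X) :* (:1 :- :1 :- :1 :- :1 :* y :* y :+ y :* X)
                c′ = (:1 :- x :* X) :* (x :- X) :* (:1 :- :1 :- :1 :- y :* y :+ y :* X)
                r = (y :- x) :* (:1 :- y :* x) in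
            c :* (pn :* (o :* ξ :* o)) :* (r :* D) :- c′ :* (ι :* N) :* (r :* (o :* o :* ξ :* pd))
            := c :* r :* (o :* ξ :* o) :* (pn :* D :- ι :* N :* pd)) ≡.refl
            x (pw q n) y ι N D pn pd o ξ))
        (rep-* (rep-/₁ (rep-*₁ (rep-*₁ (rep-−-common rep-one (rep-*₁ rx t)) (rep-−-common rx t))
                   (rep-+-common (rep-−-common (rep-−-common (rep-−-common rep-one rep-one) rep-one) (rep-^ ry 2)) (rep-*₁ ry t)))
                 (rep-*₁ (rep-−-common ry rx) (rep-−-common rep-one (rep-*₁ ry rx))))
          (rep-/ (rep-* (rep-* (rep-poch (rep-^ rq 5) t⁴ m) (rep-poch (rep-*₁ rx t²) t⁴ m)) (rep-poch (rep-/₁ t² rx) t⁴ m))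
                 (rep-* (rep-* (rep-poch rq t⁴ m) (rep-poch (rep-/₁ t⁴ rx) t⁴ m)) (rep-poch (rep-*₁ rx t⁴) t⁴ m))))
      where
      t  = rep-^ rq n
      t² = rep-^ rq 2
      t⁴ = rep-^ rq 4
      o  = pw 1# m
      ξ  = pw x m
      X  = pw q n
      c  = (1# - x * X) * (x - X) * (1# - 1# - 1# - pw y 2 + y * X)
      r  = (y - x) * (1# - y * x)
      N  = ∏ (λ i → pair x (sq q * sq (pw (sq q) i))) m
      D  = ∏ (λ i → pair x (sq (pw (sq q) (suc i)))) m
      pn = product-num q x m
      pd = product-den q x m
      u  = c * (pn * (o * ξ * o))
      u′ = (1# - x * X) * (x - X) * (1# - 1# - 1# - y * y + y * X) * (ι * N)
      d  = r * (o * o * ξ * pd)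
      d′ = r * D
      reg-o : Reg o
      reg-o = reg-pw m reg-1
      pd≈ : pochhammer q 1# (pw q 4) m * D ≈ pd
      pd≈ = lin₁ (- g₁) (pairs-den q x m)
        (solve 4 (λ g₁ g₂ g₃ D → g₁ :* D :- g₁ :* g₂ :* g₃ := (:- g₁) :* (g₂ :* g₃ :- D)) ≡.refl
          g₁ (pochhammer (pw q 4) x (pw q 4) m) (pochhammer (x * pw q 4) 1# (pw q 4) m) D)
        where g₁ = pochhammer q 1# (pw q 4) m
      reg-pd : Reg pd
      reg-pd = reg-cong {pochhammer q 1# (pw q 4) m * D} {pd} pd≈
        (reg-* {pochhammer q 1# (pw q 4) m} {D} (reg-∏ m λ i _ → reg-odd i) (reg-∏ m λ i _ → reg-y₄ i))

-- Assembly for n = 4N + 1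

module Main where

  open PolynomialRing
  open LeadingTerms
  open Elimination
  open Coprimality
  open Ideals
  open RootsOfUnity using (module Identities; half-sum; full-sum)
  open Fractions
  open ≡ using (refl; cong; subst)
  open CommutativeRing polyRing using (_≈_; _+_; _*_; -_; _-_; 1#; trans; sym; *-comm; *-cong)
    renaming (refl to ≈-refl)
  open RingReasoning polyRing
  open Powers polyRing
  open Reduction polyRing
  open Combination polyRing
  open Formulas _+P_ _*P_ negP zeroP oneP

  open Reduced qP aP bP
  open Identities using (y₂; y₄; sum-a; sum-b)

  module _ (N : ℕ) where

    h = N ℕ.+ N

    open Odd h
    open OddIdeal h

    X ι Da Db Na Nb : Poly
    X  = Q n
    ι  = qintPoly n
    Da = ∏ (λ i → pair aP (y₄ i)) N
    Db = ∏ (λ i → pair bP (y₄ i)) N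
    Na = ∏ (λ i → pair aP (y₂ i)) N
    Nb = ∏ (λ i → pair bP (y₂ i)) N

    ι≈ : (1# - qP) * ι ≈ 1# - X
    ι≈ = trans (*-comm (1# - qP) ι) (qint-cyc n)

    qK²≈X : qP * sq (K N) ≈ X
    qK²≈X = lin₂ (qP * (K N + Q h)) (- qP) (K-pw qP N) (pw-+ qP h h)
      (solve 4 (λ q K p x → q :* (K :* K) :- x :* q := q :* (K :+ p) :* (K :- p) :+ (:- q) :* (x :- p :* p)) ≡.refl qP (K N) (Q h) (Q (h ℕ.+ h)))

    good-pair : ∀ y j {z} → z ≈ Q (j ℕ.+ j) → Good (pair (letter y) z)
    good-pair y j {z} e = good-cong {pair (letter y) (Q (j ℕ.+ j))} {pair (letter y) z} (pair-cong {letter y} (sym e)) (good-* (good-diff y j) (good-prod y j))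

    good-∏ : ∀ {f : ℕ → Poly} k → (∀ i → Good (f i)) → Good (∏ f k)
    good-∏ zero    g = good-1
    good-∏ (suc k) g = good-* (good-∏ k g) (g k)

    y₄≈ : ∀ i → y₄ i ≈ Q ((suc i ℕ.+ suc i) ℕ.+ (suc i ℕ.+ suc i))
    y₄≈ i = trans (*-cong (K-pw qP (suc i)) (K-pw qP (suc i))) (sym (pw-+ qP (suc i ℕ.+ suc i) (suc i ℕ.+ suc i)))

    -- The purpose of the reduced form: its denominators contain only 1 + q^(2j) and pairs with even
    -- powers of q.
    good-D : ∀ k → Good (D k)
    good-D k = good-∏ k λ i → good-* (good-* (good-1+K i) (good-1+K i)) (good-* (good-pair ℓa (suc i ℕ.+ suc i) (y₄≈ i)) (good-pair ℓb (suc i) (K-pw qP (suc i))))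
      where
      good-1+K : ∀ i → Good (1# + K (suc i))
      good-1+K i = good-cong (lin₁ (- 1#) (K-pw qP (suc i)) (solve 2 (λ x y → :1 :+ y :- (:1 :+ x) := (:- :1) :* (x :- y)) ≡.refl (K (suc i)) (Q (suc i ℕ.+ suc i)))) (good-1+Q i)

    r r′ : Poly
    r  = (bP - aP) * (1# - bP * aP)
    r′ = (aP - bP) * (1# - aP * bP)

    good-r′ : Good r′
    good-r′ = good-* good-a−b good-1−ab

    good-r : Good r
    good-r = good-∣ (- 1#) (solve 2 (λ a b → (b :- a) :* (:1 :- b :* a) :* (:- :1) := (a :- b) :* (:1 :- a :* b)) ≡.refl aP bP) good-r′

    nonZero-r′ : NonZero r′
    nonZero-r′ = nonZero-* {aP - bP} {1# - aP * bP} a−b-nonZero 1−ab-nonZero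

    nonZero-r : NonZero r
    nonZero-r z = nonZero-r′ (lin₁ (- 1#) z (solve 2 (λ a b → (a :- b) :* (:1 :- a :* b) :- :0 := (:- :1) :* ((b :- a) :* (:1 :- b :* a) :- :0)) ≡.refl aP bP))

    congruent-sums : ∀ M → SaturatedIdeal.mem generated (U (suc M)) →
      (U-a : Reduced.U qP X bP (suc M) * Db ≈ Reduced.D qP X bP (suc M) * (ι * Nb)) →
      (U-b : Reduced.U qP aP X (suc M) * Da ≈ Reduced.D qP aP X (suc M) * (ι * Na)) →
      (n ∸ 1) / 4 ≡ N →
      CongF (lhs M) (rhs n) (modulus n)
    congruent-sums M (s , w , good-s , e) U-a U-b quarter =
      congF (lhs M) (rhs n) {U (suc M)} {D (suc M)} {C.V} {C.E₂} {modulus n} C.multiplier (r′ * C.Z) left right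
        (good⇒coprime (good-* (good-* (good-D (suc M)) (good-* (good-* good-r good-Da) (good-* good-r′ good-Db)))
          (good-* (good-* (good-* (good-* (good-pair ℓa 0 ≈-refl) (good-pair ℓb 0 ≈-refl)) good-s) (good-* good-X good-r)) (good-* good-X (good-pw (suc M) good-X)))))
        (subst (λ m → (U (suc M) * C.E₂ - C.V * D (suc M)) * C.multiplier ≈ m * (r′ * C.Z)) (≡.sym modulus≡) C.congruence)
      where
      hA = sum-mod-a qP X aP bP (suc M) Db (ι * Nb) U-a
      hB = sum-mod-b qP X aP bP (suc M) Da (ι * Na) U-b
      module C = Congruence qP X aP bP ι (U (suc M)) (D (suc M)) Da Db Na Nb s w (pw X (suc M)) (proj₁ hA) (proj₁ hB) ι≈ (proj₂ hA) (proj₂ hB) e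
      good-X : Good X
      good-X = good-pw n good-q
      good-Da : Good Da
      good-Da = good-∏ N λ i → good-pair ℓa (suc i ℕ.+ suc i) (y₄≈ i)
      good-Db : Good Db
      good-Db = good-∏ N λ i → good-pair ℓb (suc i ℕ.+ suc i) (y₄≈ i)
      hι : (1# - qP) * ι ≈ 1# - qP * sq (K N)
      hι = lin₂ 1# 1# ι≈ qK²≈X (solve 4 (λ q i x y → (:1 :- q) :* i :- (:1 :- y) := :1 :* ((:1 :- q) :* i :- (:1 :- x)) :+ :1 :* (y :- x)) ≡.refl qP ι X (qP * sq (K N)))
      rq : qF represents qP / 1#
      rq = rep-fromP qP
      ra : aF represents aP / 1#
      ra = rep-fromP aP
      rb : bF represents bP / 1#
      rb = rep-fromP bP
      reg-letter : ∀ y → Reg (letter y)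
      reg-letter y = nonZero⇒reg {letter y} (letter-nonZero y)
      left : lhs M represents U (suc M) / D (suc M)
      left = rep-sum W P denom (rep-term rq ra rb Identities.reg-1−q (reg-letter ℓa) (reg-letter ℓb) Identities.reg-1−K Identities.reg-oδ) M
      u₁ u₂ d₁ d₂ : Poly
      u₁ = (1# - aP * X) * (aP - X) * C.cb * (ι * Na)
      d₁ = r * Da
      u₂ = (1# - bP * X) * (bP - X) * C.ca * (ι * Nb)
      d₂ = r′ * Db
      right₁ : rhsPart aF bF n represents u₁ / d₁
      right₁ = subst (λ m → part rq ra rb Identities.reg-1−q (reg-letter ℓa) (nonZero⇒reg {r} nonZero-r) n m represents u₁ / d₁) (≡.sym quarter)
        (rep-part rq ra rb Identities.reg-1−q (reg-letter ℓa) (nonZero⇒reg {r} nonZero-r) Identities.reg-odd Identities.reg-a-y₄ n N ι hι)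
      right₂ : rhsPart bF aF n represents u₂ / d₂
      right₂ = subst (λ m → part rq rb ra Identities.reg-1−q (reg-letter ℓb) (nonZero⇒reg {r′} nonZero-r′) n m represents u₂ / d₂) (≡.sym quarter)
        (rep-part rq rb ra Identities.reg-1−q (reg-letter ℓb) (nonZero⇒reg {r′} nonZero-r′) Identities.reg-odd Identities.reg-b-y₄ n N ι hι)
      right : rhs n represents C.V / C.E₂
      right = rep-+ {rhsPart aF bF n} {rhsPart bF aF n} {u₁} {u₂} {d₁} {d₂} right₁ right₂

    quarter : (n ∸ 1) / 4 ≡ N
    quarter = ≡.trans (cong (_/ 4) (S.solve 1 (λ N → (N S.:+ N) S.:+ (N S.:+ N) S.:= N S.:* S.con 4) refl N)) (m*n/n≡m N 4)

    -- At a = q^n the series ends at k = 2N, exactly M, and at b = q^n already at k = N; hence the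
    -- offsets 0 and N.
    half-congruence : CongF (lhs h) (rhs n) (modulus n)
    half-congruence = congruent-sums h (half-sum h) (sum-a N qK²≈X ι ι≈ 0) (sum-b N qK²≈X ι ι≈ N) quarter

    full-congruence : CongF (lhs (h ℕ.+ h)) (rhs n) (modulus n)
    full-congruence = congruent-sums (h ℕ.+ h) (full-sum h) (sum-a N qK²≈X ι ι≈ h)
      (subst (λ k → Reduced.U qP aP X (suc k) * Da ≈ Reduced.D qP aP X (suc k) * (ι * Na)) (ℕₚ.+-assoc h N N) (sum-b N qK²≈X ι ι≈ (h ℕ.+ N))) quarter

theorem3p2 : (n M : ℕ) → 1 ≤ n → n % 4 ≡ 1 →
    (M ≡ (n ∸ 1) / 2 ⊎ M ≡ n ∸ 1) →
    CongF (lhs M) (rhs n) (modulus n)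
theorem3p2 n M _ n%4≡1 M≡ = ≡.subst (λ n → (M ≡ (n ∸ 1) / 2 ⊎ M ≡ n ∸ 1) → CongF (lhs M) (rhs n) (modulus n)) (≡.sym n≡) cases M≡
  where
  N h n′ : ℕ
  N  = n / 4
  h  = N ℕ.+ N
  n′ = suc (h ℕ.+ h)
  n≡ : n ≡ n′
  n≡ = ≡.trans (m≡m%n+[m/n]*n n 4) (≡.cong₂ ℕ._+_ n%4≡1 (S.solve 1 (λ N → N S.:* S.con 4 S.:= (N S.:+ N) S.:+ (N S.:+ N)) ≡.refl N))
  half : (h ℕ.+ h) / 2 ≡ h
  half = ≡.trans (≡.cong (_/ 2) (S.solve 1 (λ x → x S.:+ x S.:= x S.:* S.con 2) ≡.refl h)) (m*n/n≡m h 2)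
  cases : (M ≡ (h ℕ.+ h) / 2 ⊎ M ≡ h ℕ.+ h) → CongF (lhs M) (rhs n′) (modulus n′)
  cases (inj₁ e) = ≡.subst (λ M → CongF (lhs M) (rhs n′) (modulus n′)) (≡.sym (≡.trans e half)) (Main.half-congruence N)
  cases (inj₂ e) = ≡.subst (λ M → CongF (lhs M) (rhs n′) (modulus n′)) (≡.sym e) (Main.full-congruence N)
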